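{- There is a unique periodic triangulation of $\mathbb{Z}^3$ up to $\mathrm{GL}_3(\mathbb{Z})$-equivalence.
   Context: A periodic triangulation of $\mathbb{Z}^n$ is a collection $\mathcal{T}$ of $n$-dimensional simplices in $\mathbb{R}^n$ whose set of vertices is $\mathbb{Z}^n$, which cover $\mathbb{R}^n$, such that the intersection of any two simplices of $\mathcal{T}$ is a (possibly empty) face of both, and such that $\mathcal{T}+v=\mathcal{T}$ for every $v\in\mathbb{Z}^n$. Two periodic triangulations $\mathcal{T},\mathcal{T}'$ of $\mathbb{Z}^n$ are $\mathrm{GL}_n(\mathbb{Z})$-equivalent if $\mathcal{T}'=g\mathcal{T}$ for some $g\in\mathrm{GL}_n(\mathbb{Z})$. -}

module Defs where

open import Algebra.Bundles using (CommutativeRing)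
import Algebra.Definitions.RawMonoid as RawMonoidDefs
open import Data.Bool.Base using (if_then_else_)
open import Data.Fin.Base using (Fin)
open import Data.Fin.Properties using (_≟_)
open import Data.Fin.Subset using (Subset; ⊤) renaming (_∉_ to _∉ₛ_)
import Data.Integer.Base as ℤ
import Data.Integer.Properties as ℤ
open import Data.Integer.Base using (ℤ; +_; -[1+_])
open import Data.Nat.Base using (ℕ; suc)
open import Data.Product.Base using (_×_; ∃)
open import Data.Vec.Functional using (Vector)
open import Level using (0ℓ) renaming (suc to lsuc)
open import Relation.Binary.Core using (Rel)
open import Relation.Binary.Definitions using (_Respects_)
open import Relation.Binary.PropositionalEquality using (_≡_)
open import Relation.Binary.Structures using (IsTotalOrder)
open import Relation.Nullary.Decidable.Core using (does)
open import Relation.Nullary.Negation.Core using (¬_)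
open import Relation.Unary using (Pred; _∈_; _∩_; _≐_; Satisfiable)

-- The reals, given axiomatically as a complete ordered field; classically this
-- determines them up to unique isomorphism.  Equality is a setoid equality, so
-- that Dedekind cuts are a model (assuming excluded middle).
record RealNumbers : Set (lsuc 0ℓ) where
  infix 4 _≤_
  field
    commutativeRing : CommutativeRing 0ℓ 0ℓ

  open CommutativeRing commutativeRing public

  field
    _≤_          : Rel Carrier 0ℓ
    isTotalOrder : IsTotalOrder _≈_ _≤_
    0≉1          : ¬ (0# ≈ 1#)
    inverse      : ∀ x → ¬ (x ≈ 0#) → ∃ λ y → x * y ≈ 1#
    +-monoˡ-≤    : ∀ z {x y} → x ≤ y → x + z ≤ y + z
    *-nonNeg     : ∀ {x y} → 0# ≤ x → 0# ≤ y → 0# ≤ x * y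

  UpperBound : Pred Carrier 0ℓ → Pred Carrier 0ℓ
  UpperBound S b = ∀ {x} → x ∈ S → x ≤ b

  field
    supremum : (S : Pred Carrier 0ℓ) → Satisfiable S → Satisfiable (UpperBound S) →
               ∃ λ s → s ∈ UpperBound S × (∀ {b} → b ∈ UpperBound S → s ≤ b)

Matrix : ℕ → Set
Matrix n = Fin n → Fin n → ℤ

identity : ∀ {n} → Matrix n
identity i j = if does (i ≟ j) then + 1 else + 0

infixl 7 _⊛_
_⊛_ : ∀ {n} → Matrix n → Matrix n → Matrix n
(a ⊛ b) i k = sum (λ j → a i j ℤ.* b j k)
  where open RawMonoidDefs ℤ.+-0-rawMonoid using (sum)

record GL (n : ℕ) : Set where
  field
    matrix   : Matrix n
    inverse  : Matrix n
    inverseˡ : ∀ i j → (inverse ⊛ matrix) i j ≡ identity i j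
    inverseʳ : ∀ i j → (matrix ⊛ inverse) i j ≡ identity i j

module _ (ℝ : RealNumbers) where
  open RealNumbers ℝ
  open RawMonoidDefs +-rawMonoid using (sum) renaming (_×_ to _·_)

  fromℤ : ℤ → Carrier
  fromℤ (+ m)    = m · 1#
  fromℤ -[1+ m ] = - (suc m · 1#)

  Point : ℕ → Set
  Point n = Vector Carrier n

  lattice : ∀ {n} → Vector ℤ n → Point n
  lattice z k = fromℤ (z k)

  infix 4 _≈ₚ_ _≋_ _IsFaceOf_

  _≈ₚ_ : ∀ {n} → Rel (Point n) 0ℓ
  x ≈ₚ y = ∀ k → x k ≈ y k

  translate : ∀ {n} → Vector ℤ n → Point n → Point n
  translate v x k = x k + lattice v k

  act : ∀ {n} → GL n → Point n → Point n
  act g x i = sum (λ j → fromℤ (GL.matrix g i j) * x j)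

  combination : ∀ {m n} → Vector Carrier m → Vector (Point n) m → Point n
  combination c p k = sum (λ i → c i * p i k)

  AffinelyIndependent : ∀ {m n} → Pred (Vector (Point n) m) 0ℓ
  AffinelyIndependent p =
    ∀ c → sum c ≈ 0# → combination c p ≈ₚ (λ _ → 0#) → ∀ i → c i ≈ 0#

  record Simplex (n : ℕ) : Set where
    field
      vertex      : Vector (Point n) (suc n)
      independent : AffinelyIndependent vertex

  open Simplex

  range : ∀ {m n} → Vector (Point n) m → Pred (Point n) 0ℓ
  range p x = ∃ λ i → x ≈ₚ p i

  -- Simplices carry an enumeration of their vertices; as geometric objects they
  -- are equal when they have the same vertex set.
  _≋_ : ∀ {n} → Rel (Simplex n) 0ℓ
  σ ≋ τ = range (vertex σ) ≐ range (vertex τ)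

  -- The convex hull of the vertices with index in S.  It is empty for S empty,
  -- since then all coefficients vanish while their sum is 1.
  face : ∀ {n} → Simplex n → Subset (suc n) → Pred (Point n) 0ℓ
  face σ S x = ∃ λ c → (∀ i → 0# ≤ c i) × (∀ i → i ∉ₛ S → c i ≈ 0#) ×
                       sum c ≈ 1# × combination c (vertex σ) ≈ₚ x

  body : ∀ {n} → Simplex n → Pred (Point n) 0ℓ
  body σ = face σ ⊤

  _IsFaceOf_ : ∀ {n} → Pred (Point n) 0ℓ → Simplex n → Set
  P IsFaceOf σ = ∃ λ S → P ≐ face σ S

  Collection : ℕ → Set (lsuc 0ℓ)
  Collection n = Pred (Simplex n) 0ℓ

  -- The collection { f σ | σ ∈ T }, for a map f taking simplices to simplices.
  image : ∀ {n} → (Point n → Point n) → Collection n → Collection n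
  image f T τ = ∃ λ σ → σ ∈ T × range (vertex τ) ≐ range (λ i → f (vertex σ i))

  record IsPeriodicTriangulation (n : ℕ) (T : Collection n) : Set where
    field
      respects     : T Respects _≋_
      vertices     : (λ x → ∃ λ σ → σ ∈ T × x ∈ range (vertex σ)) ≐
                     (λ x → ∃ λ z → x ≈ₚ lattice z)
      covers       : ∀ x → ∃ λ σ → σ ∈ T × x ∈ body σ
      intersection : ∀ {σ τ} → σ ∈ T → τ ∈ T →
                     (body σ ∩ body τ) IsFaceOf σ × (body σ ∩ body τ) IsFaceOf τ
      periodic     : ∀ v → image (translate v) T ≐ T

  GLEquivalent : (n : ℕ) → Collection n → Collection n → Set
  GLEquivalent n T T′ = ∃ λ (g : GL n) → T′ ≐ image (act g) T

-- Existence.  The vertices of a Kuhn simplex differ pairwise by 0/1-vectors up to sign.  Sorting the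
-- fractional parts of its coordinates puts any point into a Kuhn simplex.  Each of the linear forms
-- xₖ and xₖ - xₗ takes at most two values, consecutive integers, at the vertices of such a simplex.
-- So if two of them have a common point, then the vertices with positive weight in the one differ
-- from all vertices of the other by 0/1-vectors up to sign, and hence are among them.
--
-- Uniqueness.  Edges that are congruent modulo 2 are equal up to sign, because suitable translates
-- have a common midpoint.  If a simplex w₀w₁w₂w₃ were not unimodular, then it would overlap with one
-- of its lattice translates.  So a = w₁ - w₀, b = w₂ - w₀, c = w₃ - w₀ may be taken as the standard
-- basis.  The edges in the six classes of a, b, c, a - b, a - c, b - c modulo 2 are known; a simplex
-- covering (a + b + c) / 2 also has an edge D in the remaining class, and its other edges show that
-- D is one of a + b - c, a - b + c, b + c - a up to sign.  The seven edges so obtained are those of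
-- the Kuhn triangulation in another basis.  Hence all simplices are Kuhn simplices in that basis,
-- and all Kuhn simplices occur because their barycentres are covered.
module Submission where

open import Defs
import Algebra.Properties.Ring as RingProperties
import Algebra.Properties.Semiring.Mult as SemiringMult
import Algebra.Properties.Semiring.Sum as SemiringSum
import Algebra.Solver.Ring as RingSolver
import Algebra.Solver.Ring.AlmostCommutativeRing as ACR
open import Axiom.ExcludedMiddle using (ExcludedMiddle)
open import Data.Bool.Base using (Bool; true; false; if_then_else_)
open import Data.Empty using (⊥; ⊥-elim)
open import Data.Fin.Base as Fin using (Fin; zero; suc)
open import Data.Fin.Patterns using (0F; 1F; 2F; 3F)
open import Data.Fin.Permutation as Perm using (Permutation′; _⟨$⟩ʳ_; _⟨$⟩ˡ_; _∘ₚ_)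
import Data.Fin.Properties as Fin
open import Data.Fin.Subset using (Subset) renaming (_∈_ to _∈ₛ_; _∉_ to _∉ₛ_)
open import Data.Fin.Subset.Properties using (∈⊤; _∈?_)
open import Data.Integer.Base as ℤ using (ℤ; +_; -[1+_]; _⊖_)
import Data.Integer.DivMod as ℤ
import Data.Integer.Divisibility.Signed as ℤ
import Data.Integer.Properties as ℤ
import Data.Integer.Tactic.RingSolver as ℤ-Ring
open import Data.Maybe.Base using (Maybe; just; nothing)
open import Data.Nat.Base as ℕ using (ℕ; zero; suc; z≤n; s≤s)
import Data.Nat.Properties as ℕ
open import Data.Product using (_×_; _,_; ∃; ∃!; proj₁; proj₂)
open import Data.Sum as Sum using (_⊎_; inj₁; inj₂)
open import Data.Vec using (tabulate)
open import Data.Vec.Functional using (Vector; []; _∷_)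
open import Data.Vec.Properties using (lookup∘tabulate; []=⇒lookup; lookup⇒[]=)
open import Function using (_∘_)
open import Level using (0ℓ)
open import Relation.Binary.Definitions using (_Respects_)
open import Relation.Binary.PropositionalEquality as ≡ using (_≡_; _≗_)
import Relation.Binary.Reasoning.Setoid as SetoidReasoning
open import Relation.Binary.Structures using (IsTotalOrder)
open import Relation.Nullary using (¬_; Dec; does; yes; no)
open import Relation.Nullary.Decidable using (dec-true; from-yes; map′; _→-dec_; _×-dec_; _⊎-dec_; ¬?)
open import Relation.Unary using (_∈_; _∩_)

-- Unimodularity cannot come from the simplices being free of further lattice points: in dimension
-- three such simplices, for example the Reeve tetrahedra, have arbitrarily large volume. What
-- excludes them is periodicity. A lattice vector outside the lattice spanned by the edges has,
-- modulo that lattice, barycentric coordinates in [0, 1) with sum K equal to 1, 2 or 3. Subtracting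
-- 1 from K of them gives a translation, and the simplex and its translate share an interior point
-- as soon as the remaining coordinates sum to less than 1. No choice works only if K = 2 and all
-- four coordinates are 1/2, and then two opposite edges are congruent modulo 2.
--
-- All of this is integral, so `CellSystem` separates it from the real numbers: common points enter
-- with integral weights, and covering enters at half-lattice points, in dual form. The finitely
-- many cases left over the integers are settled by decision procedures.

module ℤΣ = SemiringSum ℤ.+-*-semiring

-- Integer vectors and matrices

infix 8 _∙_ _·_
_∙_ : ∀ {n} → Vector ℤ n → Vector ℤ n → ℤ
s ∙ z = ℤΣ.sum (λ k → s k ℤ.* z k)

_·_ : ∀ {m n} → Vector ℤ m → Vector (Vector ℤ n) m → Vector ℤ n
(s · w) k = s ∙ (λ i → w i k)

infixl 6 _+ᵥ_ _-ᵥ_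
_+ᵥ_ _-ᵥ_ : ∀ {n} → Vector ℤ n → Vector ℤ n → Vector ℤ n
(z +ᵥ z′) k = z k ℤ.+ z′ k
(z -ᵥ z′) k = z k ℤ.- z′ k

-- Lets the ring solver, which knows no hypotheses, make use of the equation a ≡ b.
transfer : ∀ {a b c d} → a ≡ b → c ℤ.- d ≡ a ℤ.- b → c ≡ d
transfer {a} ≡.refl c-d≡ = ℤ.i-j≡0⇒i≡j _ _ (≡.trans c-d≡ (ℤ.+-inverseʳ a))

∙-congˡ : ∀ {n} {s t : Vector ℤ n} z → s ≗ t → s ∙ z ≡ t ∙ z
∙-congˡ z s≗t = ℤΣ.sum-cong-≗ (λ k → ≡.cong (ℤ._* z k) (s≗t k))

∙-congʳ : ∀ {n} (s : Vector ℤ n) {y z} → y ≗ z → s ∙ y ≡ s ∙ z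
∙-congʳ s y≗z = ℤΣ.sum-cong-≗ (λ k → ≡.cong (s k ℤ.*_) (y≗z k))

∙-+ˡ : ∀ {n} (s t z : Vector ℤ n) → (s +ᵥ t) ∙ z ≡ s ∙ z ℤ.+ t ∙ z
∙-+ˡ s t z = ≡.trans (ℤΣ.sum-cong-≗ (λ k → ℤ.*-distribʳ-+ (z k) (s k) (t k)))
  (ℤΣ.∑-distrib-+ (λ k → s k ℤ.* z k) (λ k → t k ℤ.* z k))

∙-comm : ∀ {n} (s z : Vector ℤ n) → s ∙ z ≡ z ∙ s
∙-comm s z = ℤΣ.sum-cong-≗ (λ k → ℤ.*-comm (s k) (z k))

∙-+ʳ : ∀ {n} (s y z : Vector ℤ n) → s ∙ (y +ᵥ z) ≡ s ∙ y ℤ.+ s ∙ z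
∙-+ʳ s y z = ≡.trans (∙-comm s _) (≡.trans (∙-+ˡ y z s) (≡.cong₂ ℤ._+_ (∙-comm y s) (∙-comm z s)))

∙-scaleˡ : ∀ {n} c (s z : Vector ℤ n) → (λ k → c ℤ.* s k) ∙ z ≡ c ℤ.* s ∙ z
∙-scaleˡ c s z = ≡.trans (ℤΣ.sum-cong-≗ (λ k → ℤ.*-assoc c (s k) (z k)))
  (≡.sym (ℤΣ.*-distribˡ-sum c (λ k → s k ℤ.* z k)))

∙-scaleʳ : ∀ {n} c (s z : Vector ℤ n) → s ∙ (λ k → c ℤ.* z k) ≡ c ℤ.* s ∙ z
∙-scaleʳ c s z = ≡.trans (∙-comm s _) (≡.trans (∙-scaleˡ c z s) (≡.cong (c ℤ.*_) (∙-comm z s)))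

∙--ʳ : ∀ {n} (s y z : Vector ℤ n) → s ∙ (y -ᵥ z) ≡ s ∙ y ℤ.- s ∙ z
∙--ʳ s y z = ≡.trans (∙-congʳ s (λ k → ≡.cong (ℤ._+_ (y k)) (≡.sym (ℤ.-1*i≡-i (z k)))))
  (≡.trans (∙-+ʳ s y (λ k → ℤ.-1ℤ ℤ.* z k))
    (≡.cong (ℤ._+_ (s ∙ y)) (≡.trans (∙-scaleʳ ℤ.-1ℤ s z) (ℤ.-1*i≡-i (s ∙ z)))))

∙--ˡ : ∀ {n} (s t z : Vector ℤ n) → (s -ᵥ t) ∙ z ≡ s ∙ z ℤ.- t ∙ z
∙--ˡ s t z = ≡.trans (∙-comm _ z) (≡.trans (∙--ʳ z s t) (≡.cong₂ ℤ._-_ (∙-comm z s) (∙-comm z t)))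

sum-zeros : ∀ n → ℤΣ.sum {n} (λ _ → + 0) ≡ + 0
sum-zeros zero    = ≡.refl
sum-zeros (suc n) = ≡.trans (ℤ.+-identityˡ _) (sum-zeros n)

identity-∙ : ∀ {n} (i : Fin n) z → identity i ∙ z ≡ z i
identity-∙ {suc n} zero    z = ≡.trans (≡.cong₂ ℤ._+_ (ℤ.*-identityˡ (z zero))
  (≡.trans (ℤΣ.sum-cong-≗ (λ k → ℤ.*-zeroˡ (z (suc k)))) (sum-zeros n))) (ℤ.+-identityʳ _)
identity-∙ (suc i) z = ≡.trans (ℤ.+-identityˡ _) (identity-∙ i (z ∘ suc))

identity-sym : ∀ {n} (i j : Fin n) → identity i j ≡ identity j i
identity-sym zero    zero    = ≡.refl
identity-sym zero    (suc j) = ≡.refl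
identity-sym (suc i) zero    = ≡.refl
identity-sym (suc i) (suc j) = identity-sym i j

∙-identity : ∀ {n} z (i : Fin n) → z ∙ identity i ≡ z i
∙-identity z i = ≡.trans (∙-comm z _) (identity-∙ i z)

apply : ∀ {n} → Matrix n → Vector ℤ n → Vector ℤ n
apply a z i = a i ∙ z

apply-⊛ : ∀ {n} (a b : Matrix n) z → apply (a ⊛ b) z ≗ apply a (apply b z)
apply-⊛ a b z i = begin
  ℤΣ.sum (λ k → ℤΣ.sum (λ j → a i j ℤ.* b j k) ℤ.* z k)
    ≡⟨ ℤΣ.sum-cong-≗ (λ k → ℤΣ.*-distribʳ-sum (z k) (λ j → a i j ℤ.* b j k)) ⟩
  ℤΣ.sum (λ k → ℤΣ.sum (λ j → a i j ℤ.* b j k ℤ.* z k))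
    ≡⟨ ℤΣ.∑-comm (λ k j → a i j ℤ.* b j k ℤ.* z k) ⟩
  ℤΣ.sum (λ j → ℤΣ.sum (λ k → a i j ℤ.* b j k ℤ.* z k))
    ≡⟨ ℤΣ.sum-cong-≗ (λ j → ≡.trans (ℤΣ.sum-cong-≗ (λ k → ℤ.*-assoc (a i j) (b j k) (z k)))
         (≡.sym (ℤΣ.*-distribˡ-sum (a i j) (λ k → b j k ℤ.* z k)))) ⟩
  ℤΣ.sum (λ j → a i j ℤ.* apply b z j) ∎
  where open ≡.≡-Reasoning

apply-cong : ∀ {n} (a : Matrix n) {y z} → y ≗ z → apply a y ≗ apply a z
apply-cong a y≗z i = ∙-congʳ (a i) y≗z

apply-- : ∀ {n} (a : Matrix n) y z → apply a (y -ᵥ z) ≗ apply a y -ᵥ apply a z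
apply-- a y z i = ∙--ʳ (a i) y z

apply-≡identity : ∀ {n} {a : Matrix n} → (∀ i j → a i j ≡ identity i j) → ∀ z → apply a z ≗ z
apply-≡identity a≡1 z i = ≡.trans (∙-congˡ z (a≡1 i)) (identity-∙ i z)

apply-inverseˡ : ∀ {n} (g : GL n) z → apply (GL.inverse g) (apply (GL.matrix g) z) ≗ z
apply-inverseˡ g z i = ≡.trans (≡.sym (apply-⊛ (GL.inverse g) (GL.matrix g) z i))
  (apply-≡identity (GL.inverseˡ g) z i)

apply-inverseʳ : ∀ {n} (g : GL n) z → apply (GL.matrix g) (apply (GL.inverse g) z) ≗ z
apply-inverseʳ g z i = ≡.trans (≡.sym (apply-⊛ (GL.matrix g) (GL.inverse g) z i))
  (apply-≡identity (GL.inverseʳ g) z i)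

-- From `a b = 1` follows `a (b a) = a`, and injectivity of `a` cancels the left factor, column by
-- column.
rightInverse⇒GL : ∀ {n} (a b : Matrix n) → (∀ y z → apply a y ≗ apply a z → y ≗ z) →
                  (∀ i j → (a ⊛ b) i j ≡ identity i j) → GL n
rightInverse⇒GL a b injective ab≡1 = record
  { matrix   = a
  ; inverse  = b
  ; inverseˡ = λ i j → ≡.trans (injective _ (identity j) (ba≗1 j) i) (identity-sym j i)
  ; inverseʳ = ab≡1
  }
  where
  ba≗1 : ∀ j → apply a (apply b (λ i → a i j)) ≗ apply a (identity j)
  ba≗1 j i = ≡.trans (≡.sym (apply-⊛ a b (λ i → a i j) i))
    (≡.trans (apply-≡identity ab≡1 (λ i → a i j) i) (≡.sym (∙-identity (a i) j)))

_∘GL_ : ∀ {n} → GL n → GL n → GL n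
g ∘GL h = record
  { matrix   = G.matrix ⊛ H.matrix
  ; inverse  = H.inverse ⊛ G.inverse
  ; inverseˡ = inverses H.inverse G.inverse G.matrix H.matrix G.inverseˡ H.inverseˡ
  ; inverseʳ = inverses G.matrix H.matrix H.inverse G.inverse H.inverseʳ G.inverseʳ
  }
  where
  module G = GL g
  module H = GL h
  inverses : ∀ a b c d → (∀ i j → (b ⊛ c) i j ≡ identity i j) → (∀ i j → (a ⊛ d) i j ≡ identity i j) →
             ∀ i j → ((a ⊛ b) ⊛ (c ⊛ d)) i j ≡ identity i j
  inverses a b c d bc≡1 ad≡1 i j = ≡.trans (apply-⊛ a b (λ k → (c ⊛ d) k j) i)
    (≡.trans (apply-cong a (λ k → ≡.trans (≡.sym (apply-⊛ b c (λ l → d l j) k))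
      (apply-≡identity bc≡1 (λ l → d l j) k)) i) (ad≡1 i j))

-- Edges modulo 2

infix 4 _≡₂_
-- A record instead of a plain function type, so that both vectors can be inferred from the type of
-- a congruence.
record _≡₂_ {n} (z z′ : Vector ℤ n) : Set where
  constructor modulo₂
  field
    even : ∀ k → + 2 ℤ.∣ z k ℤ.- z′ k

open _≡₂_

-- The integral content of a periodic triangulation: Cell w stands for the lattice points w being the
-- vertices of a simplex.  half-covers says that some simplex contains u / 2, by integral half-spaces.
record CellSystem (Cell : Vector (Vector ℤ 3) 4 → Set) : Set where
  field
    translated  : ∀ {w} → Cell w → ∀ v → Cell (λ i → w i +ᵥ v)
    independent : ∀ {w} → Cell w → ∀ (s : Vector ℤ 4) → ℤΣ.sum s ≡ + 0 →
                  (∀ k → (s · w) k ≡ + 0) → ∀ i → s i ≡ + 0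
    support     : ∀ {w w′} → Cell w → Cell w′ → ∀ {s s′ : Vector ℤ 4} {N} →
                  (∀ i → + 0 ℤ.≤ s i) → (∀ i → + 0 ℤ.≤ s′ i) →
                  ℤΣ.sum s ≡ + suc N → ℤΣ.sum s′ ≡ + suc N → (∀ k → (s · w) k ≡ (s′ · w′) k) →
                  ∀ i → ¬ s i ≡ + 0 → ∃ λ j → ¬ s′ j ≡ + 0 × w i ≗ w′ j
    half-covers : ∀ u → ∃ λ w → Cell w ×
                  (∀ f m → (∀ j → m ℤ.≤ f ∙ w j) → + 2 ℤ.* m ℤ.≤ f ∙ u)

module Edges {Cell} (system : CellSystem Cell) where
  open CellSystem system

  private
    e : Fin 4 → Vector ℤ 4
    e = identity

  combine₄ : ∀ (w : Vector (Vector ℤ 3) 4) i j k l p →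
             ((e i +ᵥ e l -ᵥ e j -ᵥ e k) · w) p ≡ w i p ℤ.+ w l p ℤ.- w j p ℤ.- w k p
  combine₄ w i j k l p = begin
    (e i +ᵥ e l -ᵥ e j -ᵥ e k) ∙ z              ≡⟨ ∙--ˡ (e i +ᵥ e l -ᵥ e j) (e k) z ⟩
    (e i +ᵥ e l -ᵥ e j) ∙ z ℤ.- e k ∙ z         ≡⟨ ≡.cong₂ ℤ._-_ (∙--ˡ (e i +ᵥ e l) (e j) z) (identity-∙ k z) ⟩
    (e i +ᵥ e l) ∙ z ℤ.- e j ∙ z ℤ.- z k        ≡⟨ ≡.cong₂ (λ a b → a ℤ.- b ℤ.- z k) (∙-+ˡ (e i) (e l) z) (identity-∙ j z) ⟩
    e i ∙ z ℤ.+ e l ∙ z ℤ.- z j ℤ.- z k         ≡⟨ ≡.cong₂ (λ a b → a ℤ.+ b ℤ.- z j ℤ.- z k) (identity-∙ i z) (identity-∙ l z) ⟩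
    z i ℤ.+ z l ℤ.- z j ℤ.- z k                 ∎
    where
    open ≡.≡-Reasoning
    z = λ a → w a p

  -- The coincidence is an affine dependence, so its coefficient vector is zero. What this means for
  -- the indices, which may coincide, is then a finite check.
  vanishing-combination : ∀ {w} → Cell w → ∀ i j k l → w i +ᵥ w l ≗ w j +ᵥ w k →
                          ∀ a → (e i +ᵥ e l -ᵥ e j -ᵥ e k) a ≡ + 0
  vanishing-combination {w} cell i j k l same = independent cell (e i +ᵥ e l -ᵥ e j -ᵥ e k) (decided i j k l)
    (λ p → ≡.trans (combine₄ w i j k l p) (transfer (same p) (rearrange (w i p) (w l p) (w j p) (w k p))))
    where
    rearrange : ∀ a b c d → (a ℤ.+ b ℤ.- c ℤ.- d) ℤ.- + 0 ≡ (a ℤ.+ b) ℤ.- (c ℤ.+ d)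
    rearrange = ℤ-Ring.solve-∀
    decided : ∀ i j k l → ℤΣ.sum (e i +ᵥ e l -ᵥ e j -ᵥ e k) ≡ + 0
    decided = from-yes (Fin.all? λ i → Fin.all? λ j → Fin.all? λ k → Fin.all? λ l →
      ℤΣ.sum (e i +ᵥ e l -ᵥ e j -ᵥ e k) ℤ.≟ + 0)

  vertex-injective : ∀ {w} → Cell w → ∀ i j → w i ≗ w j → i ≡ j
  vertex-injective {w} cell i j wi≗wj = decided i j (vanishing-combination cell i j i i
    (λ p → ≡.trans (≡.cong (ℤ._+ w i p) (wi≗wj p)) ≡.refl))
    where
    decided : ∀ i j → (∀ a → (e i +ᵥ e i -ᵥ e j -ᵥ e i) a ≡ + 0) → i ≡ j
    decided = from-yes (Fin.all? λ i → Fin.all? λ j →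
      (Fin.all? λ a → (e i +ᵥ e i -ᵥ e j -ᵥ e i) a ℤ.≟ + 0) →-dec (i Fin.≟ j))

  edge-injective : ∀ {w} → Cell w → ∀ i j k l → ¬ i ≡ j → w i -ᵥ w j ≗ w k -ᵥ w l → i ≡ k × j ≡ l
  edge-injective {w} cell i j k l i≢j same = decided i j k l i≢j (vanishing-combination cell i j k l
    (λ p → transfer (same p) (rearrange (w i p) (w j p) (w k p) (w l p))))
    where
    rearrange : ∀ a b c d → (a ℤ.+ d) ℤ.- (b ℤ.+ c) ≡ (a ℤ.- b) ℤ.- (c ℤ.- d)
    rearrange = ℤ-Ring.solve-∀
    decided : ∀ i j k l → ¬ i ≡ j → (∀ a → (e i +ᵥ e l -ᵥ e j -ᵥ e k) a ≡ + 0) → i ≡ k × j ≡ l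
    decided = from-yes (Fin.all? λ i → Fin.all? λ j → Fin.all? λ k → Fin.all? λ l → ¬? (i Fin.≟ j) →-dec
      (Fin.all? λ a → (e i +ᵥ e l -ᵥ e j -ᵥ e k) a ℤ.≟ + 0) →-dec (i Fin.≟ k) ×-dec (j Fin.≟ l))

  -- The midpoints of congruent edges differ by a lattice vector, and a translate of the second edge
  -- meets the first one in its midpoint.
  congruent-edges : ∀ {w w′} → Cell w → Cell w′ → ∀ i j k l → ¬ i ≡ j → w i -ᵥ w j ≡₂ w′ k -ᵥ w′ l →
                    (w i -ᵥ w j ≗ w′ k -ᵥ w′ l) ⊎ (w i -ᵥ w j ≗ w′ l -ᵥ w′ k)
  congruent-edges {w} {w′} cell cell′ i j k l i≢j congruent =
    conclude (endpoint i (proj₁ (nonzero i j))) (endpoint j (proj₂ (nonzero i j)))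
    where
    h : Vector ℤ 3
    h p = ℤ.quotient (even congruent p)
    -- `h` is half the difference of the two edges, and `t` is the solution of
    -- `w i + w j = (w′ k + t) + (w′ l + t)`.
    t : Vector ℤ 3
    t = w j -ᵥ w′ l +ᵥ h
    w″ = λ a → w′ a +ᵥ t
    nonNeg : ∀ i j a → + 0 ℤ.≤ (e i +ᵥ e j) a
    nonNeg = from-yes (Fin.all? λ i → Fin.all? λ j → Fin.all? λ a → + 0 ℤ.≤? (e i +ᵥ e j) a)
    sum≡2 : ∀ i j → ℤΣ.sum (e i +ᵥ e j) ≡ + 2
    sum≡2 = from-yes (Fin.all? λ i → Fin.all? λ j → ℤΣ.sum (e i +ᵥ e j) ℤ.≟ + 2)
    nonzero : ∀ i j → ¬ (e i +ᵥ e j) i ≡ + 0 × ¬ (e i +ᵥ e j) j ≡ + 0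
    nonzero = from-yes (Fin.all? λ i → Fin.all? λ j →
      ¬? ((e i +ᵥ e j) i ℤ.≟ + 0) ×-dec ¬? ((e i +ᵥ e j) j ℤ.≟ + 0))
    supported : ∀ k l a → ¬ (e k +ᵥ e l) a ≡ + 0 → a ≡ k ⊎ a ≡ l
    supported = from-yes (Fin.all? λ k → Fin.all? λ l → Fin.all? λ a →
      ¬? ((e k +ᵥ e l) a ℤ.≟ + 0) →-dec ((a Fin.≟ k) ⊎-dec (a Fin.≟ l)))
    combine₂ : ∀ (w : Vector (Vector ℤ 3) 4) i j p → ((e i +ᵥ e j) · w) p ≡ w i p ℤ.+ w j p
    combine₂ w i j p = ≡.trans (∙-+ˡ (e i) (e j) (λ a → w a p))
      (≡.cong₂ ℤ._+_ (identity-∙ i (λ a → w a p)) (identity-∙ j (λ a → w a p)))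
    midpoints : ∀ p → ((e i +ᵥ e j) · w) p ≡ ((e k +ᵥ e l) · w″) p
    midpoints p = ≡.trans (combine₂ w i j p) (≡.trans
      (transfer (ℤ._∣_.equality (even congruent p)) (rearrange (w i p) (w j p) (w′ k p) (w′ l p) (h p)))
      (≡.sym (combine₂ w″ k l p)))
      where
      rearrange : ∀ x y k l h → (x ℤ.+ y) ℤ.- ((k ℤ.+ (y ℤ.- l ℤ.+ h)) ℤ.+ (l ℤ.+ (y ℤ.- l ℤ.+ h))) ≡
                  (x ℤ.- y ℤ.- (k ℤ.- l)) ℤ.- h ℤ.* + 2
      rearrange = ℤ-Ring.solve-∀
    endpoint : ∀ a → ¬ (e i +ᵥ e j) a ≡ + 0 → ∃ λ b → (b ≡ k ⊎ b ≡ l) × w a ≗ w″ b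
    endpoint a a∈ij = proj₁ found , supported k l (proj₁ found) (proj₁ (proj₂ found)) , proj₂ (proj₂ found)
      where
      found : ∃ λ b → ¬ (e k +ᵥ e l) b ≡ + 0 × w a ≗ w″ b
      found = support {w} {w″} cell (translated cell′ t) {e i +ᵥ e j} {e k +ᵥ e l} {1}
        (nonNeg i j) (nonNeg k l) (sum≡2 i j) (sum≡2 k l) midpoints a a∈ij
    difference : ∀ {a b} → w i ≗ w″ a → w j ≗ w″ b → w i -ᵥ w j ≗ w′ a -ᵥ w′ b
    difference {a} {b} wi≗ wj≗ p = ≡.trans (≡.cong₂ ℤ._-_ (wi≗ p) (wj≗ p)) (cancel (w′ a p) (w′ b p) (t p))
      where
      cancel : ∀ x y z → (x ℤ.+ z) ℤ.- (y ℤ.+ z) ≡ x ℤ.- y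
      cancel = ℤ-Ring.solve-∀
    conclude : (∃ λ b → (b ≡ k ⊎ b ≡ l) × w i ≗ w″ b) → (∃ λ b → (b ≡ k ⊎ b ≡ l) × w j ≗ w″ b) →
               (w i -ᵥ w j ≗ w′ k -ᵥ w′ l) ⊎ (w i -ᵥ w j ≗ w′ l -ᵥ w′ k)
    conclude (_ , inj₁ ≡.refl , i≗k) (_ , inj₂ ≡.refl , j≗l) = inj₁ (difference {k} {l} i≗k j≗l)
    conclude (_ , inj₂ ≡.refl , i≗l) (_ , inj₁ ≡.refl , j≗k) = inj₂ (difference {l} {k} i≗l j≗k)
    conclude (_ , inj₁ ≡.refl , i≗k) (_ , inj₁ ≡.refl , j≗k) =
      ⊥-elim (i≢j (vertex-injective cell i j (λ p → ≡.trans (i≗k p) (≡.sym (j≗k p)))))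
    conclude (_ , inj₂ ≡.refl , i≗l) (_ , inj₂ ≡.refl , j≗l) =
      ⊥-elim (i≢j (vertex-injective cell i j (λ p → ≡.trans (i≗l p) (≡.sym (j≗l p)))))

  -- Affine independence rules out two parallel edges of equal length in one cell. So the six edges
  -- of a cell lie in six different classes modulo 2.
  same-edge : ∀ {w} → Cell w → ∀ i j k l → ¬ i ≡ j → w i -ᵥ w j ≡₂ w k -ᵥ w l →
              (i ≡ k × j ≡ l) ⊎ (i ≡ l × j ≡ k)
  same-edge {w} cell i j k l i≢j congruent = Sum.map (edge-injective cell i j k l i≢j)
    (edge-injective cell i j l k i≢j) (congruent-edges {w} {w} cell cell i j k l i≢j congruent)

  -- If `w 0F = w j + v` and `w j = w l + v`, then `w 0F`, `w j`, `w l` form an arithmetic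
  -- progression, which affinely independent points contain only if it is constant.
  constant-shift : ∀ {w} → Cell w → ∀ v → (∀ i → ∃ λ j → w i ≗ w j +ᵥ v) → ∀ k → v k ≡ + 0
  constant-shift {w} cell v shift k = transfer
    (≡.sym (≡.trans (proj₂ (shift 0F) k) (≡.cong (λ a → w a k ℤ.+ v k) (≡.sym 0≡j))))
    (rearrange (w 0F k) (v k))
    where
    j = proj₁ (shift 0F)
    l = proj₁ (shift j)
    decided : ∀ j l → (∀ a → (e 0F +ᵥ e l -ᵥ e j -ᵥ e j) a ≡ + 0) → 0F ≡ j
    decided = from-yes (Fin.all? λ j → Fin.all? λ l →
      (Fin.all? λ a → (e 0F +ᵥ e l -ᵥ e j -ᵥ e j) a ℤ.≟ + 0) →-dec (0F Fin.≟ j))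
    rearrange : ∀ x v → v ℤ.- + 0 ≡ (x ℤ.+ v) ℤ.- x
    rearrange = ℤ-Ring.solve-∀
    0≡j : 0F ≡ j
    0≡j = decided j l (vanishing-combination cell 0F j j l (λ p → progression p))
      where
      expand : ∀ a b v → (b ℤ.+ v ℤ.+ a) ℤ.- (b ℤ.+ b) ≡ (a ℤ.+ v) ℤ.- b
      expand = ℤ-Ring.solve-∀
      progression : ∀ p → w 0F p ℤ.+ w l p ≡ w j p ℤ.+ w j p
      progression p = ≡.trans (≡.cong (ℤ._+ w l p) (proj₂ (shift 0F) p))
        (transfer (≡.sym (proj₂ (shift j) p)) (expand (w l p) (w j p) (v p)))

-- Unimodularity

cross : Vector ℤ 3 → Vector ℤ 3 → Vector ℤ 3
cross b c = (b 1F ℤ.* c 2F ℤ.- b 2F ℤ.* c 1F) ∷ (b 2F ℤ.* c 0F ℤ.- b 0F ℤ.* c 2F) ∷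
            (b 0F ℤ.* c 1F ℤ.- b 1F ℤ.* c 0F) ∷ []

private
  rotate : Vector ℤ 3 → Vector ℤ 3
  rotate z = z 1F ∷ z 2F ∷ z 0F ∷ []

  rotate-∙ : ∀ y z → rotate y ∙ rotate z ≡ y ∙ z
  rotate-∙ y z = rearrange (y 0F ℤ.* z 0F) (y 1F ℤ.* z 1F) (y 2F ℤ.* z 2F)
    where
    rearrange : ∀ a b c → b ℤ.+ (c ℤ.+ (a ℤ.+ + 0)) ≡ a ℤ.+ (b ℤ.+ (c ℤ.+ + 0))
    rearrange = ℤ-Ring.solve-∀

-- The solver treats the first coordinate only. Cyclic rotation of the coordinates commutes with
-- `cross` and preserves `_∙_`, which gives the other two.
cramer : ∀ a b c v k → v ∙ cross b c ℤ.* a k ℤ.+ v ∙ cross c a ℤ.* b k ℤ.+ v ∙ cross a b ℤ.* c k ≡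
         a ∙ cross b c ℤ.* v k
cramer a b c v = λ
  { 0F → first a b c v
  ; 1F → rotated (r v (cross b c)) (r v (cross c a)) (r v (cross a b)) (r a (cross b c))
           (first (rotate a) (rotate b) (rotate c) (rotate v))
  ; 2F → rotated (rr v (cross b c)) (rr v (cross c a)) (rr v (cross a b)) (rr a (cross b c))
           (first (rotate (rotate a)) (rotate (rotate b)) (rotate (rotate c)) (rotate (rotate v)))
  }
  where
  expand : ∀ a₀ a₁ a₂ b₀ b₁ b₂ c₀ c₁ c₂ v₀ v₁ v₂ →
    (v₀ ℤ.* (b₁ ℤ.* c₂ ℤ.- b₂ ℤ.* c₁) ℤ.+ (v₁ ℤ.* (b₂ ℤ.* c₀ ℤ.- b₀ ℤ.* c₂) ℤ.+
      (v₂ ℤ.* (b₀ ℤ.* c₁ ℤ.- b₁ ℤ.* c₀) ℤ.+ + 0))) ℤ.* a₀ ℤ.+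
    (v₀ ℤ.* (c₁ ℤ.* a₂ ℤ.- c₂ ℤ.* a₁) ℤ.+ (v₁ ℤ.* (c₂ ℤ.* a₀ ℤ.- c₀ ℤ.* a₂) ℤ.+
      (v₂ ℤ.* (c₀ ℤ.* a₁ ℤ.- c₁ ℤ.* a₀) ℤ.+ + 0))) ℤ.* b₀ ℤ.+
    (v₀ ℤ.* (a₁ ℤ.* b₂ ℤ.- a₂ ℤ.* b₁) ℤ.+ (v₁ ℤ.* (a₂ ℤ.* b₀ ℤ.- a₀ ℤ.* b₂) ℤ.+
      (v₂ ℤ.* (a₀ ℤ.* b₁ ℤ.- a₁ ℤ.* b₀) ℤ.+ + 0))) ℤ.* c₀ ≡
    (a₀ ℤ.* (b₁ ℤ.* c₂ ℤ.- b₂ ℤ.* c₁) ℤ.+ (a₁ ℤ.* (b₂ ℤ.* c₀ ℤ.- b₀ ℤ.* c₂) ℤ.+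
      (a₂ ℤ.* (b₀ ℤ.* c₁ ℤ.- b₁ ℤ.* c₀) ℤ.+ + 0))) ℤ.* v₀
  expand = ℤ-Ring.solve-∀
  first : ∀ a b c v →
    v ∙ cross b c ℤ.* a 0F ℤ.+ v ∙ cross c a ℤ.* b 0F ℤ.+ v ∙ cross a b ℤ.* c 0F ≡ a ∙ cross b c ℤ.* v 0F
  first a b c v = expand (a 0F) (a 1F) (a 2F) (b 0F) (b 1F) (b 2F) (c 0F) (c 1F) (c 2F) (v 0F) (v 1F) (v 2F)
  r : ∀ y z → rotate y ∙ rotate z ≡ y ∙ z
  r = rotate-∙
  rr : ∀ y z → rotate (rotate y) ∙ rotate (rotate z) ≡ y ∙ z
  rr y z = ≡.trans (rotate-∙ (rotate y) (rotate z)) (rotate-∙ y z)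
  rotated : ∀ {x x′ y y′ z z′ d d′ a b c v} → x ≡ x′ → y ≡ y′ → z ≡ z′ → d ≡ d′ →
            x ℤ.* a ℤ.+ y ℤ.* b ℤ.+ z ℤ.* c ≡ d ℤ.* v → x′ ℤ.* a ℤ.+ y′ ℤ.* b ℤ.+ z′ ℤ.* c ≡ d′ ℤ.* v
  rotated ≡.refl ≡.refl ≡.refl ≡.refl eq = eq

module Rational {Cell} (system : CellSystem Cell) {w} (cell : Cell w) where
  open CellSystem system

  side : Vector (Vector ℤ 3) 3
  side i = w (suc i) -ᵥ w zero

  private
    a = side 0F
    b = side 1F
    c = side 2F

  -- Turns coefficients of the sides into coefficients of the vertices with sum zero, the form that
  -- `independent` expects.
  affine : ℤ → ℤ → ℤ → Vector ℤ 4
  affine x y z = (ℤ.- (x ℤ.+ y ℤ.+ z)) ∷ x ∷ y ∷ z ∷ []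

  ∑affine : ∀ x y z → ℤΣ.sum (affine x y z) ≡ + 0
  ∑affine = rearrange
    where
    rearrange : ∀ x y z → (ℤ.- (x ℤ.+ y ℤ.+ z)) ℤ.+ (x ℤ.+ (y ℤ.+ (z ℤ.+ + 0))) ≡ + 0
    rearrange = ℤ-Ring.solve-∀

  affine-· : ∀ x y z k → (affine x y z · w) k ≡ x ℤ.* a k ℤ.+ y ℤ.* b k ℤ.+ z ℤ.* c k
  affine-· x y z k = rearrange x y z (w 0F k) (w 1F k) (w 2F k) (w 3F k)
    where
    rearrange : ∀ x y z p q r s → (ℤ.- (x ℤ.+ y ℤ.+ z)) ℤ.* p ℤ.+ (x ℤ.* q ℤ.+ (y ℤ.* r ℤ.+ (z ℤ.* s ℤ.+ + 0))) ≡
      x ℤ.* (q ℤ.- p) ℤ.+ y ℤ.* (r ℤ.- p) ℤ.+ z ℤ.* (s ℤ.- p)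
    rearrange = ℤ-Ring.solve-∀

  sides-independent : ∀ x y z → (∀ k → x ℤ.* a k ℤ.+ y ℤ.* b k ℤ.+ z ℤ.* c k ≡ + 0) →
                      ∀ i → affine x y z i ≡ + 0
  sides-independent x y z zero-combination =
    independent cell (affine x y z) (∑affine x y z) (λ k → ≡.trans (affine-· x y z k) (zero-combination k))

  det : ℤ
  det = a ∙ cross b c

  -- If `det` were zero, Cramer's rule for the unit vectors would be a dependence of the sides in
  -- which `c` has the entries of `cross a b` as coefficients, so these vanish. Then
  -- `b i * a - a i * b = 0` is a dependence for every `i`, hence `a = 0`, and this is a dependence
  -- too.
  det≢0 : ¬ det ≡ + 0
  det≢0 det≡0 = 1≢0 (sides-independent (+ 1) (+ 0) (+ 0) (λ k → ≡.trans
      (rearrange (a k) (b k) (c k)) (a≡0 k)) 1F)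
    where
    1≢0 : ¬ + 1 ≡ + 0
    1≢0 ()
    cross≡0 : ∀ j → cross a b j ≡ + 0
    cross≡0 j = ≡.trans (≡.sym (identity-∙ j (cross a b)))
      (sides-independent (v ∙ cross b c) (v ∙ cross c a) (v ∙ cross a b)
        (λ k → ≡.trans (cramer a b c v k) (≡.cong (ℤ._* v k) det≡0)) 3F)
      where v = identity j
    rearrange : ∀ a b c → + 1 ℤ.* a ℤ.+ + 0 ℤ.* b ℤ.+ + 0 ℤ.* c ≡ a
    rearrange = ℤ-Ring.solve-∀
    diagonal : ∀ x y z → y ℤ.* x ℤ.+ (ℤ.- x) ℤ.* y ℤ.+ + 0 ℤ.* z ≡ + 0
    diagonal = ℤ-Ring.solve-∀
    plus : ∀ x y x′ y′ z → x′ ℤ.* y ℤ.- x ℤ.* y′ ≡ + 0 → y ℤ.* x′ ℤ.+ (ℤ.- x) ℤ.* y′ ℤ.+ + 0 ℤ.* z ≡ + 0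
    plus x y x′ y′ z = ≡.trans (expand x y x′ y′ z)
      where
      expand : ∀ x y x′ y′ z → y ℤ.* x′ ℤ.+ (ℤ.- x) ℤ.* y′ ℤ.+ + 0 ℤ.* z ≡ x′ ℤ.* y ℤ.- x ℤ.* y′
      expand = ℤ-Ring.solve-∀
    minus : ∀ x y x′ y′ z → x ℤ.* y′ ℤ.- x′ ℤ.* y ≡ + 0 → y ℤ.* x′ ℤ.+ (ℤ.- x) ℤ.* y′ ℤ.+ + 0 ℤ.* z ≡ + 0
    minus x y x′ y′ z eq = ≡.trans (expand x y x′ y′ z) (≡.cong ℤ.-_ eq)
      where
      expand : ∀ x y x′ y′ z → y ℤ.* x′ ℤ.+ (ℤ.- x) ℤ.* y′ ℤ.+ + 0 ℤ.* z ≡ ℤ.- (x ℤ.* y′ ℤ.- x′ ℤ.* y)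
      expand = ℤ-Ring.solve-∀
    minor : ∀ i k → b i ℤ.* a k ℤ.+ (ℤ.- a i) ℤ.* b k ℤ.+ + 0 ℤ.* c k ≡ + 0
    minor 0F 0F = diagonal (a 0F) (b 0F) (c 0F)
    minor 0F 1F = minus (a 0F) (b 0F) (a 1F) (b 1F) (c 1F) (cross≡0 2F)
    minor 0F 2F = plus  (a 0F) (b 0F) (a 2F) (b 2F) (c 2F) (cross≡0 1F)
    minor 1F 0F = plus  (a 1F) (b 1F) (a 0F) (b 0F) (c 0F) (cross≡0 2F)
    minor 1F 1F = diagonal (a 1F) (b 1F) (c 1F)
    minor 1F 2F = minus (a 1F) (b 1F) (a 2F) (b 2F) (c 2F) (cross≡0 0F)
    minor 2F 0F = minus (a 2F) (b 2F) (a 0F) (b 0F) (c 0F) (cross≡0 1F)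
    minor 2F 1F = plus  (a 2F) (b 2F) (a 1F) (b 1F) (c 1F) (cross≡0 0F)
    minor 2F 2F = diagonal (a 2F) (b 2F) (c 2F)
    a≡0 : ∀ i → a i ≡ + 0
    a≡0 i = ≡.trans (≡.sym (ℤ.neg-involutive (a i)))
      (≡.cong ℤ.-_ (sides-independent (b i) (ℤ.- a i) (+ 0) (minor i) 2F))

  -- `X i / M` is the change of the `i`-th barycentric coordinate under translation by `v`. For
  -- `M = 1` this puts `v` into the lattice spanned by the edges.
  Coordinates : ℤ → Vector ℤ 3 → Set
  Coordinates M v = ∃ λ (X : Vector ℤ 4) → ℤΣ.sum X ≡ + 0 × (∀ k → (X · w) k ≡ M ℤ.* v k)

  det-coordinates : ∀ v → Coordinates det v
  det-coordinates v = affine x y z , ∑affine x y z , λ k → ≡.trans (affine-· x y z k) (cramer a b c v k)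
    where
    x = v ∙ cross b c
    y = v ∙ cross c a
    z = v ∙ cross a b

  rational-coordinates : ∃ λ N → ∀ v → Coordinates (+ suc N) v
  rational-coordinates = by-sign det ≡.refl
    where
    by-sign : ∀ d → det ≡ d → ∃ λ N → ∀ v → Coordinates (+ suc N) v
    by-sign (+ zero)  det≡0  = ⊥-elim (det≢0 det≡0)
    by-sign (+ suc N) det≡N  = N , λ v → ≡.subst (λ d → Coordinates d v) det≡N (det-coordinates v)
    by-sign -[1+ N ]  det≡-N = N , negated
      where
      negated : ∀ v → Coordinates (+ suc N) v
      negated v = proj₁ found , proj₁ (proj₂ found) , λ k →
        ≡.trans (proj₂ (proj₂ found) k) (≡.trans (≡.cong (ℤ._* (ℤ.- v k)) det≡-N) (flip (+ suc N) (v k)))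
        where
        found = det-coordinates (λ k → ℤ.- v k)
        flip : ∀ m x → (ℤ.- m) ℤ.* (ℤ.- x) ≡ m ℤ.* x
        flip = ℤ-Ring.solve-∀

0≤-+ : ∀ {a b} → + 0 ℤ.≤ a → + 0 ℤ.≤ b → + 0 ℤ.≤ a ℤ.+ b
0≤-+ 0≤a 0≤b = ℤ.+-mono-≤ 0≤a 0≤b

-- Inequalities are kept in the form `+ 0 ≤ a`, so that linear arithmetic becomes adding such
-- inequalities and one ring identity.
0≤-by : ∀ {a b} → + 0 ℤ.≤ a → a ≡ b → + 0 ℤ.≤ b
0≤-by 0≤a a≡b = ≡.subst (+ 0 ℤ.≤_) a≡b 0≤a

0≰-1 : ¬ + 0 ℤ.≤ -[1+ 0 ]
0≰-1 ()

0≰⇒ : ∀ a → ¬ + 0 ℤ.≤ a → + 0 ℤ.≤ -[1+ 0 ] ℤ.- a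
0≰⇒ a 0≰a = 0≤-by (ℤ.i≤j⇒0≤j-i (ℤ.i<j⇒suc[i]≤j (ℤ.≰⇒> 0≰a))) (rearrange a)
  where
  rearrange : ∀ a → + 0 ℤ.- (+ 1 ℤ.+ a) ≡ -[1+ 0 ] ℤ.- a
  rearrange = ℤ-Ring.solve-∀

module Overlap {Cell} (system : CellSystem Cell) {w} (cell : Cell w) where
  open CellSystem system
  open Edges system

  -- The points (Σ sᵢ wᵢ) / 4 M = v + (Σ s′ᵢ wᵢ) / 4 M with positive weights s and s′ lie in
  -- the interior of a simplex and of its translate by v.
  no-overlap : ∀ N (d d⁺ : Vector ℤ 4) v → (∀ i → + 0 ℤ.≤ d⁺ i) → (∀ i → + 0 ℤ.≤ d⁺ i ℤ.- d i) →
            + 0 ℤ.≤ + N ℤ.- ℤΣ.sum d⁺ → ℤΣ.sum d ≡ + 0 → (∀ k → (d · w) k ≡ + suc N ℤ.* v k) →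
            ∀ i → d i ≡ + 0
  no-overlap N d d⁺ v 0≤d⁺ 0≤d⁻ small ∑d≡0 dw≡Mv =
    independent cell d ∑d≡0 (λ k → ≡.trans (dw≡Mv k) (≡.trans (≡.cong (M ℤ.*_) (v≡0 k)) (ℤ.*-zeroʳ M)))
    where
    M = + suc N
    -- The slack `G` is at least 1, since `d⁺` sums to at most `N`. Given to each of the four
    -- vertices, it makes all weights positive; the factor 4 on `d⁺` then yields the total weight
    -- `4 M`.
    G = + suc N ℤ.- ℤΣ.sum d⁺
    s s′ : Vector ℤ 4
    s i = + 4 ℤ.* d⁺ i ℤ.+ G
    s′ i = + 4 ℤ.* (d⁺ i ℤ.- d i) ℤ.+ G
    1≤G : + 0 ℤ.≤ G ℤ.- + 1
    1≤G = 0≤-by small (rearrange (+ N) (ℤΣ.sum d⁺))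
      where
      rearrange : ∀ n p → n ℤ.- p ≡ (+ 1 ℤ.+ n) ℤ.- p ℤ.- + 1
      rearrange = ℤ-Ring.solve-∀
    0≤G : + 0 ℤ.≤ G
    0≤G = 0≤-by (0≤-+ 1≤G (ℤ.+≤+ {0} {1} z≤n)) (rearrange G)
      where
      rearrange : ∀ g → (g ℤ.- + 1) ℤ.+ + 1 ≡ g
      rearrange = ℤ-Ring.solve-∀
    0≤4* : ∀ {a} → + 0 ℤ.≤ a → + 0 ℤ.≤ + 4 ℤ.* a
    0≤4* 0≤a = ℤ.*-monoˡ-≤-nonNeg (+ 4) 0≤a
    positive : ∀ i → ¬ s i ≡ + 0
    positive i s≡0 = 0≰-1 (0≤-by (0≤-+ (0≤4* (0≤d⁺ i)) 1≤G)
      (≡.trans (rearrange (+ 4 ℤ.* d⁺ i) G) (≡.cong (ℤ._- + 1) s≡0)))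
      where
      rearrange : ∀ a g → a ℤ.+ (g ℤ.- + 1) ≡ (a ℤ.+ g) ℤ.- + 1
      rearrange = ℤ-Ring.solve-∀
    ∑s : ℤΣ.sum s ≡ + 4 ℤ.* M
    ∑s = expand (d⁺ 0F) (d⁺ 1F) (d⁺ 2F) (d⁺ 3F) M
      where
      expand : ∀ a b c d m → let g = m ℤ.- (a ℤ.+ (b ℤ.+ (c ℤ.+ (d ℤ.+ + 0)))) in
        (+ 4 ℤ.* a ℤ.+ g) ℤ.+ ((+ 4 ℤ.* b ℤ.+ g) ℤ.+ ((+ 4 ℤ.* c ℤ.+ g) ℤ.+ ((+ 4 ℤ.* d ℤ.+ g) ℤ.+ + 0))) ≡ + 4 ℤ.* m
      expand = ℤ-Ring.solve-∀
    ∑s′ : ℤΣ.sum s′ ≡ + 4 ℤ.* M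
    ∑s′ = transfer (≡.cong (λ z → + 4 ℤ.* M ℤ.- + 4 ℤ.* z) ∑d≡0)
      (expand (d⁺ 0F) (d⁺ 1F) (d⁺ 2F) (d⁺ 3F) (d 0F) (d 1F) (d 2F) (d 3F) M)
      where
      expand : ∀ a b c d p q r s m → let g = m ℤ.- (a ℤ.+ (b ℤ.+ (c ℤ.+ (d ℤ.+ + 0)))) in
        ((+ 4 ℤ.* (a ℤ.- p) ℤ.+ g) ℤ.+ ((+ 4 ℤ.* (b ℤ.- q) ℤ.+ g) ℤ.+
          ((+ 4 ℤ.* (c ℤ.- r) ℤ.+ g) ℤ.+ ((+ 4 ℤ.* (d ℤ.- s) ℤ.+ g) ℤ.+ + 0)))) ℤ.- + 4 ℤ.* m ≡
        (+ 4 ℤ.* m ℤ.- + 4 ℤ.* (p ℤ.+ (q ℤ.+ (r ℤ.+ (s ℤ.+ + 0))))) ℤ.- (+ 4 ℤ.* m ℤ.- + 4 ℤ.* + 0)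
      expand = ℤ-Ring.solve-∀
    w′ : Vector (Vector ℤ 3) 4
    w′ i = w i +ᵥ v
    4d : Vector ℤ 4
    4d i = + 4 ℤ.* d i
    same-point : ∀ k → (s · w) k ≡ (s′ · w′) k
    same-point k = ≡.sym (begin
      s′ ∙ (z +ᵥ (λ _ → v k))                        ≡⟨ ∙-+ʳ s′ z (λ _ → v k) ⟩
      s′ ∙ z ℤ.+ s′ ∙ (λ _ → v k)                    ≡⟨ ≡.cong₂ ℤ._+_ s′z (≡.sym (ℤΣ.*-distribʳ-sum (v k) s′)) ⟩
      (s ∙ z ℤ.- + 4 ℤ.* d ∙ z) ℤ.+ ℤΣ.sum s′ ℤ.* v k ≡⟨ ≡.cong₂ (λ a b → (s ∙ z ℤ.- + 4 ℤ.* a) ℤ.+ b ℤ.* v k) (dw≡Mv k) ∑s′ ⟩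
      (s ∙ z ℤ.- + 4 ℤ.* (M ℤ.* v k)) ℤ.+ + 4 ℤ.* M ℤ.* v k ≡⟨ cancel (s ∙ z) M (v k) ⟩
      s ∙ z                                          ∎)
      where
      open ≡.≡-Reasoning
      z : Vector ℤ 4
      z i = w i k
      s′z : s′ ∙ z ≡ s ∙ z ℤ.- + 4 ℤ.* d ∙ z
      s′z = ≡.trans (∙-congˡ z (λ i → split (d⁺ i) (d i) G))
        (≡.trans (∙--ˡ s 4d z) (≡.cong (ℤ._-_ (s ∙ z)) (∙-scaleˡ (+ 4) d z)))
        where
        split : ∀ a d g → + 4 ℤ.* (a ℤ.- d) ℤ.+ g ≡ (+ 4 ℤ.* a ℤ.+ g) ℤ.- + 4 ℤ.* d
        split = ℤ-Ring.solve-∀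
      cancel : ∀ a m v → (a ℤ.- + 4 ℤ.* (m ℤ.* v)) ℤ.+ + 4 ℤ.* m ℤ.* v ≡ a
      cancel = ℤ-Ring.solve-∀
    shifted : ∀ i → ∃ λ j → w i ≗ w j +ᵥ v
    shifted i = proj₁ found , proj₂ (proj₂ found)
      where
      found : ∃ λ j → ¬ s′ j ≡ + 0 × w i ≗ w′ j
      found = support {w} {w′} cell (translated cell v) {s} {s′}
        (λ i → 0≤-+ (0≤4* (0≤d⁺ i)) 0≤G) (λ i → 0≤-+ (0≤4* (0≤d⁻ i)) 0≤G) ∑s ∑s′ same-point i (positive i)
    v≡0 : ∀ k → v k ≡ + 0
    v≡0 = constant-shift cell v shifted

module Unimodular {Cell} (system : CellSystem Cell) {w} (cell : Cell w) where
  open Edges system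
  open Overlap system cell
  open Rational system cell using (Coordinates; rational-coordinates)

  -- Division with remainder `X = x + M q` of the coordinates of `v`. As `X` has sum zero, the
  -- remainders sum to a multiple `K M`, and their bounds leave 0, 1, 2, 3 for `K`.
  record Remainders (N : ℕ) (v : Vector ℤ 3) : Set where
    field
      q x          : Vector ℤ 4
      0≤x          : ∀ i → + 0 ℤ.≤ x i
      x≤N          : ∀ i → + 0 ℤ.≤ + N ℤ.- x i
      combination≡ : ∀ k → (x · w) k ℤ.+ + suc N ℤ.* (q · w) k ≡ + suc N ℤ.* v k

    K : ℤ
    K = ℤ.- ℤΣ.sum q

    field
      ∑x           : ℤΣ.sum x ≡ K ℤ.* + suc N

  remainders : ∀ N v → Coordinates (+ suc N) v → Remainders N v
  remainders N v (X , ∑X≡0 , Xw≡Mv) = record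
    { q = q
    ; x = x
    ; 0≤x = λ i → ℤ.+≤+ z≤n
    ; x≤N = λ i → ℤ.i≤j⇒0≤j-i (ℤ.+≤+ (ℕ.s≤s⁻¹ (ℤ.n%ℕd<d (X i) (suc N))))
    ; combination≡ = λ k → let z = λ i → w i k in begin
        x ∙ z ℤ.+ M ℤ.* q ∙ z            ≡⟨ ≡.cong (ℤ._+_ (x ∙ z)) (∙-scaleˡ M q z) ⟨
        x ∙ z ℤ.+ (λ i → M ℤ.* q i) ∙ z  ≡⟨ ∙-+ˡ x (λ i → M ℤ.* q i) z ⟨
        (x +ᵥ (λ i → M ℤ.* q i)) ∙ z     ≡⟨ ∙-congˡ z X≡ ⟨
        X ∙ z                            ≡⟨ Xw≡Mv k ⟩
        M ℤ.* v k                        ∎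
    ; ∑x = transfer (≡.trans (≡.sym (ℤΣ.sum-cong-≗ X≡)) ∑X≡0)
        (expand (x 0F) (x 1F) (x 2F) (x 3F) (q 0F) (q 1F) (q 2F) (q 3F) M)
    }
    where
    open ≡.≡-Reasoning
    M : ℤ
    M = + suc N
    q x : Vector ℤ 4
    q i = X i ℤ./ℕ suc N
    x i = + (X i ℤ.%ℕ suc N)
    X≡ : X ≗ x +ᵥ (λ i → M ℤ.* q i)
    X≡ i = ≡.trans (ℤ.a≡a%ℕn+[a/ℕn]*n (X i) (suc N)) (≡.cong (ℤ._+_ (x i)) (ℤ.*-comm (q i) M))
    expand : ∀ a b c d p q r s m →
      (a ℤ.+ (b ℤ.+ (c ℤ.+ (d ℤ.+ + 0)))) ℤ.- (ℤ.- (p ℤ.+ (q ℤ.+ (r ℤ.+ (s ℤ.+ + 0))))) ℤ.* m ≡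
      ((a ℤ.+ m ℤ.* p) ℤ.+ ((b ℤ.+ m ℤ.* q) ℤ.+ ((c ℤ.+ m ℤ.* r) ℤ.+ ((d ℤ.+ m ℤ.* s) ℤ.+ + 0)))) ℤ.- + 0
    expand = ℤ-Ring.solve-∀

  module Reduction (N : ℕ) (v : Vector ℤ 3) (r : Remainders N v) where
    open Remainders r

    private
      M : ℤ
      M = + suc N

    indicator : Bool → ℤ
    indicator b = if b then + 1 else + 0

    -- The positive part after the shift: a marked remainder becomes `x - M`, which is negative, and
    -- the others stay.
    off : Bool → ℤ → ℤ
    off b z = if b then + 0 else z

    -- Moving K of the remainders x into (- M , 0] gives the weights of a lattice vector.
    not-shiftable : ∀ (ε : Fin 4 → Bool) → ℤΣ.sum (λ i → indicator (ε i)) ≡ K →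
                    + 0 ℤ.≤ + N ℤ.- ℤΣ.sum (λ i → off (ε i) (x i)) → ∀ i → ε i ≡ true → ⊥
    -- `no-overlap` yields `x i = M` for a marked `i`, against `x i ≤ N`.
    not-shiftable ε ∑ε small i εi = 0≰-1 (0≤-by (x≤N i) (transfer
        (≡.sym (≡.trans (≡.sym (≡.cong (λ b → x i ℤ.- M ℤ.* indicator b) εi)) d≡0)) (rearrange (+ N) (x i))))
      where
      d d⁺ : Vector ℤ 4
      d j = x j ℤ.- M ℤ.* indicator (ε j)
      d⁺ j = off (ε j) (x j)
      rearrange : ∀ n x → (n ℤ.- x) ℤ.- -[1+ 0 ] ≡ + 0 ℤ.- (x ℤ.- (+ 1 ℤ.+ n) ℤ.* + 1)
      rearrange = ℤ-Ring.solve-∀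
      d≡0 : d i ≡ + 0
      d≡0 = no-overlap N d d⁺ shift (λ j → 0≤off (ε j) (0≤x j)) (λ j → 0≤off-d (ε j) j) small ∑d≡0 dw≡ i
        where
        0≤off : ∀ b {z} → + 0 ℤ.≤ z → + 0 ℤ.≤ off b z
        0≤off true  _   = ℤ.≤-refl
        0≤off false 0≤z = 0≤z
        0≤off-d : ∀ b j → + 0 ℤ.≤ off b (x j) ℤ.- (x j ℤ.- M ℤ.* indicator b)
        0≤off-d true  j = 0≤-by (0≤-+ (x≤N j) (ℤ.+≤+ {0} {1} z≤n)) (rearrange′ (+ N) (x j))
          where
          rearrange′ : ∀ n x → (n ℤ.- x) ℤ.+ + 1 ≡ + 0 ℤ.- (x ℤ.- (+ 1 ℤ.+ n) ℤ.* + 1)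
          rearrange′ = ℤ-Ring.solve-∀
        0≤off-d false j = ℤ.≤-reflexive (cancel (x j) M)
          where
          cancel : ∀ x m → + 0 ≡ x ℤ.- (x ℤ.- m ℤ.* + 0)
          cancel = ℤ-Ring.solve-∀
        [ε] : Vector ℤ 4
        [ε] j = indicator (ε j)
        shift : Vector ℤ 3
        shift k = v k ℤ.- (q · w) k ℤ.- ([ε] · w) k
        ∑d≡0 : ℤΣ.sum d ≡ + 0
        ∑d≡0 = transfer (≡.cong₂ (λ a b → a ℤ.- M ℤ.* b) ∑x ∑ε)
          (expand (x 0F) (x 1F) (x 2F) (x 3F) ([ε] 0F) ([ε] 1F) ([ε] 2F) ([ε] 3F) M K)
          where
          expand : ∀ a b c d p q r s m k →
            ((a ℤ.- m ℤ.* p) ℤ.+ ((b ℤ.- m ℤ.* q) ℤ.+ ((c ℤ.- m ℤ.* r) ℤ.+ ((d ℤ.- m ℤ.* s) ℤ.+ + 0)))) ℤ.- + 0 ≡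
            ((a ℤ.+ (b ℤ.+ (c ℤ.+ (d ℤ.+ + 0)))) ℤ.- m ℤ.* (p ℤ.+ (q ℤ.+ (r ℤ.+ (s ℤ.+ + 0))))) ℤ.-
            (k ℤ.* m ℤ.- m ℤ.* k)
          expand = ℤ-Ring.solve-∀
        dw≡ : ∀ k → (d · w) k ≡ M ℤ.* shift k
        dw≡ k = ≡.trans (∙--ˡ x (λ j → M ℤ.* [ε] j) z) (≡.trans
          (≡.cong (ℤ._-_ (x ∙ z)) (∙-scaleˡ M [ε] z))
          (transfer (combination≡ k) (expand (x ∙ z) (q ∙ z) ([ε] ∙ z) M (v k))))
          where
          z : Vector ℤ 4
          z j = w j k
          expand : ∀ a b c m v → (a ℤ.- m ℤ.* c) ℤ.- m ℤ.* (v ℤ.- b ℤ.- c) ≡ (a ℤ.+ m ℤ.* b) ℤ.- m ℤ.* v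
          expand = ℤ-Ring.solve-∀

    integral : (∀ i → x i ≡ + 0) → Coordinates (+ 1) v
    integral x≡0 = q , ∑q≡0 , λ k → ≡.trans (qw≡v k) (≡.sym (ℤ.*-identityˡ (v k)))
      where
      K≡0 : K ≡ + 0
      K≡0 = ℤ.*-cancelʳ-≡ K (+ 0) M (≡.trans (≡.sym ∑x) (ℤΣ.sum-cong-≗ x≡0))
      ∑q≡0 : ℤΣ.sum q ≡ + 0
      ∑q≡0 = ≡.trans (≡.sym (ℤ.neg-involutive (ℤΣ.sum q))) (≡.cong ℤ.-_ K≡0)
      qw≡v : ∀ k → (q · w) k ≡ v k
      qw≡v k = ℤ.*-cancelˡ-≡ M _ _ (≡.trans (≡.sym (≡.trans
        (≡.cong (ℤ._+ M ℤ.* (q · w) k) (≡.trans (∙-congˡ z x≡0) (≡.trans (∙-scaleˡ (+ 0) z z) (ℤ.*-zeroˡ (z ∙ z)))))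
        (ℤ.+-identityˡ _))) (combination≡ k))
        where
        z : Vector ℤ 4
        z i = w i k

    private
      ε : Bool → Bool → Bool → Bool → Fin 4 → Bool
      ε a b c d = a ∷ b ∷ c ∷ d ∷ []

    -- The remainders other than `x i` sum to `M - x i`, which is at most `N` once `x i` is at least
    -- 1. Since no remainder may then be shifted, none is positive, and they cannot sum to `M`.
    one-remainder : K ≡ + 1 → ⊥
    one-remainder K≡1 = absurd (0≤-by (0≤-+ (0≤-+ (nonPos 0F) (nonPos 1F)) (0≤-+ (nonPos 2F) (nonPos 3F)))
        (transfer (≡.sym ∑x≡) (total (x 0F) (x 1F) (x 2F) (x 3F) M)))
      where
      ∑x≡ : ℤΣ.sum x ≡ + 1 ℤ.* M
      ∑x≡ = ≡.trans ∑x (≡.cong (ℤ._* M) K≡1)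
      absurd : ¬ + 0 ℤ.≤ ℤ.- (+ 1 ℤ.* M)
      absurd ()
      total : ∀ a b c d m →
        (((-[1+ 0 ] ℤ.- (a ℤ.- + 1)) ℤ.+ (-[1+ 0 ] ℤ.- (b ℤ.- + 1))) ℤ.+
         ((-[1+ 0 ] ℤ.- (c ℤ.- + 1)) ℤ.+ (-[1+ 0 ] ℤ.- (d ℤ.- + 1)))) ℤ.- ℤ.- (+ 1 ℤ.* m) ≡
        + 1 ℤ.* m ℤ.- (a ℤ.+ (b ℤ.+ (c ℤ.+ (d ℤ.+ + 0))))
      total = ℤ-Ring.solve-∀
      nonPos : ∀ i → + 0 ℤ.≤ -[1+ 0 ] ℤ.- (x i ℤ.- + 1)
      nonPos 0F = 0≰⇒ (x 0F ℤ.- + 1) λ 1≤x → not-shiftable (ε true false false false) (≡.sym K≡1)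
        (0≤-by 1≤x (transfer ∑x≡ (rest (x 0F) (x 1F) (x 2F) (x 3F) (+ N)))) 0F ≡.refl
        where
        rest : ∀ a b c d n → (a ℤ.- + 1) ℤ.- (n ℤ.- (+ 0 ℤ.+ (b ℤ.+ (c ℤ.+ (d ℤ.+ + 0))))) ≡
          (a ℤ.+ (b ℤ.+ (c ℤ.+ (d ℤ.+ + 0)))) ℤ.- + 1 ℤ.* (+ 1 ℤ.+ n)
        rest = ℤ-Ring.solve-∀
      nonPos 1F = 0≰⇒ (x 1F ℤ.- + 1) λ 1≤x → not-shiftable (ε false true false false) (≡.sym K≡1)
        (0≤-by 1≤x (transfer ∑x≡ (rest (x 0F) (x 1F) (x 2F) (x 3F) (+ N)))) 1F ≡.refl
        where
        rest : ∀ a b c d n → (b ℤ.- + 1) ℤ.- (n ℤ.- (a ℤ.+ (+ 0 ℤ.+ (c ℤ.+ (d ℤ.+ + 0))))) ≡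
          (a ℤ.+ (b ℤ.+ (c ℤ.+ (d ℤ.+ + 0)))) ℤ.- + 1 ℤ.* (+ 1 ℤ.+ n)
        rest = ℤ-Ring.solve-∀
      nonPos 2F = 0≰⇒ (x 2F ℤ.- + 1) λ 1≤x → not-shiftable (ε false false true false) (≡.sym K≡1)
        (0≤-by 1≤x (transfer ∑x≡ (rest (x 0F) (x 1F) (x 2F) (x 3F) (+ N)))) 2F ≡.refl
        where
        rest : ∀ a b c d n → (c ℤ.- + 1) ℤ.- (n ℤ.- (a ℤ.+ (b ℤ.+ (+ 0 ℤ.+ (d ℤ.+ + 0))))) ≡
          (a ℤ.+ (b ℤ.+ (c ℤ.+ (d ℤ.+ + 0)))) ℤ.- + 1 ℤ.* (+ 1 ℤ.+ n)
        rest = ℤ-Ring.solve-∀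
      nonPos 3F = 0≰⇒ (x 3F ℤ.- + 1) λ 1≤x → not-shiftable (ε false false false true) (≡.sym K≡1)
        (0≤-by 1≤x (transfer ∑x≡ (rest (x 0F) (x 1F) (x 2F) (x 3F) (+ N)))) 3F ≡.refl
        where
        rest : ∀ a b c d n → (d ℤ.- + 1) ℤ.- (n ℤ.- (a ℤ.+ (b ℤ.+ (c ℤ.+ (+ 0 ℤ.+ + 0))))) ≡
          (a ℤ.+ (b ℤ.+ (c ℤ.+ (d ℤ.+ + 0)))) ℤ.- + 1 ℤ.* (+ 1 ℤ.+ n)
        rest = ℤ-Ring.solve-∀

    -- All pairs of remainders have sum M, so 2 v is congruent to the sum of the vertices, and the
    -- opposite edges w₀ w₁ and w₂ w₃ are congruent modulo 2.
    two-remainders : K ≡ + 2 → ⊥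
    two-remainders K≡2 = distinct (same-edge cell 0F 1F 2F 3F (λ ()) congruent)
      where
      distinct : ¬ ((0F ≡ 2F × 1F ≡ 3F) ⊎ (0F ≡ 3F × 1F ≡ 2F))
      distinct (inj₁ (() , _))
      distinct (inj₂ (() , _))
      ∑x≡ : ℤΣ.sum x ≡ + 2 ℤ.* M
      ∑x≡ = ≡.trans ∑x (≡.cong (ℤ._* M) K≡2)
      large : ∀ {p r} → + 0 ℤ.≤ -[1+ 0 ] ℤ.- (+ N ℤ.- p) → p ≡ r → + 0 ℤ.≤ r ℤ.- M
      large {p} {r} 0≤ p≡r = 0≤-by 0≤ (≡.trans (rearrange (+ N) p) (≡.cong (ℤ._- M) p≡r))
        where
        rearrange : ∀ n p → -[1+ 0 ] ℤ.- (n ℤ.- p) ≡ p ℤ.- (+ 1 ℤ.+ n)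
        rearrange = ℤ-Ring.solve-∀
      x₀ = x 0F
      x₁ = x 1F
      x₂ = x 2F
      x₃ = x 3F
      -- If a pair summed to at most `N`, the complementary pair could be shifted. So all six pairs
      -- sum to at least `M`, and as complementary pairs have the total `2 M`, to exactly `M`.
      23≥ : + 0 ℤ.≤ (x₂ ℤ.+ x₃) ℤ.- M
      23≥ = large (0≰⇒ _ λ small → not-shiftable (ε true true false false) (≡.sym K≡2) small 0F ≡.refl) (sum x₂ x₃)
        where
        sum : ∀ c d → + 0 ℤ.+ (+ 0 ℤ.+ (c ℤ.+ (d ℤ.+ + 0))) ≡ c ℤ.+ d
        sum = ℤ-Ring.solve-∀
      13≥ : + 0 ℤ.≤ (x₁ ℤ.+ x₃) ℤ.- M
      13≥ = large (0≰⇒ _ λ small → not-shiftable (ε true false true false) (≡.sym K≡2) small 0F ≡.refl) (sum x₁ x₃)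
        where
        sum : ∀ c d → + 0 ℤ.+ (c ℤ.+ (+ 0 ℤ.+ (d ℤ.+ + 0))) ≡ c ℤ.+ d
        sum = ℤ-Ring.solve-∀
      12≥ : + 0 ℤ.≤ (x₁ ℤ.+ x₂) ℤ.- M
      12≥ = large (0≰⇒ _ λ small → not-shiftable (ε true false false true) (≡.sym K≡2) small 0F ≡.refl) (sum x₁ x₂)
        where
        sum : ∀ c d → + 0 ℤ.+ (c ℤ.+ (d ℤ.+ (+ 0 ℤ.+ + 0))) ≡ c ℤ.+ d
        sum = ℤ-Ring.solve-∀
      03≥ : + 0 ℤ.≤ (x₀ ℤ.+ x₃) ℤ.- M
      03≥ = large (0≰⇒ _ λ small → not-shiftable (ε false true true false) (≡.sym K≡2) small 1F ≡.refl) (sum x₀ x₃)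
        where
        sum : ∀ c d → c ℤ.+ (+ 0 ℤ.+ (+ 0 ℤ.+ (d ℤ.+ + 0))) ≡ c ℤ.+ d
        sum = ℤ-Ring.solve-∀
      02≥ : + 0 ℤ.≤ (x₀ ℤ.+ x₂) ℤ.- M
      02≥ = large (0≰⇒ _ λ small → not-shiftable (ε false true false true) (≡.sym K≡2) small 1F ≡.refl) (sum x₀ x₂)
        where
        sum : ∀ c d → c ℤ.+ (+ 0 ℤ.+ (d ℤ.+ (+ 0 ℤ.+ + 0))) ≡ c ℤ.+ d
        sum = ℤ-Ring.solve-∀
      01≥ : + 0 ℤ.≤ (x₀ ℤ.+ x₁) ℤ.- M
      01≥ = large (0≰⇒ _ λ small → not-shiftable (ε false false true true) (≡.sym K≡2) small 2F ≡.refl) (sum x₀ x₁)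
        where
        sum : ∀ c d → c ℤ.+ (d ℤ.+ (+ 0 ℤ.+ (+ 0 ℤ.+ + 0))) ≡ c ℤ.+ d
        sum = ℤ-Ring.solve-∀
      exact : ∀ p r → + 0 ℤ.≤ p ℤ.- M → + 0 ℤ.≤ r ℤ.- M → p ℤ.+ r ≡ ℤΣ.sum x → p ≡ M
      exact p r p≥ r≥ p+r≡ = ℤ.≤-antisym
        (ℤ.0≤i-j⇒j≤i (0≤-by r≥ (transfer (≡.trans p+r≡ ∑x≡) (rearrange p r M)))) (ℤ.0≤i-j⇒j≤i p≥)
        where
        rearrange : ∀ p r m → (r ℤ.- m) ℤ.- (m ℤ.- p) ≡ (p ℤ.+ r) ℤ.- + 2 ℤ.* m
        rearrange = ℤ-Ring.solve-∀
      01≡ : x₀ ℤ.+ x₁ ≡ M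
      01≡ = exact (x₀ ℤ.+ x₁) (x₂ ℤ.+ x₃) 01≥ 23≥ (order x₀ x₁ x₂ x₃)
        where
        order : ∀ a b c d → (a ℤ.+ b) ℤ.+ (c ℤ.+ d) ≡ a ℤ.+ (b ℤ.+ (c ℤ.+ (d ℤ.+ + 0)))
        order = ℤ-Ring.solve-∀
      02≡ : x₀ ℤ.+ x₂ ≡ M
      02≡ = exact (x₀ ℤ.+ x₂) (x₁ ℤ.+ x₃) 02≥ 13≥ (order x₀ x₁ x₂ x₃)
        where
        order : ∀ a b c d → (a ℤ.+ c) ℤ.+ (b ℤ.+ d) ≡ a ℤ.+ (b ℤ.+ (c ℤ.+ (d ℤ.+ + 0)))
        order = ℤ-Ring.solve-∀
      12≡ : x₁ ℤ.+ x₂ ≡ M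
      12≡ = exact (x₁ ℤ.+ x₂) (x₀ ℤ.+ x₃) 12≥ 03≥ (order x₀ x₁ x₂ x₃)
        where
        order : ∀ a b c d → (b ℤ.+ c) ℤ.+ (a ℤ.+ d) ≡ a ℤ.+ (b ℤ.+ (c ℤ.+ (d ℤ.+ + 0)))
        order = ℤ-Ring.solve-∀
      03≡ : x₀ ℤ.+ x₃ ≡ M
      03≡ = exact (x₀ ℤ.+ x₃) (x₁ ℤ.+ x₂) 03≥ 12≥ (order x₀ x₁ x₂ x₃)
        where
        order : ∀ a b c d → (a ℤ.+ d) ℤ.+ (b ℤ.+ c) ≡ a ℤ.+ (b ℤ.+ (c ℤ.+ (d ℤ.+ + 0)))
        order = ℤ-Ring.solve-∀
      ∑w : Vector ℤ 3
      ∑w k = w 0F k ℤ.+ w 1F k ℤ.+ w 2F k ℤ.+ w 3F k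
      half : ∀ a b c → a ℤ.+ b ≡ M → a ℤ.+ c ≡ M → b ℤ.+ c ≡ M → + 2 ℤ.* a ≡ M
      half a b c ab ac bc = transfer (≡.cong₂ ℤ._-_ (≡.cong₂ ℤ._+_ ab ac) bc) (rearrange a b c M)
        where
        rearrange : ∀ a b c m → + 2 ℤ.* a ℤ.- m ≡ ((a ℤ.+ b) ℤ.+ (a ℤ.+ c) ℤ.- (b ℤ.+ c)) ℤ.- (m ℤ.+ m ℤ.- m)
        rearrange = ℤ-Ring.solve-∀
      flip : ∀ {a b} → a ℤ.+ b ≡ M → b ℤ.+ a ≡ M
      flip {a} {b} = ≡.trans (ℤ.+-comm b a)
      2x≡M : ∀ i → + 2 ℤ.* x i ≡ M
      2x≡M 0F = half x₀ x₁ x₂ 01≡ 02≡ 12≡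
      2x≡M 1F = half x₁ x₀ x₂ (flip {x₀} {x₁} 01≡) 12≡ 02≡
      2x≡M 2F = half x₂ x₀ x₁ (flip {x₀} {x₂} 02≡) (flip {x₁} {x₂} 12≡) 01≡
      2x≡M 3F = transfer (≡.cong₂ (λ a b → + 2 ℤ.* a ℤ.- b) 03≡ (2x≡M 0F)) (rearrange x₀ x₃ M)
        where
        rearrange : ∀ a d m → + 2 ℤ.* d ℤ.- m ≡ (+ 2 ℤ.* (a ℤ.+ d) ℤ.- + 2 ℤ.* a) ℤ.- (+ 2 ℤ.* m ℤ.- m)
        rearrange = ℤ-Ring.solve-∀
      2xw≡ : ∀ k → + 2 ℤ.* (x · w) k ≡ M ℤ.* ∑w k
      2xw≡ k = ≡.trans (≡.sym (∙-scaleˡ (+ 2) x z)) (≡.trans (∙-congˡ z 2x≡M)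
        (expand M (z 0F) (z 1F) (z 2F) (z 3F)))
        where
        z : Vector ℤ 4
        z i = w i k
        expand : ∀ m a b c d → m ℤ.* a ℤ.+ (m ℤ.* b ℤ.+ (m ℤ.* c ℤ.+ (m ℤ.* d ℤ.+ + 0))) ≡ m ℤ.* (a ℤ.+ b ℤ.+ c ℤ.+ d)
        expand = ℤ-Ring.solve-∀
      2v≡ : ∀ k → ∑w k ℤ.+ + 2 ℤ.* (q · w) k ≡ + 2 ℤ.* v k
      2v≡ k = ℤ.*-cancelˡ-≡ M _ _ (transfer
        (≡.cong₂ (λ a b → + 2 ℤ.* a ℤ.- b) (combination≡ k) (2xw≡ k))
        (rearrange M (∑w k) ((x · w) k) ((q · w) k) (v k)))
        where
        rearrange : ∀ m s x q v → m ℤ.* (s ℤ.+ + 2 ℤ.* q) ℤ.- m ℤ.* (+ 2 ℤ.* v) ≡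
          (+ 2 ℤ.* (x ℤ.+ m ℤ.* q) ℤ.- + 2 ℤ.* x) ℤ.- (+ 2 ℤ.* (m ℤ.* v) ℤ.- m ℤ.* s)
        rearrange = ℤ-Ring.solve-∀
      congruent : w 0F -ᵥ w 1F ≡₂ w 2F -ᵥ w 3F
      congruent = modulo₂ λ k → ℤ.divides (v k ℤ.- (q · w) k ℤ.- w 1F k ℤ.- w 2F k)
        (transfer (2v≡ k) (rearrange (w 0F k) (w 1F k) (w 2F k) (w 3F k) (v k) ((q · w) k)))
        where
        rearrange : ∀ a b c d v q → (a ℤ.- b ℤ.- (c ℤ.- d)) ℤ.- (v ℤ.- q ℤ.- b ℤ.- c) ℤ.* + 2 ≡
          (a ℤ.+ b ℤ.+ c ℤ.+ d ℤ.+ + 2 ℤ.* q) ℤ.- + 2 ℤ.* v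
        rearrange = ℤ-Ring.solve-∀

    -- Shifting the last three leaves only `x 0F` as positive part, and this is at most `N`.
    three-remainders : K ≡ + 3 → ⊥
    three-remainders K≡3 = not-shiftable (ε false true true true) (≡.sym K≡3)
      (0≤-by (x≤N 0F) (≡.cong (ℤ._-_ (+ N)) (≡.sym (ℤ.+-identityʳ (x 0F))))) 1F ≡.refl

    no-remainder : K ≡ + 0 → ∀ i → x i ≡ + 0
    no-remainder K≡0 i = ℤ.≤-antisym (ℤ.0≤i-j⇒j≤i (nonPos i)) (0≤x i)
      where
      ∑x≡0 : ℤΣ.sum x ≡ + 0
      ∑x≡0 = ≡.trans ∑x (≡.trans (≡.cong (ℤ._* M) K≡0) (ℤ.*-zeroˡ M))
      nonPos : ∀ i → + 0 ℤ.≤ + 0 ℤ.- x i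
      nonPos 0F = 0≤-by (0≤-+ (0≤x 1F) (0≤-+ (0≤x 2F) (0≤x 3F))) (transfer ∑x≡0 (rest (x 0F) (x 1F) (x 2F) (x 3F)))
        where
        rest : ∀ a b c d → (b ℤ.+ (c ℤ.+ d)) ℤ.- (+ 0 ℤ.- a) ≡ (a ℤ.+ (b ℤ.+ (c ℤ.+ (d ℤ.+ + 0)))) ℤ.- + 0
        rest = ℤ-Ring.solve-∀
      nonPos 1F = 0≤-by (0≤-+ (0≤x 0F) (0≤-+ (0≤x 2F) (0≤x 3F))) (transfer ∑x≡0 (rest (x 0F) (x 1F) (x 2F) (x 3F)))
        where
        rest : ∀ a b c d → (a ℤ.+ (c ℤ.+ d)) ℤ.- (+ 0 ℤ.- b) ≡ (a ℤ.+ (b ℤ.+ (c ℤ.+ (d ℤ.+ + 0)))) ℤ.- + 0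
        rest = ℤ-Ring.solve-∀
      nonPos 2F = 0≤-by (0≤-+ (0≤x 0F) (0≤-+ (0≤x 1F) (0≤x 3F))) (transfer ∑x≡0 (rest (x 0F) (x 1F) (x 2F) (x 3F)))
        where
        rest : ∀ a b c d → (a ℤ.+ (b ℤ.+ d)) ℤ.- (+ 0 ℤ.- c) ≡ (a ℤ.+ (b ℤ.+ (c ℤ.+ (d ℤ.+ + 0)))) ℤ.- + 0
        rest = ℤ-Ring.solve-∀
      nonPos 3F = 0≤-by (0≤-+ (0≤x 0F) (0≤-+ (0≤x 1F) (0≤x 2F))) (transfer ∑x≡0 (rest (x 0F) (x 1F) (x 2F) (x 3F)))
        where
        rest : ∀ a b c d → (a ℤ.+ (b ℤ.+ c)) ℤ.- (+ 0 ℤ.- d) ≡ (a ℤ.+ (b ℤ.+ (c ℤ.+ (d ℤ.+ + 0)))) ℤ.- + 0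
        rest = ℤ-Ring.solve-∀

    result : Coordinates (+ 1) v
    result = by-K K ≡.refl
      where
      by-K : ∀ κ → K ≡ κ → Coordinates (+ 1) v
      by-K (+ 0) K≡ = integral (no-remainder K≡)
      by-K (+ 1) K≡ = ⊥-elim (one-remainder K≡)
      by-K (+ 2) K≡ = ⊥-elim (two-remainders K≡)
      by-K (+ 3) K≡ = ⊥-elim (three-remainders K≡)
      -- Four remainders sum to at most `4 N`, which is 4 less than `4 M`.
      by-K (+ suc (suc (suc (suc n)))) K≡ = ⊥-elim (absurd (0≤-by
        (0≤-+ (0≤-+ (0≤-+ (x≤N 0F) (x≤N 1F)) (0≤-+ (x≤N 2F) (x≤N 3F))) (0≤nM n))
        (transfer (≡.sym (≡.trans ∑x (≡.cong (ℤ._* M) K≡)))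
          (rearrange (x 0F) (x 1F) (x 2F) (x 3F) (+ n) (+ N)))))
        where
        absurd : ¬ + 0 ℤ.≤ -[1+ 3 ]
        absurd ()
        0≤nM : ∀ n → + 0 ℤ.≤ + n ℤ.* M
        0≤nM n = ≡.subst (+ 0 ℤ.≤_) (ℤ.pos-* n (suc N)) (ℤ.+≤+ z≤n)
        rearrange : ∀ a b c d n N →
          ((N ℤ.- a ℤ.+ (N ℤ.- b)) ℤ.+ (N ℤ.- c ℤ.+ (N ℤ.- d)) ℤ.+ n ℤ.* (+ 1 ℤ.+ N)) ℤ.- -[1+ 3 ] ≡
          (+ 4 ℤ.+ n) ℤ.* (+ 1 ℤ.+ N) ℤ.- (a ℤ.+ (b ℤ.+ (c ℤ.+ (d ℤ.+ + 0))))
        rearrange = ℤ-Ring.solve-∀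
      by-K -[1+ n ] K≡ = ⊥-elim (absurd (0≤-by
        (0≤-+ (0≤x 0F) (0≤-+ (0≤x 1F) (0≤-+ (0≤x 2F) (0≤-+ (0≤x 3F) ℤ.≤-refl))))
        (≡.trans ∑x (≡.cong (ℤ._* M) K≡))))
        where
        absurd : ¬ + 0 ℤ.≤ -[1+ n ] ℤ.* M
        absurd ()

  abstract
    unimodular : ∀ v → Coordinates (+ 1) v
    unimodular v = Reduction.result N v (remainders N v (proj₂ rational-coordinates v))
      where
      N : ℕ
      N = proj₁ rational-coordinates

-- Short vectors and near points

-- In homogeneous coordinates (0 , z), Short d says that the coordinates of d differ by at most 1.
-- In dimension n these d are, up to sign, the 0/1-vectors.
homogeneous : ∀ {n} → Vector ℤ n → Vector ℤ (suc n)
homogeneous z = + 0 ∷ z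

Short : ∀ {n} → Vector ℤ n → Set
Short d = ∀ k l → homogeneous d k ℤ.- homogeneous d l ℤ.≤ + 1

Near : ∀ {n} → Vector ℤ n → Vector ℤ n → Set
Near z z′ = Short (z -ᵥ z′)

homogeneous-- : ∀ {n} (z z′ : Vector ℤ n) k →
                homogeneous (z -ᵥ z′) k ≡ homogeneous z k ℤ.- homogeneous z′ k
homogeneous-- z z′ zero    = ≡.refl
homogeneous-- z z′ (suc k) = ≡.refl

homogeneous-cong : ∀ {n} {d d′ : Vector ℤ n} → d ≗ d′ → homogeneous d ≗ homogeneous d′
homogeneous-cong d≗d′ zero    = ≡.refl
homogeneous-cong d≗d′ (suc k) = d≗d′ k

Short-cong : ∀ {n} {d d′ : Vector ℤ n} → d ≗ d′ → Short d → Short d′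
Short-cong {d = d} {d′} d≗d′ short k l =
  ≡.subst₂ (λ a b → a ℤ.- b ℤ.≤ + 1) (homogeneous-cong d≗d′ k) (homogeneous-cong d≗d′ l) (short k l)

Short-neg : ∀ {n} {d : Vector ℤ n} → Short d → Short (λ k → ℤ.- d k)
Short-neg {d = d} short k l = ≡.subst (ℤ._≤ + 1)
  (≡.trans (flip (homogeneous d k) (homogeneous d l)) (≡.sym (≡.cong₂ ℤ._-_ (neg k) (neg l)))) (short l k)
  where
  flip : ∀ a b → b ℤ.- a ≡ ℤ.- a ℤ.- ℤ.- b
  flip = ℤ-Ring.solve-∀
  neg : ∀ k → homogeneous (λ k → ℤ.- d k) k ≡ ℤ.- homogeneous d k
  neg zero    = ≡.refl
  neg (suc k) = ≡.refl

Near-sym : ∀ {n} {z z′ : Vector ℤ n} → Near z z′ → Near z′ z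
Near-sym {z = z} {z′} near = Short-cong (λ k → flip (z k) (z′ k)) (Short-neg near)
  where
  flip : ∀ a b → ℤ.- (a ℤ.- b) ≡ b ℤ.- a
  flip = ℤ-Ring.solve-∀

Near-cong : ∀ {n} {z₁ z₂ z₁′ z₂′ : Vector ℤ n} → z₁ ≗ z₂ → z₁′ ≗ z₂′ → Near z₁ z₁′ → Near z₂ z₂′
Near-cong p q = Short-cong (λ k → ≡.cong₂ ℤ._-_ (p k) (q k))

Short? : ∀ {n} (d : Vector ℤ n) → Dec (Short d)
Short? d = Fin.all? λ k → Fin.all? λ l → homogeneous d k ℤ.- homogeneous d l ℤ.≤? + 1

trit : Fin 3 → ℤ
trit 0F = -[1+ 0 ]
trit 1F = + 0
trit 2F = + 1

trits : Fin 3 → Fin 3 → Fin 3 → Vector ℤ 3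
trits a b c = trit a ∷ trit b ∷ trit c ∷ []

Short⇒trit : ∀ {n} {d : Vector ℤ n} → Short d → ∀ k → ∃ λ a → d k ≡ trit a
Short⇒trit {d = d} short k = cases (d k) (short (suc k) zero) (short zero (suc k))
  where
  cases : ∀ z → z ℤ.+ + 0 ℤ.≤ + 1 → + 0 ℤ.- z ℤ.≤ + 1 → ∃ λ a → z ≡ trit a
  cases (+ 0)             _             _             = 1F , ≡.refl
  cases (+ 1)             _             _             = 2F , ≡.refl
  cases (+ suc (suc n))   (ℤ.+≤+ (s≤s ())) _
  cases -[1+ 0 ]          _             _             = 0F , ≡.refl
  cases -[1+ suc n ]      _             (ℤ.+≤+ (s≤s ()))

-- Up to sign, `d` is a 0/1-vector, and its sum is the number of its ones, which is at most 3.
Short-4∣sum : ∀ d → Short d → + 4 ℤ.∣ ℤΣ.sum {3} d → ∀ k → d k ≡ + 0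
Short-4∣sum d short 4∣∑d k = ≡.trans (d≗trits k)
  (decided (proj₁ (tr 0F)) (proj₁ (tr 1F)) (proj₁ (tr 2F)) (Short-cong d≗trits short)
    (≡.subst (+ 4 ℤ.∣_) (ℤΣ.sum-cong-≗ d≗trits) 4∣∑d) k)
  where
  tr = Short⇒trit short
  d≗trits : d ≗ trits (proj₁ (tr 0F)) (proj₁ (tr 1F)) (proj₁ (tr 2F))
  d≗trits 0F = proj₂ (tr 0F)
  d≗trits 1F = proj₂ (tr 1F)
  d≗trits 2F = proj₂ (tr 2F)
  decided : ∀ a b c → Short (trits a b c) → + 4 ℤ.∣ ℤΣ.sum (trits a b c) → ∀ k → trits a b c k ≡ + 0
  decided = from-yes (Fin.all? λ a → Fin.all? λ b → Fin.all? λ c →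
    Short? (trits a b c) →-dec (+ 4 ℤ.∣? ℤΣ.sum (trits a b c)) →-dec
    Fin.all? λ k → trits a b c k ℤ.≟ + 0)

-- The coordinate sums of pairwise near points are distinct modulo 4, so there are at most four such points.
near-all⇒member : (w : Vector (Vector ℤ 3) 4) (z : Vector ℤ 3) → (∀ i j → Near (w i) (w j)) →
                  (∀ i j → w i ≗ w j → i ≡ j) → (∀ i → Near (w i) z) → ∃ λ i → w i ≗ z
near-all⇒member w z near injective near-z = conclude (Fin.pigeonhole (ℕ.n<1+n 4) class)
  where
  q : Vector (Vector ℤ 3) 5
  q = z ∷ w
  class : Fin 5 → Fin 4
  class i = Fin.fromℕ< (ℤ.n%ℕd<d (ℤΣ.sum (q i)) 4)
  4∣difference : ∀ i j → class i ≡ class j → + 4 ℤ.∣ ℤΣ.sum (q i -ᵥ q j)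
  4∣difference i j same = ℤ.divides (a ℤ./ℕ 4 ℤ.- b ℤ./ℕ 4) (begin
    ℤΣ.sum (q i -ᵥ q j)       ≡⟨ expand (q i 0F) (q i 1F) (q i 2F) (q j 0F) (q j 1F) (q j 2F) ⟩
    a ℤ.- b                   ≡⟨ ≡.cong₂ ℤ._-_ (ℤ.a≡a%ℕn+[a/ℕn]*n a 4) (ℤ.a≡a%ℕn+[a/ℕn]*n b 4) ⟩
    (+ (a ℤ.%ℕ 4) ℤ.+ (a ℤ./ℕ 4) ℤ.* + 4) ℤ.- (+ (b ℤ.%ℕ 4) ℤ.+ (b ℤ./ℕ 4) ℤ.* + 4)
      ≡⟨ ≡.cong (λ r → (+ r ℤ.+ (a ℤ./ℕ 4) ℤ.* + 4) ℤ.- (+ (b ℤ.%ℕ 4) ℤ.+ (b ℤ./ℕ 4) ℤ.* + 4)) remainders ⟩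
    (+ (b ℤ.%ℕ 4) ℤ.+ (a ℤ./ℕ 4) ℤ.* + 4) ℤ.- (+ (b ℤ.%ℕ 4) ℤ.+ (b ℤ./ℕ 4) ℤ.* + 4)
      ≡⟨ cancel (+ (b ℤ.%ℕ 4)) (a ℤ./ℕ 4) (b ℤ./ℕ 4) ⟩
    (a ℤ./ℕ 4 ℤ.- b ℤ./ℕ 4) ℤ.* + 4 ∎)
    where
    open ≡.≡-Reasoning
    a = ℤΣ.sum (q i)
    b = ℤΣ.sum (q j)
    expand : ∀ a b c d e f → (a ℤ.- d) ℤ.+ ((b ℤ.- e) ℤ.+ ((c ℤ.- f) ℤ.+ + 0)) ≡
             (a ℤ.+ (b ℤ.+ (c ℤ.+ + 0))) ℤ.- (d ℤ.+ (e ℤ.+ (f ℤ.+ + 0)))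
    expand = ℤ-Ring.solve-∀
    cancel : ∀ r x y → (r ℤ.+ x ℤ.* + 4) ℤ.- (r ℤ.+ y ℤ.* + 4) ≡ (x ℤ.- y) ℤ.* + 4
    cancel = ℤ-Ring.solve-∀
    remainders : a ℤ.%ℕ 4 ≡ b ℤ.%ℕ 4
    remainders = ≡.trans (≡.sym (Fin.toℕ-fromℕ< (ℤ.n%ℕd<d a 4)))
      (≡.trans (≡.cong Fin.toℕ same) (Fin.toℕ-fromℕ< (ℤ.n%ℕd<d b 4)))
  equal : ∀ i j → Near (q i) (q j) → class i ≡ class j → q i ≗ q j
  equal i j near-ij same k = ℤ.i-j≡0⇒i≡j _ _ (Short-4∣sum (q i -ᵥ q j) near-ij (4∣difference i j same) k)
  conclude : (∃ λ i → ∃ λ j → i Fin.< j × class i ≡ class j) → ∃ λ i → w i ≗ z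
  conclude (zero  , suc j , _   , same) = j , equal (suc j) zero (near-z j) (≡.sym same)
  conclude (suc i , suc j , i<j , same) =
    ⊥-elim (Fin.<⇒≢ i<j (≡.cong suc (injective i j (equal (suc i) (suc j) (near i j) same))))

-- Congruence modulo 2

_≡₂?_ : ∀ {n} (z z′ : Vector ℤ n) → Dec (z ≡₂ z′)
z ≡₂? z′ = map′ modulo₂ even (Fin.all? λ k → + 2 ℤ.∣? z k ℤ.- z′ k)

≗? : ∀ {n} (z z′ : Vector ℤ n) → Dec (z ≗ z′)
≗? z z′ = Fin.all? λ k → z k ℤ.≟ z′ k

≡₂-reflexive : ∀ {n} {y z : Vector ℤ n} → y ≗ z → y ≡₂ z
≡₂-reflexive {y = y} {z} y≗z = modulo₂ λ k → ℤ.divides (+ 0)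
  (≡.trans (≡.cong (ℤ._- z k) (y≗z k)) (ℤ.+-inverseʳ (z k)))

≡₂-trans : ∀ {n} {x y z : Vector ℤ n} → x ≡₂ y → y ≡₂ z → x ≡₂ z
≡₂-trans {x = x} {y} {z} x≡y y≡z = modulo₂ λ k → ≡.subst (+ 2 ℤ.∣_) (telescope (x k) (y k) (z k))
  (ℤ.∣m∣n⇒∣m+n (even x≡y k) (even y≡z k))
  where
  telescope : ∀ x y z → (x ℤ.- y) ℤ.+ (y ℤ.- z) ≡ x ℤ.- z
  telescope = ℤ-Ring.solve-∀

≡₂-sym : ∀ {n} {x y : Vector ℤ n} → x ≡₂ y → y ≡₂ x
≡₂-sym {x = x} {y} x≡y = modulo₂ λ k → ≡.subst (+ 2 ℤ.∣_) (flip (x k) (y k)) (ℤ.∣m⇒∣-m (even x≡y k))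
  where
  flip : ∀ x y → ℤ.- (x ℤ.- y) ≡ y ℤ.- x
  flip = ℤ-Ring.solve-∀

apply-≡₂ : ∀ {n} (a : Matrix n) {y z} → y ≡₂ z → apply a y ≡₂ apply a z
apply-≡₂ a {y} {z} y≡z = modulo₂ λ i → let h = λ k → ℤ.quotient (even y≡z k) in ℤ.divides (a i ∙ h) (begin
  a i ∙ y ℤ.- a i ∙ z            ≡⟨ ∙--ʳ (a i) y z ⟨
  a i ∙ (y -ᵥ z)                 ≡⟨ ∙-congʳ (a i) (λ k → ≡.trans (ℤ._∣_.equality (even y≡z k)) (ℤ.*-comm (h k) (+ 2))) ⟩
  a i ∙ (λ k → + 2 ℤ.* h k)      ≡⟨ ∙-scaleʳ (+ 2) (a i) h ⟩
  + 2 ℤ.* a i ∙ h                ≡⟨ ℤ.*-comm (+ 2) (a i ∙ h) ⟩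
  a i ∙ h ℤ.* + 2                ∎)
  where
  open ≡.≡-Reasoning

-- The possible sets of edges

bit : Fin 2 → ℤ
bit β = + Fin.toℕ β

bits : Fin 2 → Fin 2 → Fin 2 → Vector ℤ 3
bits a b c = bit a ∷ bit b ∷ bit c ∷ []

parity : ∀ (z : Vector ℤ 3) → ∃ λ a → ∃ λ b → ∃ λ c → z ≡₂ bits a b c
parity z = r 0F , r 1F , r 2F , modulo₂ λ
  { 0F → even′ 0F
  ; 1F → even′ 1F
  ; 2F → even′ 2F
  }
  where
  r : Fin 3 → Fin 2
  r k = Fin.fromℕ< (ℤ.n%ℕd<d (z k) 2)
  even′ : ∀ k → + 2 ℤ.∣ z k ℤ.- bit (r k)
  even′ k = ℤ.divides (z k ℤ./ℕ 2) (transfer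
    (≡.cong₂ (λ a b → a ℤ.- + b) (ℤ.a≡a%ℕn+[a/ℕn]*n (z k) 2) (Fin.toℕ-fromℕ< (ℤ.n%ℕd<d (z k) 2)))
    (rearrange (z k) (bit (r k)) (+ (z k ℤ.%ℕ 2)) (z k ℤ./ℕ 2)))
    where
    rearrange : ∀ z b r q → (z ℤ.- b) ℤ.- q ℤ.* + 2 ≡ (z ℤ.- b) ℤ.- ((r ℤ.+ q ℤ.* + 2) ℤ.- r)
    rearrange = ℤ-Ring.solve-∀

𝟙 : Vector ℤ 3
𝟙 _ = + 1

-- The standard simplex with vertices 0 and the unit vectors, which is what the reference cell
-- becomes in the basis of its sides.
origin : Vector (Vector ℤ 3) 4
origin zero    = λ _ → + 0
origin (suc i) = identity i

-- The twelve edge vectors of the standard simplex, a root system of type A₃, together with 0.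
-- Admitting 0 allows statements about all pairs of vertices, equal ones included.
Root : Vector ℤ 3 → Set
Root t = ∃ λ i → ∃ λ j → t ≗ origin i -ᵥ origin j

-- Of the eight classes modulo 2, the edges of the standard simplex occupy six; those of 0 and of
-- `𝟙` remain.
residue-classes : ∀ a b c → bits a b c ≡₂ origin 0F ⊎ bits a b c ≡₂ 𝟙 ⊎
                  ∃ λ i → ∃ λ j → ¬ i ≡ j × bits a b c ≡₂ origin i -ᵥ origin j
residue-classes = from-yes (Fin.all? λ a → Fin.all? λ b → Fin.all? λ c →
  (bits a b c ≡₂? origin 0F) ⊎-dec (bits a b c ≡₂? 𝟙) ⊎-dec
  Fin.any? λ i → Fin.any? λ j → ¬? (i Fin.≟ j) ×-dec (bits a b c ≡₂? (origin i -ᵥ origin j)))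

-- The directions of the three diagonals of the octahedron with vertices eₚ and 𝟙 - eₚ.
diagonal : Fin 3 → Vector ℤ 3
diagonal s = 𝟙 -ᵥ identity s -ᵥ identity s

-- Edges relative to a reference cell

module Basis {Cell} (system : CellSystem Cell) {w} (cell : Cell w) where
  open Unimodular system cell
  open Rational system cell using (side; sides-independent)

  abstract
    -- The columns of the matrix are the sides of the cell. Those of the right inverse are the
    -- integral coordinates of the unit vectors; the entry at vertex 0 is dropped, being determined
    -- by the sum zero.
    basis : GL 3
    basis = rightInverse⇒GL (λ k i → side i k) (λ i k → proj₁ (unimodular (λ l → identity l k)) (suc i))
      injective (λ l k → ≡.trans (rearrange (proj₁ (unimodular (λ l → identity l k))) l
          (proj₁ (proj₂ (unimodular (λ l → identity l k)))))
        (≡.trans (proj₂ (proj₂ (unimodular (λ l → identity l k))) l) (ℤ.*-identityˡ _)))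
      where
      rearrange : ∀ (X : Vector ℤ 4) l → ℤΣ.sum X ≡ + 0 → (λ i → side i l) ∙ (λ i → X (suc i)) ≡ (X · w) l
      rearrange X l ∑X≡0 = transfer (≡.cong (λ z → ℤ.- (z ℤ.* w 0F l)) ∑X≡0)
        (expand (X 0F) (X 1F) (X 2F) (X 3F) (w 0F l) (w 1F l) (w 2F l) (w 3F l))
        where
        expand : ∀ p q r s a b c d →
          ((b ℤ.- a) ℤ.* q ℤ.+ ((c ℤ.- a) ℤ.* r ℤ.+ ((d ℤ.- a) ℤ.* s ℤ.+ + 0))) ℤ.-
          (p ℤ.* a ℤ.+ (q ℤ.* b ℤ.+ (r ℤ.* c ℤ.+ (s ℤ.* d ℤ.+ + 0)))) ≡
          ℤ.- ((p ℤ.+ (q ℤ.+ (r ℤ.+ (s ℤ.+ + 0)))) ℤ.* a) ℤ.- ℤ.- (+ 0 ℤ.* a)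
        expand = ℤ-Ring.solve-∀
      injective : ∀ y z → apply (λ k i → side i k) y ≗ apply (λ k i → side i k) z → y ≗ z
      injective y z same i = ℤ.i-j≡0⇒i≡j (y i) (z i) (component i)
        where
        expand : ∀ a b c p q r s t u →
          ((p ℤ.- s) ℤ.* a ℤ.+ (q ℤ.- t) ℤ.* b ℤ.+ (r ℤ.- u) ℤ.* c) ℤ.- + 0 ≡
          (a ℤ.* p ℤ.+ (b ℤ.* q ℤ.+ (c ℤ.* r ℤ.+ + 0))) ℤ.- (a ℤ.* s ℤ.+ (b ℤ.* t ℤ.+ (c ℤ.* u ℤ.+ + 0)))
        expand = ℤ-Ring.solve-∀
        zeros : ∀ i → Rational.affine system cell (y 0F ℤ.- z 0F) (y 1F ℤ.- z 1F) (y 2F ℤ.- z 2F) i ≡ + 0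
        zeros = sides-independent (y 0F ℤ.- z 0F) (y 1F ℤ.- z 1F) (y 2F ℤ.- z 2F) (λ k → transfer (same k)
          (expand (side 0F k) (side 1F k) (side 2F k) (y 0F) (y 1F) (y 2F) (z 0F) (z 1F) (z 2F)))
        component : ∀ i → y i ℤ.- z i ≡ + 0
        component 0F = zeros 1F
        component 1F = zeros 2F
        component 2F = zeros 3F

    matrix-basis : ∀ k i → GL.matrix basis k i ≡ w (suc i) k ℤ.- w 0F k
    matrix-basis k i = ≡.refl

module Classification {Cell} (system : CellSystem Cell) {w} (cell : Cell w) where
  open CellSystem system
  open Edges system
  open Basis system cell
  open GL basis using () renaming (matrix to B; inverse to B⁻¹)

  -- Edges of any cell, written in the basis of the sides of `w`.
  edge : Vector (Vector ℤ 3) 4 → Fin 4 → Fin 4 → Vector ℤ 3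
  edge w′ i j = apply B⁻¹ (w′ i -ᵥ w′ j)

  B-edge : ∀ w′ i j → apply B (edge w′ i j) ≗ w′ i -ᵥ w′ j
  B-edge w′ i j = apply-inverseʳ basis (w′ i -ᵥ w′ j)

  edge-origin : ∀ i j → edge w i j ≗ origin i -ᵥ origin j
  edge-origin i j k = ≡.trans (apply-cong B⁻¹ (λ l → ≡.sym (≡.trans (apply-- B (origin i) (origin j) l)
      (≡.trans (≡.cong₂ ℤ._-_ (B-origin i l) (B-origin j l)) (cancel (w i l) (w j l) (w 0F l))))) k)
    (apply-inverseˡ basis (origin i -ᵥ origin j) k)
    where
    cancel : ∀ a b c → (a ℤ.- c) ℤ.- (b ℤ.- c) ≡ a ℤ.- b
    cancel = ℤ-Ring.solve-∀
    B-origin : ∀ i l → apply B (origin i) l ≡ w i l ℤ.- w 0F l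
    B-origin zero    l = ≡.trans (≡.trans (∙-comm (B l) (λ _ → + 0)) (∙-scaleˡ (+ 0) (B l) (B l)))
      (≡.trans (ℤ.*-zeroˡ (B l ∙ B l)) (≡.sym (ℤ.+-inverseʳ (w 0F l))))
    B-origin (suc i) l = ≡.trans (∙-identity (B l) i) (matrix-basis l i)

  edge-difference : ∀ w′ i j k → edge w′ i j ≗ edge w′ i k +ᵥ edge w′ k j
  edge-difference w′ i j k l = ≡.trans (apply-cong B⁻¹ (λ p → telescope (w′ i p) (w′ j p) (w′ k p)) l)
    (∙-+ʳ (B⁻¹ l) (w′ i -ᵥ w′ k) (w′ k -ᵥ w′ j))
    where
    telescope : ∀ a b c → a ℤ.- b ≡ (a ℤ.- c) ℤ.+ (c ℤ.- b)
    telescope = ℤ-Ring.solve-∀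

  edge-≡₂ : ∀ {w′ w″} i j k l → edge w′ i j ≡₂ edge w″ k l → w′ i -ᵥ w′ j ≡₂ w″ k -ᵥ w″ l
  edge-≡₂ {w′} {w″} i j k l t≡t′ = ≡₂-trans (≡₂-reflexive (λ p → ≡.sym (B-edge w′ i j p)))
    (≡₂-trans (apply-≡₂ B t≡t′) (≡₂-reflexive (B-edge w″ k l)))

  congruent-coordinates : ∀ {w′ w″} → Cell w′ → Cell w″ → ∀ i j k l → ¬ i ≡ j → edge w′ i j ≡₂ edge w″ k l →
                          (edge w′ i j ≗ edge w″ k l) ⊎ (edge w′ i j ≗ edge w″ l k)
  congruent-coordinates {w′} {w″} cell′ cell″ i j k l i≢j t≡t′ = Sum.map (apply-cong B⁻¹) (apply-cong B⁻¹)
    (congruent-edges {w′} {w″} cell′ cell″ i j k l i≢j (edge-≡₂ {w′} {w″} i j k l t≡t′))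

  -- An edge congruent to 0 would be congruent to the degenerate edge from `i` to `i`, and so have
  -- equal ends. An edge congruent to one of `w` equals it up to sign. The class of `𝟙` is the only
  -- one on which `w` gives no information.
  edge-type : ∀ {w′} → Cell w′ → ∀ i j → ¬ i ≡ j → Root (edge w′ i j) ⊎ edge w′ i j ≡₂ 𝟙
  edge-type {w′} cell′ i j i≢j = by-residue (parity (edge w′ i j))
    where
    degenerate : edge w′ i j ≡₂ origin 0F → ⊥
    degenerate t≡0 = i≢j (vertex-injective cell′ i j (equal
      (congruent-edges {w′} {w′} cell′ cell′ i j i i i≢j (edge-≡₂ {w′} {w′} i j i i
        (≡₂-trans t≡0 (≡₂-reflexive (λ k → ≡.sym (zero-edge k))))))))
      where
      zero-edge : edge w′ i i ≗ origin 0F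
      zero-edge k = ≡.trans (∙--ʳ (B⁻¹ k) (w′ i) (w′ i)) (ℤ.+-inverseʳ (B⁻¹ k ∙ w′ i))
      equal : (w′ i -ᵥ w′ j ≗ w′ i -ᵥ w′ i) ⊎ (w′ i -ᵥ w′ j ≗ w′ i -ᵥ w′ i) → w′ i ≗ w′ j
      equal (inj₁ same) k = ℤ.i-j≡0⇒i≡j _ _ (≡.trans (same k) (ℤ.+-inverseʳ (w′ i k)))
      equal (inj₂ same) k = ℤ.i-j≡0⇒i≡j _ _ (≡.trans (same k) (ℤ.+-inverseʳ (w′ i k)))
    root : ∀ k l → ¬ k ≡ l → edge w′ i j ≡₂ origin k -ᵥ origin l → Root (edge w′ i j)
    root k l k≢l t≡ = signed (congruent-coordinates {w′} {w} cell′ cell i j k l i≢j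
      (≡₂-trans t≡ (≡₂-reflexive (λ p → ≡.sym (edge-origin k l p)))))
      where
      signed : (edge w′ i j ≗ edge w k l) ⊎ (edge w′ i j ≗ edge w l k) → Root (edge w′ i j)
      signed (inj₁ same) = k , l , λ p → ≡.trans (same p) (edge-origin k l p)
      signed (inj₂ same) = l , k , λ p → ≡.trans (same p) (edge-origin l k p)
    by-residue : (∃ λ a → ∃ λ b → ∃ λ c → edge w′ i j ≡₂ bits a b c) → Root (edge w′ i j) ⊎ edge w′ i j ≡₂ 𝟙
    by-residue (a , b , c , t≡b) = by-class (residue-classes a b c)
      where
      by-class : bits a b c ≡₂ origin 0F ⊎ bits a b c ≡₂ 𝟙 ⊎
                 (∃ λ i → ∃ λ j → ¬ i ≡ j × bits a b c ≡₂ origin i -ᵥ origin j) →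
                 Root (edge w′ i j) ⊎ edge w′ i j ≡₂ 𝟙
      by-class (inj₁ b≡0)                          = ⊥-elim (degenerate (≡₂-trans t≡b b≡0))
      by-class (inj₂ (inj₁ b≡1))                   = inj₂ (≡₂-trans t≡b b≡1)
      by-class (inj₂ (inj₂ (k , l , k≢l , b≡kl))) = inj₁ (root k l k≢l (≡₂-trans t≡b b≡kl))

  -- A cell covering the centre w₀ + B 𝟙 / 2 of the octahedron B (eₚ), B (𝟙 - eₚ) has a diagonal edge:
  -- otherwise its vertices are among those of the octahedron, without antipodal pairs.
  module Octahedron {w′} (cell′ : Cell w′)
    (covers : ∀ f m → (∀ j → m ℤ.≤ f ∙ w′ j) → + 2 ℤ.* m ℤ.≤ f ∙ (w 0F +ᵥ w 0F +ᵥ apply B 𝟙))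
    (roots : ∀ i j → Root (edge w′ i j)) where

    t : Vector (Vector ℤ 3) 4
    t j = apply B⁻¹ (w′ j -ᵥ w 0F)

    t-difference : ∀ i j → t i -ᵥ t j ≗ edge w′ i j
    t-difference i j k = ≡.trans (≡.sym (∙--ʳ (B⁻¹ k) (w′ i -ᵥ w 0F) (w′ j -ᵥ w 0F)))
      (apply-cong B⁻¹ (λ p → cancel (w′ i p) (w′ j p) (w 0F p)) k)
      where
      cancel : ∀ a b c → (a ℤ.- c) ℤ.- (b ℤ.- c) ≡ a ℤ.- b
      cancel = ℤ-Ring.solve-∀

    t-root : ∀ i j → Root (t i -ᵥ t j)
    t-root i j = proj₁ (roots i j) , proj₁ (proj₂ (roots i j)) ,
      λ k → ≡.trans (t-difference i j k) (proj₂ (proj₂ (roots i j)) k)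

    -- In the coordinates `t` the covered point is `𝟙 / 2`. The half-space is transported by the
    -- functional `φ B⁻¹`, obtained as a row of a matrix product so that `apply-⊛` evaluates it, and
    -- its bound is shifted by the value at `w 0F`.
    covers-t : ∀ φ m → (∀ j → m ℤ.≤ φ ∙ t j) → + 2 ℤ.* m ℤ.≤ φ ∙ 𝟙
    covers-t φ m m≤ = ℤ.0≤i-j⇒j≤i (0≤-by (ℤ.i≤j⇒0≤j-i (covers f (m ℤ.+ f ∙ w 0F) bound))
        (≡.trans (≡.cong (λ z → z ℤ.- + 2 ℤ.* (m ℤ.+ f ∙ w 0F)) value) (rearrange (f ∙ w 0F) (φ ∙ 𝟙) m)))
      where
      f : Vector ℤ 3
      f = ((λ (_ : Fin 3) → φ) ⊛ B⁻¹) 0F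
      f∙ : ∀ z → f ∙ z ≡ φ ∙ apply B⁻¹ z
      f∙ z = apply-⊛ (λ _ → φ) B⁻¹ z 0F
      rearrange : ∀ a b m → a ℤ.+ a ℤ.+ b ℤ.- + 2 ℤ.* (m ℤ.+ a) ≡ b ℤ.- + 2 ℤ.* m
      rearrange = ℤ-Ring.solve-∀
      bound : ∀ j → m ℤ.+ f ∙ w 0F ℤ.≤ f ∙ w′ j
      bound j = ≡.subst (m ℤ.+ f ∙ w 0F ℤ.≤_) (≡.trans (≡.cong (ℤ._+ f ∙ w 0F)
        (≡.trans (≡.sym (f∙ (w′ j -ᵥ w 0F))) (∙--ʳ f (w′ j) (w 0F)))) (cancel (f ∙ w′ j) (f ∙ w 0F)))
        (ℤ.+-monoˡ-≤ (f ∙ w 0F) (m≤ j))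
        where
        cancel : ∀ a b → a ℤ.- b ℤ.+ b ≡ a
        cancel = ℤ-Ring.solve-∀
      value : f ∙ (w 0F +ᵥ w 0F +ᵥ apply B 𝟙) ≡ f ∙ w 0F ℤ.+ f ∙ w 0F ℤ.+ φ ∙ 𝟙
      value = ≡.trans (∙-+ʳ f (w 0F +ᵥ w 0F) (apply B 𝟙)) (≡.cong₂ ℤ._+_ (∙-+ʳ f (w 0F) (w 0F))
        (≡.trans (f∙ (apply B 𝟙)) (∙-congʳ φ (apply-inverseˡ basis 𝟙))))

    -- The form `φ` has the value `c + 1/2` at the covered point, so some vertex has a value of at
    -- most `c` and some vertex one of at least `c + 1`. As the vertices differ by roots, any two
    -- values differ by at most 1.
    slab : ∀ φ c → (∀ i j → φ ∙ (origin i -ᵥ origin j) ℤ.≤ + 1) → φ ∙ 𝟙 ≡ + 2 ℤ.* c ℤ.+ + 1 →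
           ∀ j → c ℤ.≤ φ ∙ t j × φ ∙ t j ℤ.≤ c ℤ.+ + 1
    slab φ c thin middle j = lower (Fin.any? λ a → c ℤ.+ + 1 ℤ.≤? φ ∙ t a) ,
                             upper (Fin.any? λ a → φ ∙ t a ℤ.≤? c)
      where
      near : ∀ i j → + 0 ℤ.≤ + 1 ℤ.- (φ ∙ t i ℤ.- φ ∙ t j)
      near i j = 0≤-by (ℤ.i≤j⇒0≤j-i (thin (proj₁ (t-root i j)) (proj₁ (proj₂ (t-root i j)))))
        (≡.cong (ℤ._-_ (+ 1)) (≡.trans (≡.sym (∙-congʳ φ (proj₂ (proj₂ (t-root i j))))) (∙--ʳ φ (t i) (t j))))
      upper : Dec (∃ λ a → φ ∙ t a ℤ.≤ c) → φ ∙ t j ℤ.≤ c ℤ.+ + 1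
      upper (yes (a , ta≤c)) = ℤ.0≤i-j⇒j≤i (0≤-by (0≤-+ (near j a) (ℤ.i≤j⇒0≤j-i ta≤c))
        (rearrange (φ ∙ t j) (φ ∙ t a) c))
        where
        rearrange : ∀ x y c → (+ 1 ℤ.- (x ℤ.- y)) ℤ.+ (c ℤ.- y) ≡ c ℤ.+ + 1 ℤ.- x
        rearrange = ℤ-Ring.solve-∀
      upper (no none) = ⊥-elim (0≰-1 (0≤-by (ℤ.i≤j⇒0≤j-i (covers-t φ (c ℤ.+ + 1) (λ a →
        ≡.subst (ℤ._≤ φ ∙ t a) (ℤ.+-comm (+ 1) c) (ℤ.i<j⇒suc[i]≤j (ℤ.≰⇒> (λ ta≤c → none (a , ta≤c)))))))
        (≡.trans (≡.cong (ℤ._- (+ 2 ℤ.* (c ℤ.+ + 1))) middle) (rearrange c))))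
        where
        rearrange : ∀ c → (+ 2 ℤ.* c ℤ.+ + 1) ℤ.- + 2 ℤ.* (c ℤ.+ + 1) ≡ -[1+ 0 ]
        rearrange = ℤ-Ring.solve-∀
      lower : Dec (∃ λ a → c ℤ.+ + 1 ℤ.≤ φ ∙ t a) → c ℤ.≤ φ ∙ t j
      lower (yes (a , c<ta)) = ℤ.0≤i-j⇒j≤i (0≤-by (0≤-+ (near a j) (ℤ.i≤j⇒0≤j-i c<ta))
        (rearrange (φ ∙ t j) (φ ∙ t a) c))
        where
        rearrange : ∀ x y c → (+ 1 ℤ.- (y ℤ.- x)) ℤ.+ (y ℤ.- (c ℤ.+ + 1)) ≡ x ℤ.- c
        rearrange = ℤ-Ring.solve-∀
      lower (no none) = ⊥-elim (0≰-1 (0≤-by (ℤ.i≤j⇒0≤j-i (covers-t (λ k → -[1+ 0 ] ℤ.* φ k) (ℤ.- c) (λ a →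
        ≡.subst (ℤ.- c ℤ.≤_) (≡.trans (≡.sym (ℤ.-1*i≡-i (φ ∙ t a))) (≡.sym (∙-scaleˡ -[1+ 0 ] φ (t a))))
          (ℤ.neg-mono-≤ (ℤ.0≤i-j⇒j≤i (below a))))))
        (≡.trans (≡.cong (ℤ._- (+ 2 ℤ.* (ℤ.- c))) (≡.trans (∙-scaleˡ -[1+ 0 ] φ 𝟙) (≡.cong (-[1+ 0 ] ℤ.*_) middle)))
          (rearrange c))))
        where
        rearrange : ∀ c → -[1+ 0 ] ℤ.* (+ 2 ℤ.* c ℤ.+ + 1) ℤ.- + 2 ℤ.* (ℤ.- c) ≡ -[1+ 0 ]
        rearrange = ℤ-Ring.solve-∀
        below : ∀ a → + 0 ℤ.≤ c ℤ.- φ ∙ t a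
        below a = 0≤-by (ℤ.i≤j⇒0≤j-i (ℤ.i<j⇒suc[i]≤j (ℤ.≰⇒> (λ c<ta → none (a , c<ta))))) (shift c (φ ∙ t a))
          where
          shift : ∀ c x → c ℤ.+ + 1 ℤ.- (+ 1 ℤ.+ x) ≡ c ℤ.- x
          shift = ℤ-Ring.solve-∀

    vertex-bit : ∀ j p → ∃ λ β → t j p ≡ bit β
    vertex-bit j p = as-bit (t j p) (≡.subst (+ 0 ℤ.≤_) value (proj₁ bounds))
      (≡.subst (ℤ._≤ + 1) value (proj₂ bounds))
      where
      value = identity-∙ p (t j)
      thin : ∀ p i j → identity p ∙ (origin i -ᵥ origin j) ℤ.≤ + 1
      thin = from-yes (Fin.all? λ p → Fin.all? λ i → Fin.all? λ j →
        identity p ∙ (origin i -ᵥ origin j) ℤ.≤? + 1)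
      bounds = slab (identity p) (+ 0) (thin p) (identity-∙ p 𝟙) j
      as-bit : ∀ z → + 0 ℤ.≤ z → z ℤ.≤ + 1 → ∃ λ β → z ≡ bit β
      as-bit (+ 0) _ _ = 0F , ≡.refl
      as-bit (+ 1) _ _ = 1F , ≡.refl
      as-bit (+ suc (suc n)) _ (ℤ.+≤+ (s≤s ()))

    OctahedronVertex : Vector ℤ 3 → Fin 3 → Set
    OctahedronVertex z p = (z ≗ identity p) ⊎ (z ≗ 𝟙 -ᵥ identity p)

    -- The coordinate forms make `t j` a 0/1-vector. The form `𝟙`, with the value 3/2 at the centre,
    -- leaves those with one or two ones: the vertices of the cube without 0 and `𝟙`.
    octahedron-vertex : ∀ j → ∃ (OctahedronVertex (t j))
    octahedron-vertex j = found (decided (β 0F) (β 1F) (β 2F)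
        (≡.subst (+ 1 ℤ.≤_) (∙-congʳ 𝟙 t≗) (proj₁ bounds)) (≡.subst (ℤ._≤ + 2) (∙-congʳ 𝟙 t≗) (proj₂ bounds)))
      where
      β : Fin 3 → Fin 2
      β p = proj₁ (vertex-bit j p)
      t≗ : t j ≗ bits (β 0F) (β 1F) (β 2F)
      t≗ 0F = proj₂ (vertex-bit j 0F)
      t≗ 1F = proj₂ (vertex-bit j 1F)
      t≗ 2F = proj₂ (vertex-bit j 2F)
      thin : ∀ i j → 𝟙 ∙ (origin i -ᵥ origin j) ℤ.≤ + 1
      thin = from-yes (Fin.all? λ i → Fin.all? λ j → 𝟙 ∙ (origin i -ᵥ origin j) ℤ.≤? + 1)
      bounds = slab 𝟙 (+ 1) thin ≡.refl j
      decided : ∀ a b c → + 1 ℤ.≤ 𝟙 ∙ bits a b c → 𝟙 ∙ bits a b c ℤ.≤ + 2 → ∃ (OctahedronVertex (bits a b c))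
      decided = from-yes (Fin.all? λ a → Fin.all? λ b → Fin.all? λ c →
        (+ 1 ℤ.≤? 𝟙 ∙ bits a b c) →-dec (𝟙 ∙ bits a b c ℤ.≤? + 2) →-dec
        Fin.any? λ p → (≗? (bits a b c) (identity p)) ⊎-dec (≗? (bits a b c) (𝟙 -ᵥ identity p)))
      found : ∃ (OctahedronVertex (bits (β 0F) (β 1F) (β 2F))) → ∃ (OctahedronVertex (t j))
      found (p , v) = p , Sum.map (λ e k → ≡.trans (t≗ k) (e k)) (λ e k → ≡.trans (t≗ k) (e k)) v

    -- Two of the four vertices lie on the same of the three axes. They are equal or antipodal, but
    -- antipodal vertices differ by a vector with all entries 1 or -1, and no root has this form.
    absurd : ⊥
    absurd = collide (Fin.pigeonhole {3} {4} (s≤s (s≤s (s≤s (s≤s z≤n)))) (λ j → proj₁ (octahedron-vertex j)))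
      where
      distinct : ∀ i j → ¬ i ≡ j → ¬ t i ≗ t j
      distinct i j i≢j same = i≢j (vertex-injective cell′ i j (λ k → ℤ.i-j≡0⇒i≡j _ _
        (≡.trans (≡.sym (B-edge w′ i j k)) (≡.trans (apply-cong B (λ l → ≡.trans (≡.sym (t-difference i j l))
          (≡.trans (≡.cong (ℤ._- t j l) (same l)) (ℤ.+-inverseʳ (t j l)))) k)
          (≡.trans (∙-comm (B k) (λ _ → + 0)) (≡.trans (∙-scaleˡ (+ 0) (B k) (B k)) (ℤ.*-zeroˡ (B k ∙ B k))))))))
      antipodal : ∀ p i j → ¬ (identity p -ᵥ (𝟙 -ᵥ identity p) ≗ origin i -ᵥ origin j)
      antipodal = from-yes (Fin.all? λ p → Fin.all? λ i → Fin.all? λ j →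
        ¬? (≗? (identity p -ᵥ (𝟙 -ᵥ identity p)) (origin i -ᵥ origin j)))
      opposite : ∀ p i j → t i ≗ identity p → t j ≗ 𝟙 -ᵥ identity p → ⊥
      opposite p i j ti≗ tj≗ = antipodal p (proj₁ (t-root i j)) (proj₁ (proj₂ (t-root i j)))
        (λ k → ≡.trans (≡.cong₂ ℤ._-_ (≡.sym (ti≗ k)) (≡.sym (tj≗ k))) (proj₂ (proj₂ (t-root i j)) k))
      clash : ∀ i j p → ¬ i ≡ j → OctahedronVertex (t i) p → OctahedronVertex (t j) p → ⊥
      clash i j p i≢j (inj₁ a) (inj₁ b) = distinct i j i≢j (λ k → ≡.trans (a k) (≡.sym (b k)))
      clash i j p i≢j (inj₂ a) (inj₂ b) = distinct i j i≢j (λ k → ≡.trans (a k) (≡.sym (b k)))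
      clash i j p i≢j (inj₁ a) (inj₂ b) = opposite p i j a b
      clash i j p i≢j (inj₂ a) (inj₁ b) = opposite p j i b a
      collide : (∃ λ i → ∃ λ j → i Fin.< j × proj₁ (octahedron-vertex i) ≡ proj₁ (octahedron-vertex j)) → ⊥
      collide (i , j , i<j , same) = clash i j (proj₁ (octahedron-vertex i)) (Fin.<⇒≢ i<j)
        (proj₂ (octahedron-vertex i))
        (≡.subst (OctahedronVertex (t j)) (≡.sym same) (proj₂ (octahedron-vertex j)))

  Diagonal : Vector (Vector ℤ 3) 4 → Set
  Diagonal w′ = ∃ λ i → ∃ λ j → ¬ i ≡ j × edge w′ i j ≡₂ 𝟙

  diagonal-edge : ∃ λ w′ → Cell w′ × Diagonal w′
  diagonal-edge = search (half-covers (w 0F +ᵥ w 0F +ᵥ apply B 𝟙))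
    where
    search : (∃ λ w′ → Cell w′ × (∀ f m → (∀ j → m ℤ.≤ f ∙ w′ j) →
               + 2 ℤ.* m ℤ.≤ f ∙ (w 0F +ᵥ w 0F +ᵥ apply B 𝟙))) → ∃ λ w′ → Cell w′ × Diagonal w′
    search (w′ , cell′ , covers) = w′ , cell′ ,
      decide (Fin.any? λ i → Fin.any? λ j → ¬? (i Fin.≟ j) ×-dec (edge w′ i j ≡₂? 𝟙))
      where
      decide : Dec (Diagonal w′) → Diagonal w′
      decide (yes found) = found
      decide (no  none)  = ⊥-elim (Octahedron.absurd cell′ covers roots)
        where
        no-diagonal : ∀ i j → ¬ i ≡ j → Root (edge w′ i j) ⊎ edge w′ i j ≡₂ 𝟙 → Root (edge w′ i j)
        no-diagonal i j i≢j (inj₁ root) = root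
        no-diagonal i j i≢j (inj₂ t≡1)  = ⊥-elim (none (i , j , i≢j , t≡1))
        roots : ∀ i j → Root (edge w′ i j)
        roots i j = by-equality (i Fin.≟ j)
          where
          by-equality : Dec (i ≡ j) → Root (edge w′ i j)
          by-equality (no i≢j)     = no-diagonal i j i≢j (edge-type cell′ i j i≢j)
          by-equality (yes ≡.refl) = 0F , 0F , λ k →
            ≡.trans (∙--ʳ (B⁻¹ k) (w′ i) (w′ i)) (ℤ.+-inverseʳ (B⁻¹ k ∙ w′ i))

  Oriented : Fin 3 → Vector ℤ 3 → Set
  Oriented s t = (t ≗ diagonal s) ⊎ (t ≗ λ k → ℤ.- diagonal s k)

  -- The third vertex m of a face through the diagonal edge makes it a sum of two roots.
  diagonal-direction : ∀ {w′} → Cell w′ → ∀ i j → ¬ i ≡ j → edge w′ i j ≡₂ 𝟙 → ∃ λ s → Oriented s (edge w′ i j)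
  diagonal-direction {w′} cell′ i j i≢j t≡1 = conclude (third i j)
    where
    third : ∀ i j → ∃ λ m → ¬ i ≡ m × ¬ m ≡ j
    third = from-yes (Fin.all? {4} λ i → Fin.all? {4} λ j → Fin.any? λ m → ¬? (i Fin.≟ m) ×-dec ¬? (m Fin.≟ j))
    -- This excludes `𝟙` and its negative: the coordinate sum of two roots has absolute value at
    -- most 2.
    decided : ∀ a b c d → (origin a -ᵥ origin b) +ᵥ (origin c -ᵥ origin d) ≡₂ 𝟙 →
              ∃ λ s → Oriented s ((origin a -ᵥ origin b) +ᵥ (origin c -ᵥ origin d))
    decided = from-yes (Fin.all? λ a → Fin.all? λ b → Fin.all? λ c → Fin.all? λ d →
      (((origin a -ᵥ origin b) +ᵥ (origin c -ᵥ origin d)) ≡₂? 𝟙) →-dec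
      Fin.any? λ s → (≗? ((origin a -ᵥ origin b) +ᵥ (origin c -ᵥ origin d)) (diagonal s)) ⊎-dec
                     (≗? ((origin a -ᵥ origin b) +ᵥ (origin c -ᵥ origin d)) (λ k → ℤ.- diagonal s k)))
    -- By `same-edge` a cell has only one edge in the class of `𝟙`, so its other edges are roots.
    root : ∀ k l → ¬ k ≡ l → ¬ ((k ≡ i × l ≡ j) ⊎ (k ≡ j × l ≡ i)) → Root (edge w′ k l)
    root k l k≢l other = exclude (edge-type cell′ k l k≢l)
      where
      exclude : Root (edge w′ k l) ⊎ edge w′ k l ≡₂ 𝟙 → Root (edge w′ k l)
      exclude (inj₁ r) = r
      exclude (inj₂ kl≡1) = ⊥-elim (other (same-edge cell′ k l i j k≢l
        (edge-≡₂ {w′} {w′} k l i j (≡₂-trans kl≡1 (≡₂-sym t≡1)))))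
    conclude : (∃ λ m → ¬ i ≡ m × ¬ m ≡ j) → ∃ λ s → Oriented s (edge w′ i j)
    conclude (m , i≢m , m≢j) = direction
        (root i m i≢m λ { (inj₁ (_ , m≡j)) → m≢j m≡j ; (inj₂ (i≡j , _)) → i≢j i≡j })
        (root m j m≢j λ { (inj₁ (m≡i , _)) → i≢m (≡.sym m≡i) ; (inj₂ (m≡j , _)) → m≢j m≡j })
      where
      direction : Root (edge w′ i m) → Root (edge w′ m j) → ∃ λ s → Oriented s (edge w′ i j)
      direction (a , b , im≗) (c , d , mj≗) = proj₁ found ,
          Sum.map (λ e k → ≡.trans (sum k) (e k)) (λ e k → ≡.trans (sum k) (e k)) (proj₂ found)
        where
        sum : edge w′ i j ≗ (origin a -ᵥ origin b) +ᵥ (origin c -ᵥ origin d)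
        sum k = ≡.trans (edge-difference w′ i j m k) (≡.cong₂ ℤ._+_ (im≗ k) (mj≗ k))
        found = decided a b c d (≡₂-trans (≡₂-reflexive (λ k → ≡.sym (sum k))) t≡1)

-- A basis in which all edges are short

abstract
  -- The basis f₁ = e_p, f₁ + f₂ = e_s, f₁ + f₂ + f₃ = e_q for {p, q, s} = {0, 1, 2}.  In this basis the
  -- roots and diagonal s are, up to sign, all the nonzero 0/1-vectors.
  chain : Fin 3 → GL 3
  chain s = record
    { matrix   = H s
    ; inverse  = H⁻¹ s
    ; inverseˡ = from-yes (Fin.all? λ s → Fin.all? λ i → Fin.all? λ j → (H⁻¹ s ⊛ H s) i j ℤ.≟ identity i j) s
    ; inverseʳ = from-yes (Fin.all? λ s → Fin.all? λ i → Fin.all? λ j → (H s ⊛ H⁻¹ s) i j ℤ.≟ identity i j) s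
    }
    where
    p q : Fin 3 → Fin 3
    p = 1F ∷ 0F ∷ 0F ∷ []
    q = 2F ∷ 2F ∷ 1F ∷ []
    H H⁻¹ : Fin 3 → Matrix 3
    H s k = identity (p s) k ∷ identity s k ℤ.- identity (p s) k ∷ identity (q s) k ℤ.- identity s k ∷ []
    H⁻¹ s = 𝟙 ∷ (identity (q s) +ᵥ identity s) ∷ identity (q s) ∷ []

  short-root : ∀ s i j → Short (apply (GL.inverse (chain s)) (origin i -ᵥ origin j))
  short-root = from-yes (Fin.all? λ s → Fin.all? λ i → Fin.all? λ j →
    Short? (apply (GL.inverse (chain s)) (origin i -ᵥ origin j)))

  short-diagonal : ∀ s → Short (apply (GL.inverse (chain s)) (diagonal s))
  short-diagonal = from-yes (Fin.all? λ s → Short? (apply (GL.inverse (chain s)) (diagonal s)))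

short-oriented : ∀ s {t} → ((t ≗ diagonal s) ⊎ (t ≗ λ k → ℤ.- diagonal s k)) →
                 Short (apply (GL.inverse (chain s)) t)
short-oriented s (inj₁ t≗) = Short-cong (apply-cong (GL.inverse (chain s)) (λ k → ≡.sym (t≗ k))) (short-diagonal s)
short-oriented s {t} (inj₂ t≗) = Short-cong (λ k → ≡.sym (negate k)) (Short-neg (short-diagonal s))
  where
  A = GL.inverse (chain s)
  negate : ∀ k → A k ∙ t ≡ ℤ.- (A k ∙ diagonal s)
  negate k = ≡.trans (∙-congʳ (A k) (λ l → ≡.trans (t≗ l) (≡.sym (ℤ.-1*i≡-i (diagonal s l)))))
    (≡.trans (∙-scaleʳ -[1+ 0 ] (A k) (diagonal s)) (ℤ.-1*i≡-i (A k ∙ diagonal s)))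

classification : ∀ {Cell} → CellSystem Cell →
                 ∃ λ g → ∀ {w} → Cell w → ∀ i j → Near (apply (GL.inverse g) (w i)) (apply (GL.inverse g) (w j))
-- Any cell can serve as reference; covering the origin provides one.
classification {Cell} system = from-cell (CellSystem.half-covers system (λ _ → + 0))
  where
  Goal : Set
  Goal = ∃ λ g → ∀ {w} → Cell w → ∀ i j → Near (apply (GL.inverse g) (w i)) (apply (GL.inverse g) (w j))
  module FromDiagonal {w} (cell : Cell w) where
    open Classification system cell
    open Basis system cell using (basis)
    goal : ∀ {w′} → Cell w′ → ∀ i j → ¬ i ≡ j → edge w′ i j ≡₂ 𝟙 → (∃ λ s → Oriented s (edge w′ i j)) → Goal
    goal {w′} cell′ i j i≢j ij≡1 (s , oriented) = basis ∘GL chain s , near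
      where
      A = GL.inverse (chain s)
      short : ∀ {v} → Cell v → ∀ k l → Dec (k ≡ l) → Short (apply A (edge v k l))
      short {v} cell-v k l (yes ≡.refl) = Short-cong (apply-cong A (λ p →
        ≡.sym (≡.trans (∙--ʳ (GL.inverse basis p) (v k) (v k)) (ℤ.+-inverseʳ (GL.inverse basis p ∙ v k)))))
        (short-root s 0F 0F)
      short {v} cell-v k l (no k≢l) = by-type (edge-type cell-v k l k≢l)
        where
        by-type : Root (edge v k l) ⊎ edge v k l ≡₂ 𝟙 → Short (apply A (edge v k l))
        by-type (inj₁ (a , b , kl≗)) = Short-cong (apply-cong A (λ p → ≡.sym (kl≗ p))) (short-root s a b)
        -- An edge of any cell in the class of `𝟙` is congruent to the one found in `w′`, hence
        -- equal to it up to sign. This is why a single `s` serves all cells.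
        by-type (inj₂ kl≡1) = matched (congruent-coordinates {v} {w′} cell-v cell′ k l i j k≢l
            (≡₂-trans kl≡1 (≡₂-sym ij≡1)))
          where
          matched : (edge v k l ≗ edge w′ i j) ⊎ (edge v k l ≗ edge w′ j i) → Short (apply A (edge v k l))
          matched (inj₁ same) = Short-cong (apply-cong A (λ p → ≡.sym (same p))) (short-oriented s oriented)
          matched (inj₂ same) = Short-cong negated (Short-neg (short-oriented s oriented))
            where
            reversed : ∀ p → edge v k l p ≡ -[1+ 0 ] ℤ.* edge w′ i j p
            reversed p = ≡.trans (same p) (≡.trans (∙-congʳ (GL.inverse basis p) (λ r → flip (w′ i r) (w′ j r)))
              (∙-scaleʳ -[1+ 0 ] (GL.inverse basis p) (w′ i -ᵥ w′ j)))
              where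
              flip : ∀ a b → b ℤ.- a ≡ -[1+ 0 ] ℤ.* (a ℤ.- b)
              flip = ℤ-Ring.solve-∀
            negated : ∀ r → ℤ.- apply A (edge w′ i j) r ≡ apply A (edge v k l) r
            negated r = ≡.sym (≡.trans (∙-congʳ (A r) reversed)
              (≡.trans (∙-scaleʳ -[1+ 0 ] (A r) (edge w′ i j)) (ℤ.-1*i≡-i (A r ∙ edge w′ i j))))
      near : ∀ {v} → Cell v → ∀ k l → Near (apply (GL.inverse (basis ∘GL chain s)) (v k))
                                            (apply (GL.inverse (basis ∘GL chain s)) (v l))
      near {v} cell-v k l = Short-cong (λ r → ≡.trans
        (≡.sym (apply-⊛ A (GL.inverse basis) (v k -ᵥ v l) r))
        (apply-- (A ⊛ GL.inverse basis) (v k) (v l) r)) (short cell-v k l (k Fin.≟ l))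
    from-diagonal : (∃ λ w′ → Cell w′ × Diagonal w′) → Goal
    from-diagonal (w′ , cell′ , i , j , i≢j , ij≡1) =
      goal cell′ i j i≢j ij≡1 (diagonal-direction cell′ i j i≢j ij≡1)
  from-cell : (∃ λ w → Cell w × (∀ f m → (∀ j → m ℤ.≤ f ∙ w j) → + 2 ℤ.* m ℤ.≤ f ∙ (λ _ → + 0))) → Goal
  from-cell (w , cell , _) = FromDiagonal.from-diagonal cell (Classification.diagonal-edge system cell)

-- Ordered fields and convex hulls

module OrderedField (ℝ : RealNumbers) where
  open RealNumbers ℝ public renaming (zero to *-zero)
  open IsTotalOrder isTotalOrder public
    using (total; antisym) renaming (refl to ≤-refl; trans to ≤-trans; reflexive to ≤-reflexive)
  open RingProperties ring public
    using (-‿distribˡ-*; -‿distribʳ-*; -‿+-comm; -‿involutive; -0#≈0#; x∙y⁻¹≈ε⇒x≈y)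
  open SemiringSum semiring public
    using (sum; sum-cong-≋; ∑-distrib-+; ∑-comm; *-distribˡ-sum; *-distribʳ-sum; sum-replicate-zero)
  open SemiringMult semiring using (×-homo-+; ×1-homo-*)
  open SetoidReasoning setoid

  private
    ι : ℤ → Carrier
    ι = fromℤ ℝ

    ι-⊖ : ∀ m n → ι (m ⊖ n) ≈ ι (+ m) - ι (+ n)
    ι-⊖ m zero = begin
      ι (+ m)        ≈⟨ +-identityʳ _ ⟨
      ι (+ m) + 0#   ≈⟨ +-congˡ -0#≈0# ⟨
      ι (+ m) - 0#   ∎
    ι-⊖ zero (suc n) = sym (+-identityˡ _)
    ι-⊖ (suc m) (suc n) = begin
      ι (suc m ⊖ suc n)                     ≡⟨ ≡.cong ι (ℤ.[1+m]⊖[1+n]≡m⊖n m n) ⟩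
      ι (m ⊖ n)                             ≈⟨ ι-⊖ m n ⟩
      ι (+ m) - ι (+ n)                     ≈⟨ +-congʳ (+-identityˡ _) ⟨
      0# + ι (+ m) - ι (+ n)                ≈⟨ +-congʳ (+-congʳ (-‿inverseʳ 1#)) ⟨
      1# - 1# + ι (+ m) - ι (+ n)           ≈⟨ +-congʳ (+-assoc _ _ _) ⟩
      1# + (- 1# + ι (+ m)) - ι (+ n)       ≈⟨ +-congʳ (+-congˡ (+-comm _ _)) ⟩
      1# + (ι (+ m) - 1#) - ι (+ n)         ≈⟨ +-congʳ (+-assoc _ _ _) ⟨
      1# + ι (+ m) - 1# - ι (+ n)           ≈⟨ +-assoc _ _ _ ⟩
      1# + ι (+ m) + (- 1# - ι (+ n))       ≈⟨ +-congˡ (-‿+-comm _ _) ⟩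
      1# + ι (+ m) - (1# + ι (+ n))         ∎

  fromℤ-+ : ∀ a b → ι (a ℤ.+ b) ≈ ι a + ι b
  fromℤ-+ (+ m)    (+ n)    = ×-homo-+ 1# m n
  fromℤ-+ (+ m)    -[1+ n ] = ι-⊖ m (suc n)
  fromℤ-+ -[1+ m ] (+ n)    = trans (ι-⊖ n (suc m)) (+-comm _ _)
  fromℤ-+ -[1+ m ] -[1+ n ] = begin
    - ι (+ suc (suc (m ℕ.+ n)))          ≡⟨ ≡.cong (λ k → - ι (+ suc k)) (≡.sym (ℕ.+-suc m n)) ⟩
    - ι (+ (suc m ℕ.+ suc n))            ≈⟨ -‿cong (×-homo-+ 1# (suc m) (suc n)) ⟩
    - (ι (+ suc m) + ι (+ suc n))        ≈⟨ -‿+-comm _ _ ⟨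
    - ι (+ suc m) - ι (+ suc n)          ∎

  fromℤ-neg : ∀ a → ι (ℤ.- a) ≈ - ι a
  fromℤ-neg (+ zero)    = sym -0#≈0#
  fromℤ-neg (+ suc n)   = refl
  fromℤ-neg -[1+ n ]    = sym (-‿involutive _)

  fromℤ-* : ∀ a b → ι (a ℤ.* b) ≈ ι a * ι b
  fromℤ-* (+ m) (+ n) = trans (reflexive (≡.cong ι (≡.sym (ℤ.pos-* m n)))) (×1-homo-* m n)
  fromℤ-* a@(-[1+ m ]) b@(+ n) = begin
    ι (a ℤ.* b)                 ≡⟨ ≡.cong ι (ℤ.neg-distribˡ-* (+ suc m) b) ⟨
    ι (ℤ.- (+ suc m ℤ.* b))     ≈⟨ fromℤ-neg (+ suc m ℤ.* b) ⟩
    - ι (+ suc m ℤ.* b)         ≈⟨ -‿cong (fromℤ-* (+ suc m) b) ⟩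
    - (ι (+ suc m) * ι b)       ≈⟨ -‿distribˡ-* _ _ ⟩
    ι a * ι b                   ∎
  fromℤ-* a@(+ m) b@(-[1+ n ]) = begin
    ι (a ℤ.* b)                 ≡⟨ ≡.cong ι (ℤ.neg-distribʳ-* a (+ suc n)) ⟨
    ι (ℤ.- (a ℤ.* + suc n))     ≈⟨ fromℤ-neg (a ℤ.* + suc n) ⟩
    - ι (a ℤ.* + suc n)         ≈⟨ -‿cong (fromℤ-* a (+ suc n)) ⟩
    - (ι a * ι (+ suc n))       ≈⟨ -‿distribʳ-* _ _ ⟩
    ι a * ι b                   ∎
  fromℤ-* a@(-[1+ m ]) b@(-[1+ n ]) = begin
    ι (+ suc m ℤ.* + suc n)         ≈⟨ fromℤ-* (+ suc m) (+ suc n) ⟩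
    ι (+ suc m) * ι (+ suc n)       ≈⟨ -‿involutive _ ⟨
    - - (ι (+ suc m) * ι (+ suc n)) ≈⟨ -‿cong (-‿distribˡ-* _ _) ⟩
    - (- ι (+ suc m) * ι (+ suc n)) ≈⟨ -‿distribʳ-* _ _ ⟩
    ι a * ι b                       ∎

  fromℤ-1 : ι (+ 1) ≈ 1#
  fromℤ-1 = +-identityʳ 1#

  private
    fromℤ-≟ : ∀ a b → Maybe (ι a ≈ ι b)
    fromℤ-≟ a b with a ℤ.≟ b
    ... | yes a≡b = just (reflexive (≡.cong ι a≡b))
    ... | no  _   = nothing

    fromℤ-homomorphism : ℤ.+-*-rawRing ACR.-Raw-AlmostCommutative⟶ ACR.fromCommutativeRing commutativeRing
    fromℤ-homomorphism = record
      { ⟦_⟧    = ι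
      ; +-homo = fromℤ-+
      ; *-homo = fromℤ-*
      ; -‿homo = fromℤ-neg
      ; 0-homo = refl
      ; 1-homo = fromℤ-1
      }

  module Solver = RingSolver ℤ.+-*-rawRing (ACR.fromCommutativeRing commutativeRing) fromℤ-homomorphism fromℤ-≟
  open Solver using (solve; con; _:=_; _:+_; _:*_; _:-_; :-_)

  fromℤ-- : ∀ a b → ι (a ℤ.- b) ≈ ι a - ι b
  fromℤ-- a b = trans (fromℤ-+ a (ℤ.- b)) (+-congˡ (fromℤ-neg b))

  ≤-respˡ : ∀ {x y z} → x ≈ y → x ≤ z → y ≤ z
  ≤-respˡ x≈y = ≤-trans (≤-reflexive (sym x≈y))

  ≤-respʳ : ∀ {x y z} → x ≈ y → z ≤ x → z ≤ y
  ≤-respʳ x≈y z≤x = ≤-trans z≤x (≤-reflexive x≈y)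

  0≤+ : ∀ {x y} → 0# ≤ x → 0# ≤ y → 0# ≤ x + y
  0≤+ {x} {y} 0≤x 0≤y = ≤-trans 0≤y (≤-respˡ (+-identityˡ y) (+-monoˡ-≤ y 0≤x))

  ≤⇒0≤- : ∀ {x y} → x ≤ y → 0# ≤ y - x
  ≤⇒0≤- {x} x≤y = ≤-respˡ (-‿inverseʳ x) (+-monoˡ-≤ (- x) x≤y)

  0≤-⇒≤ : ∀ {x y} → 0# ≤ y - x → x ≤ y
  0≤-⇒≤ {x} {y} 0≤y-x = ≤-respˡ (+-identityˡ x)
    (≤-respʳ (solve 2 (λ a b → b :- a :+ a := b) refl x y) (+-monoˡ-≤ x 0≤y-x))

  0≤1 : 0# ≤ 1#
  0≤1 with total 0# 1#
  ... | inj₁ 0≤1  = 0≤1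
  ... | inj₂ 1≤0 = ≤-respʳ -1*-1≈1 (*-nonNeg 0≤-1 0≤-1)
    where
    0≤-1 : 0# ≤ - 1#
    0≤-1 = ≤-respʳ (+-identityˡ _) (≤⇒0≤- 1≤0)
    -1*-1≈1 : - 1# * - 1# ≈ 1#
    -1*-1≈1 = trans (solve 1 (λ x → :- x :* :- x := x :* x) refl 1#) (*-identityˡ 1#)

  0≤fromℕ : ∀ n → 0# ≤ ι (+ n)
  0≤fromℕ zero    = ≤-refl
  0≤fromℕ (suc n) = 0≤+ 0≤1 (0≤fromℕ n)

  fromℤ-mono : ∀ {a b} → a ℤ.≤ b → ι a ≤ ι b
  fromℤ-mono {a} {b} a≤b = 0≤-⇒≤ (≤-respʳ (fromℤ-- b a) (nonNeg (b ℤ.- a) (ℤ.i≤j⇒0≤j-i a≤b)))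
    where
    nonNeg : ∀ c → + 0 ℤ.≤ c → 0# ≤ ι c
    nonNeg (+ n) _ = 0≤fromℕ n

  private
    suc≉0 : ∀ n → ¬ (ι (+ suc n) ≈ 0#)
    suc≉0 n 1+n≈0 = 0≉1 (antisym 0≤1
      (≤-respʳ 1+n≈0 (≤-respˡ (+-identityʳ 1#) (≤-respˡ (+-comm 0# 1#)
        (≤-respʳ (+-comm (ι (+ n)) 1#) (+-monoˡ-≤ 1# (0≤fromℕ n)))))))

  fromℤ≈0⇒≡0 : ∀ a → ι a ≈ 0# → a ≡ + 0
  fromℤ≈0⇒≡0 (+ zero)  _   = ≡.refl
  fromℤ≈0⇒≡0 (+ suc n) a≈0 = ⊥-elim (suc≉0 n a≈0)
  fromℤ≈0⇒≡0 -[1+ n ]  a≈0 = ⊥-elim (suc≉0 n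
    (trans (sym (-‿involutive _)) (trans (-‿cong a≈0) -0#≈0#)))

  fromℤ-injective : ∀ {a b} → ι a ≈ ι b → a ≡ b
  fromℤ-injective {a} {b} a≈b = ℤ.i-j≡0⇒i≡j a b (fromℤ≈0⇒≡0 (a ℤ.- b)
    (trans (fromℤ-- a b) (trans (+-congʳ a≈b) (-‿inverseʳ _))))

  fromℤ-cancel-≤ : ∀ {a b} → ι a ≤ ι b → a ℤ.≤ b
  fromℤ-cancel-≤ {a} {b} a≤b with ℤ.≤-total a b
  ... | inj₁ a≤b′ = a≤b′
  ... | inj₂ b≤a  = ℤ.≤-reflexive (fromℤ-injective (antisym a≤b (fromℤ-mono b≤a)))

  *-cancelˡ-0 : ∀ {x y} → ¬ (x ≈ 0#) → x * y ≈ 0# → y ≈ 0#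
  *-cancelˡ-0 {x} {y} x≉0 xy≈0 with inverse x x≉0
  ... | z , xz≈1 = begin
    y             ≈⟨ *-identityˡ y ⟨
    1# * y        ≈⟨ *-congʳ xz≈1 ⟨
    x * z * y     ≈⟨ solve 3 (λ x y z → x :* z :* y := z :* (x :* y)) refl x y z ⟩
    z * (x * y)   ≈⟨ *-congˡ xy≈0 ⟩
    z * 0#        ≈⟨ zeroʳ z ⟩
    0#            ∎

  +≈0⇒≈0 : ∀ {x y} → 0# ≤ x → 0# ≤ y → x + y ≈ 0# → x ≈ 0#
  +≈0⇒≈0 {x} {y} 0≤x 0≤y x+y≈0 =
    antisym (≤-respˡ (+-identityˡ x) (≤-respʳ (trans (+-comm y x) x+y≈0) (+-monoˡ-≤ x 0≤y))) 0≤x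

  0≤sum : ∀ {n} {c : Vector Carrier n} → (∀ i → 0# ≤ c i) → 0# ≤ sum c
  0≤sum {zero}  0≤c = ≤-refl
  0≤sum {suc n} 0≤c = 0≤+ (0≤c zero) (0≤sum (0≤c ∘ suc))

  sum≈0⇒≈0 : ∀ {n} {c : Vector Carrier n} → (∀ i → 0# ≤ c i) → sum c ≈ 0# → ∀ i → c i ≈ 0#
  sum≈0⇒≈0 0≤c ∑c≈0 zero    = +≈0⇒≈0 (0≤c zero) (0≤sum (0≤c ∘ suc)) ∑c≈0
  sum≈0⇒≈0 0≤c ∑c≈0 (suc i) = sum≈0⇒≈0 (0≤c ∘ suc)
    (+≈0⇒≈0 (0≤sum (0≤c ∘ suc)) (0≤c zero) (trans (+-comm _ _) ∑c≈0)) i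

  sum-zero : ∀ {n} {c : Vector Carrier n} → (∀ i → c i ≈ 0#) → sum c ≈ 0#
  sum-zero {n} c≈0 = trans (sum-cong-≋ c≈0) (sum-replicate-zero n)

  sum-neg : ∀ {n} (c : Vector Carrier n) → sum (λ i → - c i) ≈ - sum c
  sum-neg {zero}  c = sym -0#≈0#
  sum-neg {suc n} c = trans (+-congˡ (sum-neg (c ∘ suc))) (-‿+-comm _ _)

  sum-- : ∀ {n} (c d : Vector Carrier n) → sum (λ i → c i - d i) ≈ sum c - sum d
  sum-- c d = trans (∑-distrib-+ c _) (+-congˡ (sum-neg d))

  reciprocal : ∀ n → ∃ λ y → ι (+ suc n) * y ≈ 1# × 0# ≤ y × ¬ (y ≈ 0#)
  reciprocal n with inverse (ι (+ suc n)) (suc≉0 n)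
  ... | y , Ny≈1 = y , Ny≈1 , 0≤y , λ y≈0 → 0≉1 (trans (sym (zeroʳ _)) (trans (*-congˡ (sym y≈0)) Ny≈1))
    where
    0≤y : 0# ≤ y
    0≤y with total 0# y
    ... | inj₁ 0≤y = 0≤y
    ... | inj₂ y≤0 = ⊥-elim (0≉1 (antisym 0≤1 (≤-respˡ Ny≈1 (0≤-⇒≤ (≤-respʳ
      (solve 2 (λ N y → N :* (con (+ 0) :- y) := con (+ 0) :- N :* y) refl (ι (+ suc n)) y)
      (*-nonNeg (0≤fromℕ (suc n)) (≤⇒0≤- y≤0)))))))

-- Integer parts and sorting

module Floor (em : ExcludedMiddle 0ℓ) (ℝ : RealNumbers) where
  open OrderedField ℝ
  open Solver using (solve; con; _:=_; _:+_; _:-_; :-_)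

  private
    ι : ℤ → Carrier
    ι = fromℤ ℝ

  -- If `x` bounded all natural numbers, they would have a supremum `s`; but with `n + 1 ≤ s` for
  -- all `n`, also `s - 1` is an upper bound.
  archimedean : ∀ x → ∃ λ n → x ≤ ι (+ n)
  archimedean x with em {∃ λ n → x ≤ ι (+ n)}
  ... | yes bounded   = bounded
  ... | no  unbounded = ⊥-elim (0≉1 (antisym 0≤1 1≤0))
    where
    x-bound : ∀ n → ι (+ n) ≤ x
    x-bound n with total x (ι (+ n))
    ... | inj₁ x≤n = ⊥-elim (unbounded (n , x≤n))
    ... | inj₂ n≤x = n≤x
    sup = supremum (λ y → ∃ λ n → y ≈ ι (+ n)) (0# , 0 , refl)
      (x , λ (n , y≈n) → ≤-respˡ (sym y≈n) (x-bound n))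
    s = proj₁ sup
    s≤s-1 : s ≤ s - 1#
    s≤s-1 = proj₂ (proj₂ sup) λ (n , y≈n) → ≤-respˡ (sym y≈n)
      (≤-respˡ (solve 2 (λ a b → a :+ b :- a := b) refl 1# (ι (+ n)))
        (+-monoˡ-≤ (- 1#) (proj₁ (proj₂ sup) (suc n , refl))))
    1≤0 : 1# ≤ 0#
    1≤0 = 0≤-⇒≤ (≤-respʳ (solve 2 (λ a b → a :- b :- a := con (+ 0) :- b) refl s 1#) (≤⇒0≤- s≤s-1))

  private
    search : ∀ x k z → ι z ≤ x → x ≤ ι (z ℤ.+ + k) → ∃ λ m → ι m ≤ x × x ≤ ι m + 1#
    search x zero z z≤x x≤z+0 = z , z≤x ,
      ≤-trans x≤z+0 (≤-respˡ (reflexive (≡.cong ι (≡.sym (ℤ.+-identityʳ z)))) z≤z+1)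
      where
      z≤z+1 : ι z ≤ ι z + 1#
      z≤z+1 = 0≤-⇒≤ (≤-respʳ (solve 2 (λ a b → b := a :+ b :- a) refl (ι z) 1#) 0≤1)
    search x (suc k) z z≤x x≤z+k with total x (ι z + 1#)
    ... | inj₁ x≤z+1 = z , z≤x , x≤z+1
    ... | inj₂ z+1≤x = search x k (z ℤ.+ + 1)
      (≤-respˡ (sym (trans (fromℤ-+ z (+ 1)) (+-congˡ fromℤ-1))) z+1≤x)
      (≤-respʳ (reflexive (≡.cong ι (≡.sym (ℤ.+-assoc z (+ 1) (+ k))))) x≤z+k)

  abstract
    -- Both inequalities are weak, as comparison by `total` yields them; at an integer either
    -- neighbouring interval may result. This suffices because simplices are closed.
    floor : ∀ x → ∃ λ m → ι m ≤ x × x ≤ ι m + 1#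
    floor x with archimedean x | archimedean (- x)
    ... | N , x≤N | M , -x≤M = search x (M ℕ.+ N) (ℤ.- + M)
      (≤-respˡ (sym (fromℤ-neg (+ M)))
        (0≤-⇒≤ (≤-respʳ (solve 2 (λ a b → a :- :- b := b :- :- a) refl (ι (+ M)) x) (≤⇒0≤- -x≤M))))
      (≤-respʳ (reflexive (≡.cong ι -M+[M+N])) x≤N)
      where
      -M+[M+N] : + N ≡ ℤ.- + M ℤ.+ + (M ℕ.+ N)
      -M+[M+N] = ≡.trans (cancel (+ M) (+ N)) (≡.cong (λ k → ℤ.- + M ℤ.+ k) (≡.sym (ℤ.pos-+ M N)))
        where
        cancel : ∀ a b → b ≡ ℤ.- a ℤ.+ (a ℤ.+ b)
        cancel = ℤ-Ring.solve-∀

  Decreasing : Vector Carrier 3 → Permutation′ 3 → Set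
  Decreasing y π = y (π ⟨$⟩ʳ 1F) ≤ y (π ⟨$⟩ʳ 0F) × y (π ⟨$⟩ʳ 2F) ≤ y (π ⟨$⟩ʳ 1F)

  abstract
    sort : ∀ y → ∃ (Decreasing y)
    sort y with total (y 1F) (y 0F) | total (y 2F) (y 1F) | total (y 2F) (y 0F)
    ... | inj₁ 1≤0 | inj₁ 2≤1 | _        = Perm.id , 1≤0 , 2≤1
    ... | inj₁ _   | inj₂ 1≤2 | inj₁ 2≤0 = Perm.transpose 1F 2F , 2≤0 , 1≤2
    ... | inj₁ 1≤0 | inj₂ _   | inj₂ 0≤2 = Perm.transpose 0F 2F ∘ₚ Perm.transpose 0F 1F , 0≤2 , 1≤0
    ... | inj₂ _   | inj₁ 2≤1 | inj₂ 0≤2 = Perm.transpose 0F 1F ∘ₚ Perm.transpose 0F 2F , 2≤1 , 0≤2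
    ... | inj₂ 0≤1 | inj₁ _   | inj₁ 2≤0 = Perm.transpose 0F 1F , 0≤1 , 2≤0
    ... | inj₂ 0≤1 | inj₂ 1≤2 | _        = Perm.transpose 0F 2F , 1≤2 , 0≤1

-- Convex combinations and simplices

module Convexity (em : ExcludedMiddle 0ℓ) (ℝ : RealNumbers) where
  open OrderedField ℝ
  open SetoidReasoning setoid
  open Simplex

  ι : ℤ → Carrier
  ι = fromℤ ℝ

  infix 4 _≃_
  _≃_ : ∀ {n} → Point ℝ n → Point ℝ n → Set
  x ≃ y = ∀ k → x k ≈ y k

  ι-sum : ∀ {n} (z : Vector ℤ n) → ι (ℤΣ.sum z) ≈ sum (ι ∘ z)
  ι-sum {zero}  z = refl
  ι-sum {suc n} z = trans (fromℤ-+ (z zero) _) (+-congˡ (ι-sum (z ∘ suc)))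

  comb : ∀ {m n} → Vector Carrier m → Vector (Point ℝ n) m → Point ℝ n
  comb = combination ℝ

  comb-cong : ∀ {m n} {c d : Vector Carrier m} {p q : Vector (Point ℝ n) m} →
              (∀ i → c i ≈ d i) → (∀ i → p i ≃ q i) → comb c p ≃ comb d q
  comb-cong c≈d p≃q k = sum-cong-≋ (λ i → *-cong (c≈d i) (p≃q i k))

  comb-- : ∀ {m n} (c d : Vector Carrier m) (p : Vector (Point ℝ n) m) k →
           comb (λ i → c i - d i) p k ≈ comb c p k - comb d p k
  comb-- c d p k = trans
    (sum-cong-≋ (λ i → trans (distribʳ (p i k) (c i) (- d i)) (+-congˡ (sym (-‿distribˡ-* _ _)))))
    (sum-- (λ i → c i * p i k) (λ i → d i * p i k))

  barycentric-unique : ∀ {n} (σ : Simplex ℝ n) c d → sum c ≈ sum d →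
                       comb c (vertex σ) ≃ comb d (vertex σ) → ∀ i → c i ≈ d i
  barycentric-unique σ c d ∑c≈∑d cv≃dv i = x∙y⁻¹≈ε⇒x≈y _ _
    (independent σ (λ i → c i - d i)
      (trans (sum-- c d) (trans (+-congʳ ∑c≈∑d) (-‿inverseʳ _)))
      (λ k → trans (comb-- c d (vertex σ) k) (trans (+-congʳ (cv≃dv k)) (-‿inverseʳ _))) i)

  δ : ∀ {m} → Fin m → Vector Carrier m
  δ i j = if does (i Fin.≟ j) then 1# else 0#

  sum-δ : ∀ {m} (i : Fin m) (f : Vector Carrier m) → sum (λ j → δ i j * f j) ≈ f i
  sum-δ zero    f = trans (+-cong (*-identityˡ _) (sum-zero {c = λ j → 0# * f (suc j)} (λ j → zeroˡ _))) (+-identityʳ _)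
  sum-δ (suc i) f = trans (+-cong (zeroˡ _) (sum-δ i (f ∘ suc))) (+-identityˡ _)

  ∑δ≈1 : ∀ {m} (i : Fin m) → sum (δ i) ≈ 1#
  ∑δ≈1 i = trans (sum-cong-≋ (λ j → sym (*-identityʳ (δ i j)))) (sum-δ i (λ _ → 1#))

  0≤δ : ∀ {m} (i j : Fin m) → 0# ≤ δ i j
  0≤δ i j with does (i Fin.≟ j)
  ... | true  = 0≤1
  ... | false = ≤-refl

  δ-≢ : ∀ {m} (i j : Fin m) → ¬ i ≡ j → δ i j ≈ 0#
  δ-≢ i j i≢j with i Fin.≟ j
  ... | yes i≡j = ⊥-elim (i≢j i≡j)
  ... | no  _   = refl

  Hull : ∀ {m n} → Vector (Point ℝ n) m → Point ℝ n → Set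
  Hull p x = ∃ λ c → (∀ i → 0# ≤ c i) × sum c ≈ 1# × comb c p ≃ x

  body⇒Hull : ∀ {n} (σ : Simplex ℝ n) {x} → x ∈ body ℝ σ → Hull (vertex σ) x
  body⇒Hull σ (c , 0≤c , _ , ∑c , cv≃x) = c , 0≤c , ∑c , cv≃x

  Hull⇒body : ∀ {n} (σ : Simplex ℝ n) {x} → Hull (vertex σ) x → x ∈ body ℝ σ
  Hull⇒body σ (c , 0≤c , ∑c , cv≃x) = c , 0≤c , (λ i i∉⊤ → ⊥-elim (i∉⊤ ∈⊤)) , ∑c , cv≃x

  vertex∈face : ∀ {n} (σ : Simplex ℝ n) S i → i ∈ₛ S → vertex σ i ∈ face ℝ σ S
  vertex∈face σ S i i∈S = δ i , 0≤δ i , (λ j j∉S → δ-≢ i j (λ i≡j → j∉S (≡.subst (_∈ₛ S) i≡j i∈S))) ,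
    ∑δ≈1 i , λ k → sum-δ i (λ j → vertex σ j k)

  -- Substituting the hull representations of the points q k into a combination of the q k;
  -- points of weight zero need no representation.
  module Substitution {l m n} (p : Vector (Point ℝ n) m) (q : Vector (Point ℝ n) l)
                      (e : Vector Carrier l) (h : ∀ k → e k ≈ 0# ⊎ Hull p (q k)) where

    part : Fin l → Vector Carrier m
    part k with h k
    -- The default 0 keeps `part` nonnegative and does not affect `weight`, where it is multiplied
    -- by a vanishing `e k`.
    ... | inj₁ _       = λ _ → 0#
    ... | inj₂ (f , _) = f

    weight : Vector Carrier m
    weight i = sum (λ k → e k * part k i)

    0≤part : ∀ k i → 0# ≤ part k i
    0≤part k with h k
    ... | inj₁ _             = λ _ → ≤-refl
    ... | inj₂ (_ , 0≤f , _) = 0≤f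

    ∑part : ∀ k → e k * sum (part k) ≈ e k
    ∑part k with h k
    ... | inj₁ e≈0              = trans (trans (*-congʳ e≈0) (zeroˡ _)) (sym e≈0)
    ... | inj₂ (_ , _ , ∑f , _) = trans (*-congˡ ∑f) (*-identityʳ _)

    comb-part : ∀ k j → e k * comb (part k) p j ≈ e k * q k j
    comb-part k j with h k
    ... | inj₁ e≈0             = trans (trans (*-congʳ e≈0) (zeroˡ _)) (sym (trans (*-congʳ e≈0) (zeroˡ _)))
    ... | inj₂ (_ , _ , _ , f) = *-congˡ (f j)

    ∑weight : sum weight ≈ sum e
    ∑weight = begin
      sum (λ i → sum (λ k → e k * part k i)) ≈⟨ ∑-comm (λ i k → e k * part k i) ⟩
      sum (λ k → sum (λ i → e k * part k i)) ≈⟨ sum-cong-≋ (λ k → sym (*-distribˡ-sum (e k) (part k))) ⟩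
      sum (λ k → e k * sum (part k))         ≈⟨ sum-cong-≋ ∑part ⟩
      sum e                                  ∎

    comb-weight : comb weight p ≃ comb e q
    comb-weight j = begin
      sum (λ i → sum (λ k → e k * part k i) * p i j)
        ≈⟨ sum-cong-≋ (λ i → *-distribʳ-sum (p i j) (λ k → e k * part k i)) ⟩
      sum (λ i → sum (λ k → e k * part k i * p i j))
        ≈⟨ ∑-comm (λ i k → e k * part k i * p i j) ⟩
      sum (λ k → sum (λ i → e k * part k i * p i j))
        ≈⟨ sum-cong-≋ (λ k → trans (sum-cong-≋ (λ i → *-assoc (e k) (part k i) (p i j)))
             (sym (*-distribˡ-sum (e k) (λ i → part k i * p i j)))) ⟩
      sum (λ k → e k * comb (part k) p j)
        ≈⟨ sum-cong-≋ (λ k → comb-part k j) ⟩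
      sum (λ k → e k * q k j) ∎

    module _ (0≤e : ∀ k → 0# ≤ e k) where

      0≤weight : ∀ i → 0# ≤ weight i
      0≤weight i = 0≤sum (λ k → *-nonNeg (0≤e k) (0≤part k i))

      weight≈0 : ∀ {i k} → weight i ≈ 0# → ¬ (e k ≈ 0#) → part k i ≈ 0#
      weight≈0 {i} {k} w≈0 e≉0 = *-cancelˡ-0 e≉0
        (sum≈0⇒≈0 (λ k → *-nonNeg (0≤e k) (0≤part k i)) w≈0 k)

    part-Hull : ∀ k → ¬ (e k ≈ 0#) → sum (part k) ≈ 1# × comb (part k) p ≃ q k
    part-Hull k e≉0 with h k
    ... | inj₁ e≈0              = ⊥-elim (e≉0 e≈0)
    ... | inj₂ (_ , _ , ∑f , f) = ∑f , f

  or-zero : ∀ {A : Set} x → (¬ (x ≈ 0#) → A) → x ≈ 0# ⊎ A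
  or-zero x f with em {x ≈ 0#}
  ... | yes x≈0 = inj₁ x≈0
  ... | no  x≉0 = inj₂ (f x≉0)

  nonzero-term : ∀ {n} (c : Vector Carrier n) → ¬ (sum c ≈ 0#) → ∃ λ i → ¬ (c i ≈ 0#)
  nonzero-term c ∑c≉0 with em {∃ λ i → ¬ (c i ≈ 0#)}
  ... | yes found = found
  ... | no  none  = ⊥-elim (∑c≉0 (sum-zero allZero))
    where
    allZero : ∀ i → c i ≈ 0#
    allZero i with em {c i ≈ 0#}
    ... | yes ci≈0 = ci≈0
    ... | no  ci≉0 = ⊥-elim (none (i , ci≉0))

  comb-act : ∀ {m n} (g : GL n) (c : Vector Carrier m) p → comb c (act ℝ g ∘ p) ≃ act ℝ g (comb c p)
  comb-act g c p i = begin
    sum (λ a → c a * sum (λ j → G j * p a j))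
      ≈⟨ sum-cong-≋ (λ a → *-distribˡ-sum (c a) (λ j → G j * p a j)) ⟩
    sum (λ a → sum (λ j → c a * (G j * p a j)))
      ≈⟨ ∑-comm (λ a j → c a * (G j * p a j)) ⟩
    sum (λ j → sum (λ a → c a * (G j * p a j)))
      ≈⟨ sum-cong-≋ (λ j → trans (sum-cong-≋ (λ a → swap (c a) (G j) (p a j)))
           (sym (*-distribˡ-sum (G j) (λ a → c a * p a j)))) ⟩
    sum (λ j → G j * comb c p j) ∎
    where
    G = λ j → ι (GL.matrix g i j)
    swap : ∀ x y z → x * (y * z) ≈ y * (x * z)
    swap x y z = trans (sym (*-assoc x y z)) (trans (*-congʳ (*-comm x y)) (*-assoc y x z))

  comb-translate : ∀ {m n} v (c : Vector Carrier m) (p : Vector (Point ℝ n) m) k →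
                   comb c (translate ℝ v ∘ p) k ≈ comb c p k + sum c * ι (v k)
  comb-translate v c p k = begin
    sum (λ i → c i * (p i k + ι (v k)))            ≈⟨ sum-cong-≋ (λ i → distribˡ (c i) _ _) ⟩
    sum (λ i → c i * p i k + c i * ι (v k))        ≈⟨ ∑-distrib-+ (λ i → c i * p i k) _ ⟩
    comb c p k + sum (λ i → c i * ι (v k))         ≈⟨ +-congˡ (*-distribʳ-sum (ι (v k)) c) ⟨
    comb c p k + sum c * ι (v k)                   ∎

  translateSimplex : ∀ {n} → Vector ℤ n → Simplex ℝ n → Simplex ℝ n
  translateSimplex v σ .vertex        = translate ℝ v ∘ vertex σ
  translateSimplex v σ .independent c ∑c≈0 cp≃0 = independent σ c ∑c≈0 λ k → begin
    comb c (vertex σ) k                        ≈⟨ +-identityʳ _ ⟨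
    comb c (vertex σ) k + 0#                   ≈⟨ +-congˡ (trans (*-congʳ ∑c≈0) (zeroˡ _)) ⟨
    comb c (vertex σ) k + sum c * ι (v k)      ≈⟨ comb-translate v c (vertex σ) k ⟨
    comb c (translate ℝ v ∘ vertex σ) k        ≈⟨ cp≃0 k ⟩
    0#                                         ∎

-- From periodic triangulations to cell systems

module Cells (em : ExcludedMiddle 0ℓ) (ℝ : RealNumbers) {n : ℕ} {T : Collection ℝ n}
             (triangulation : IsPeriodicTriangulation ℝ n T) where
  open OrderedField ℝ
  open SetoidReasoning setoid
  open Convexity em ℝ
  open IsPeriodicTriangulation triangulation
  open Simplex

  -- The point lies in the common face, whose vertices are indexed by `S`. Barycentric coordinates
  -- being unique, those in `σ` vanish outside `S`, and the vertices with index in `S` belong to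
  -- both simplices.
  support⊆body : ∀ {σ τ} → σ ∈ T → τ ∈ T → ∀ {c} → (∀ i → 0# ≤ c i) → sum c ≈ 1# →
                 comb c (vertex σ) ∈ body ℝ τ → ∀ i → ¬ (c i ≈ 0#) → vertex σ i ∈ body ℝ τ
  support⊆body {σ} {τ} σ∈T τ∈T {c} 0≤c ∑c≈1 x∈τ i ci≉0 with proj₁ (intersection {σ} {τ} σ∈T τ∈T)
  ... | S , σ∩τ⊆S , S⊆σ∩τ with σ∩τ⊆S (Hull⇒body σ (c , 0≤c , ∑c≈1 , λ k → refl) , x∈τ) | i ∈? S
  ... | _ | yes i∈S = proj₂ (S⊆σ∩τ (vertex∈face σ S i i∈S))
  ... | d , _ , d-supp , ∑d≈1 , dv≃x | no i∉S = ⊥-elim (ci≉0 (trans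
    (barycentric-unique σ c d (trans ∑c≈1 (sym ∑d≈1)) (λ k → sym (dv≃x k)) i)
    (d-supp i i∉S)))

  -- A vertex of `τ` is an extreme point of it. The vertices of `σ` with nonzero weight lie in `τ`,
  -- and substituting their barycentric coordinates must give `δ j`; as nothing cancels, each of
  -- them is concentrated at `j`.
  body-vertex : ∀ {σ τ} → σ ∈ T → τ ∈ T → ∀ {e j} → (∀ i → 0# ≤ e i) → sum e ≈ 1# →
                comb e (vertex σ) ≃ vertex τ j → ∀ i → ¬ (e i ≈ 0#) → vertex σ i ≃ vertex τ j
  body-vertex {σ} {τ} σ∈T τ∈T {e} {j} 0≤e ∑e≈1 ev≃τj i ei≉0 k = begin
    vertex σ i k                                ≈⟨ proj₂ (part-Hull i ei≉0) k ⟨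
    comb (part i) (vertex τ) k                  ≈⟨ comb-cong {c = part i} {p = vertex τ} part≈δ (λ _ _ → refl) k ⟩
    comb (δ j) (vertex τ) k                     ≈⟨ sum-δ j (λ a → vertex τ a k) ⟩
    vertex τ j k                                ∎
    where
    τj∈τ : comb e (vertex σ) ∈ body ℝ τ
    τj∈τ = Hull⇒body τ (δ j , 0≤δ j , ∑δ≈1 j ,
      λ k → trans (sum-δ j (λ a → vertex τ a k)) (sym (ev≃τj k)))
    open Substitution (vertex τ) (vertex σ) e
      (λ a → or-zero (e a) (body⇒Hull τ ∘ support⊆body σ∈T τ∈T 0≤e ∑e≈1 τj∈τ a))
    weight≈δ : ∀ a → weight a ≈ δ j a
    weight≈δ = barycentric-unique τ weight (δ j) (trans ∑weight (trans ∑e≈1 (sym (∑δ≈1 j))))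
      (λ k → trans (comb-weight k) (trans (ev≃τj k) (sym (sum-δ j (λ a → vertex τ a k)))))
    part≈0 : ∀ a → ¬ j ≡ a → part i a ≈ 0#
    part≈0 a j≢a = weight≈0 0≤e (trans (weight≈δ a) (δ-≢ j a j≢a)) ei≉0
    partδ : ∀ a → part i a ≈ part i j * δ j a
    partδ a with j Fin.≟ a
    ... | yes ≡.refl = sym (*-identityʳ _)
    ... | no  j≢a    = trans (part≈0 a j≢a) (sym (zeroʳ _))
    partj≈1 : part i j ≈ 1#
    partj≈1 = begin
      part i j                          ≈⟨ *-identityʳ _ ⟨
      part i j * 1#                     ≈⟨ *-congˡ (∑δ≈1 j) ⟨
      part i j * sum (δ j)              ≈⟨ *-distribˡ-sum (part i j) (δ j) ⟩
      sum (λ a → part i j * δ j a)      ≈⟨ sum-cong-≋ partδ ⟨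
      sum (part i)                      ≈⟨ proj₁ (part-Hull i ei≉0) ⟩
      1#                                ∎
    part≈δ : ∀ a → part i a ≈ δ j a
    part≈δ a = trans (partδ a) (trans (*-congʳ partj≈1) (*-identityˡ _))

  -- The vertices of `τ` with nonzero weight lie in `σ`, and by uniqueness `c i` is the average of
  -- their weights at `vertex σ i`. So one of them involves `vertex σ i`, and `body-vertex` makes
  -- the two equal.
  common-support : ∀ {σ τ} → σ ∈ T → τ ∈ T → ∀ {c d} →
                   (∀ i → 0# ≤ c i) → sum c ≈ 1# → (∀ j → 0# ≤ d j) → sum d ≈ 1# →
                   comb c (vertex σ) ≃ comb d (vertex τ) →
                   ∀ i → ¬ (c i ≈ 0#) → ∃ λ j → ¬ (d j ≈ 0#) × vertex σ i ≃ vertex τ j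
  common-support {σ} {τ} σ∈T τ∈T {c} {d} 0≤c ∑c≈1 0≤d ∑d≈1 cv≃dv i ci≉0 =
    j , dj≉0 , body-vertex σ∈T τ∈T (0≤part j) (proj₁ (part-Hull j dj≉0)) (proj₂ (part-Hull j dj≉0))
      i (λ p≈0 → dp≉0 (trans (*-congˡ p≈0) (zeroʳ _)))
    where
    x∈σ : comb d (vertex τ) ∈ body ℝ σ
    x∈σ = Hull⇒body σ (c , 0≤c , ∑c≈1 , cv≃dv)
    open Substitution (vertex σ) (vertex τ) d
      (λ a → or-zero (d a) (body⇒Hull σ ∘ support⊆body τ∈T σ∈T 0≤d ∑d≈1 x∈σ a))
    c≈weight : c i ≈ weight i
    c≈weight = barycentric-unique σ c weight (trans ∑c≈1 (sym (trans ∑weight ∑d≈1)))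
      (λ k → trans (cv≃dv k) (sym (comb-weight k))) i
    term : ∃ λ a → ¬ (d a * part a i ≈ 0#)
    term = nonzero-term _ (λ w≈0 → ci≉0 (trans c≈weight w≈0))
    j = proj₁ term
    dp≉0 = proj₂ term
    dj≉0 : ¬ (d j ≈ 0#)
    dj≉0 d≈0 = dp≉0 (trans (*-congʳ d≈0) (zeroˡ _))

  Cell : Vector (Vector ℤ n) (suc n) → Set
  Cell w = ∃ λ σ → σ ∈ T × (∀ i → vertex σ i ≃ lattice ℝ (w i))

  cell : ∀ {σ} → σ ∈ T → ∃ λ w → ∀ i → vertex σ i ≃ lattice ℝ (w i)
  cell {σ} σ∈T = (λ i → proj₁ (integral i)) , (λ i → proj₂ (integral i))
    where
    integral : ∀ i → ∃ λ z → vertex σ i ≃ lattice ℝ z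
    integral i = proj₁ vertices (σ , σ∈T , i , λ k → refl)

  ι-· : ∀ {m} (s : Vector ℤ m) (w : Vector (Vector ℤ n) m) k →
        ι ((s · w) k) ≈ comb (ι ∘ s) (λ i → lattice ℝ (w i)) k
  ι-· s w k = trans (ι-sum (λ i → s i ℤ.* w i k)) (sum-cong-≋ (λ i → fromℤ-* (s i) (w i k)))

  Cell-translate : ∀ {w} v → Cell w → Cell (λ i k → w i k ℤ.+ v k)
  Cell-translate {w} v (σ , σ∈T , σ≃w) = translateSimplex v σ ,
    proj₁ (periodic v) (σ , σ∈T , (λ x → x) , (λ x → x)) ,
    λ i k → trans (+-congʳ (σ≃w i k)) (sym (fromℤ-+ (w i k) (v k)))

  Cell-independent : ∀ {w} → Cell w → ∀ (s : Vector ℤ (suc n)) → ℤΣ.sum s ≡ + 0 →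
                     (∀ k → (s · w) k ≡ + 0) → ∀ i → s i ≡ + 0
  Cell-independent {w} (σ , _ , σ≃w) s ∑s≡0 sw≡0 i = fromℤ≈0⇒≡0 (s i)
    (independent σ (ι ∘ s) (trans (sym (ι-sum s)) (reflexive (≡.cong ι ∑s≡0)))
      (λ k → trans (comb-cong {c = ι ∘ s} (λ _ → refl) σ≃w k)
        (trans (sym (ι-· s w k)) (reflexive (≡.cong ι (sw≡0 k))))) i)

  Cell-support : ∀ {w w′} → Cell w → Cell w′ → ∀ {s s′ : Vector ℤ (suc n)} {N} →
                 (∀ i → + 0 ℤ.≤ s i) → (∀ i → + 0 ℤ.≤ s′ i) →
                 ℤΣ.sum s ≡ + suc N → ℤΣ.sum s′ ≡ + suc N → (∀ k → (s · w) k ≡ (s′ · w′) k) →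
                 ∀ i → ¬ s i ≡ + 0 → ∃ λ j → ¬ s′ j ≡ + 0 × w i ≗ w′ j
  Cell-support {w} {w′} (σ , σ∈T , σ≃w) (τ , τ∈T , τ≃w′) {s} {s′} {N} 0≤s 0≤s′ ∑s ∑s′ sw≡s′w′ i si≢0 =
    j , s′j≢0 , λ k → fromℤ-injective (trans (sym (σ≃w i k)) (trans (σi≃τj k) (τ≃w′ j k)))
    where
    y = proj₁ (reciprocal N)
    scaled : Vector ℤ (suc n) → Vector Carrier (suc n)
    scaled s i = y * ι (s i)
    0≤scaled : ∀ s → (∀ i → + 0 ℤ.≤ s i) → ∀ i → 0# ≤ scaled s i
    0≤scaled s 0≤s i = *-nonNeg (proj₁ (proj₂ (proj₂ (reciprocal N)))) (fromℤ-mono (0≤s i))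
    ∑scaled : ∀ s → ℤΣ.sum s ≡ + suc N → sum (scaled s) ≈ 1#
    ∑scaled s ∑s = begin
      sum (scaled s)       ≈⟨ *-distribˡ-sum y (λ i → ι (s i)) ⟨
      y * sum (ι ∘ s)      ≈⟨ *-congˡ (ι-sum s) ⟨
      y * ι (ℤΣ.sum s)     ≈⟨ *-congˡ (reflexive (≡.cong ι ∑s)) ⟩
      y * ι (+ suc N)      ≈⟨ *-comm _ _ ⟩
      ι (+ suc N) * y      ≈⟨ proj₁ (proj₂ (reciprocal N)) ⟩
      1#                   ∎
    comb-scaled : ∀ s w (p : Vector (Point ℝ n) (suc n)) → (∀ i → p i ≃ lattice ℝ (w i)) →
                  ∀ k → comb (scaled s) p k ≈ y * ι ((s · w) k)
    comb-scaled s w p p≃w k = begin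
      sum (λ i → y * ι (s i) * p i k)
        ≈⟨ sum-cong-≋ (λ i → trans (*-assoc y (ι (s i)) (p i k)) (*-congˡ (*-congˡ (p≃w i k)))) ⟩
      sum (λ i → y * (ι (s i) * ι (w i k)))
        ≈⟨ *-distribˡ-sum y (λ i → ι (s i) * ι (w i k)) ⟨
      y * comb (ι ∘ s) (λ i → lattice ℝ (w i)) k
        ≈⟨ *-congˡ (ι-· s w k) ⟨
      y * ι ((s · w) k) ∎
    common : ∃ λ j → ¬ (scaled s′ j ≈ 0#) × vertex σ i ≃ vertex τ j
    common = common-support σ∈T τ∈T {scaled s} {scaled s′} (0≤scaled s 0≤s) (∑scaled s ∑s)
      (0≤scaled s′ 0≤s′) (∑scaled s′ ∑s′)
      (λ k → trans (comb-scaled s w (vertex σ) σ≃w k)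
        (trans (*-congˡ (reflexive (≡.cong ι (sw≡s′w′ k)))) (sym (comb-scaled s′ w′ (vertex τ) τ≃w′ k))))
      i (λ ys≈0 → si≢0 (fromℤ≈0⇒≡0 (s i) (*-cancelˡ-0 (proj₂ (proj₂ (proj₂ (reciprocal N)))) ys≈0)))
    j = proj₁ common
    σi≃τj = proj₂ (proj₂ common)
    s′j≢0 : ¬ s′ j ≡ + 0
    s′j≢0 s′≡0 = proj₁ (proj₂ common) (trans (*-congˡ (reflexive (≡.cong ι s′≡0))) (zeroʳ y))

-- The Kuhn triangulation

module Kuhn (em : ExcludedMiddle 0ℓ) (ℝ : RealNumbers) where
  open OrderedField ℝ
  open Convexity em ℝ
  open Simplex
  open Solver using (solve; con; _:=_; _:+_; _:*_; _:-_)
  open SetoidReasoning setoid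

  Vertices : ∀ {n} → Simplex ℝ n → Vector (Vector ℤ n) (suc n) → Set
  Vertices σ w = ∀ i → vertex σ i ≃ lattice ℝ (w i)

  -- Membership is a pairwise condition on the vertices, so it does not depend on their enumeration
  -- and has the form that `classification` delivers. The familiar description by permutations
  -- appears as `kuhnSimplex`.
  kuhn : ∀ n → Collection ℝ n
  kuhn n σ = ∃ λ w → Vertices σ w × ∀ i j → Near (w i) (w j)

  linear : ∀ {m} → Vector Carrier m → Vector ℤ m → Carrier
  linear c a = sum (λ i → c i * ι (a i))

  linear-- : ∀ {m} (c : Vector Carrier m) a b → linear c (λ i → a i ℤ.- b i) ≈ linear c a - linear c b
  linear-- c a b = trans
    (sum-cong-≋ (λ i → trans (*-congˡ (fromℤ-- (a i) (b i)))
      (solve 3 (λ c a b → c :* (a :- b) := c :* a :- c :* b) refl (c i) (ι (a i)) (ι (b i)))))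
    (sum-- (λ i → c i * ι (a i)) (λ i → c i * ι (b i)))

  linear-const : ∀ {m} (c : Vector Carrier m) M → sum c ≈ 1# → linear c (λ _ → M) ≈ ι M
  linear-const c M ∑c≈1 = trans (sym (*-distribʳ-sum (ι M) c)) (trans (*-congʳ ∑c≈1) (*-identityˡ _))

  -- If a i ≥ b j + 2, then b j + 1 separates the two averages, except for the strictly larger a i.
  average-bound : ∀ {m l} (c : Vector Carrier m) (d : Vector Carrier l) a b →
    (∀ p → 0# ≤ c p) → sum c ≈ 1# → (∀ q → 0# ≤ d q) → sum d ≈ 1# → linear c a ≈ linear d b →
    (∀ p p′ → a p ℤ.- a p′ ℤ.≤ + 1) → (∀ q q′ → b q ℤ.- b q′ ℤ.≤ + 1) →
    ∀ i → ¬ (c i ≈ 0#) → ∀ j → a i ℤ.- b j ℤ.≤ + 1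
  average-bound c d a b 0≤c ∑c 0≤d ∑d ca≈db a-near b-near i ci≉0 j with a i ℤ.- b j ℤ.≤? + 1
  ... | yes bounded = bounded
  ... | no  ¬bounded = ⊥-elim (ci≉0 (*-cancelˡ-0 gap≉0
      (trans (*-comm _ _) (sum≈0⇒≈0 (λ p → *-nonNeg (0≤c p) (0≤gap p)) ∑≈0 i))))
    where
    M = b j ℤ.+ + 1
    2≤ : + 2 ℤ.≤ a i ℤ.- b j
    2≤ = ℤ.i<j⇒suc[i]≤j (ℤ.≰⇒> ¬bounded)
    0≤ai-M-1 : + 0 ℤ.≤ (a i ℤ.- b j) ℤ.- + 2
    0≤ai-M-1 = ℤ.i≤j⇒0≤j-i 2≤
    0≤gap : ∀ p → 0# ≤ ι (a p ℤ.- M)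
    0≤gap p = fromℤ-mono (≡.subst (+ 0 ℤ.≤_) (rearrange (a i) (b j) (a p))
      (ℤ.+-mono-≤ 0≤ai-M-1 (ℤ.i≤j⇒0≤j-i (a-near i p))))
      where
      rearrange : ∀ x y z → ((x ℤ.- y) ℤ.- + 2) ℤ.+ (+ 1 ℤ.- (x ℤ.- z)) ≡ z ℤ.- (y ℤ.+ + 1)
      rearrange = ℤ-Ring.solve-∀
    0≤M-b : ∀ q → 0# ≤ ι (M ℤ.- b q)
    0≤M-b q = fromℤ-mono (≡.subst (+ 0 ℤ.≤_) (rearrange (b j) (b q)) (ℤ.i≤j⇒0≤j-i (b-near q j)))
      where
      rearrange : ∀ y z → + 1 ℤ.- (z ℤ.- y) ≡ (y ℤ.+ + 1) ℤ.- z
      rearrange = ℤ-Ring.solve-∀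
    gap≉0 : ¬ (ι (a i ℤ.- M) ≈ 0#)
    gap≉0 gap≈0 = ℤ.<-irrefl ≡.refl (ℤ.≤-<-trans (≡.subst (+ 0 ℤ.≤_) (≡.trans (rearrange (a i) (b j))
      (≡.cong (ℤ._- + 1) (fromℤ≈0⇒≡0 (a i ℤ.- M) gap≈0))) 0≤ai-M-1) ℤ.-<+)
      where
      rearrange : ∀ x y → (x ℤ.- y) ℤ.- + 2 ≡ (x ℤ.- (y ℤ.+ + 1)) ℤ.- + 1
      rearrange = ℤ-Ring.solve-∀
    ∑≈0 : linear c (λ p → a p ℤ.- M) ≈ 0#
    ∑≈0 = +≈0⇒≈0 (0≤sum (λ p → *-nonNeg (0≤c p) (0≤gap p))) (0≤sum (λ q → *-nonNeg (0≤d q) (0≤M-b q))) (begin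
      linear c (λ p → a p ℤ.- M) + linear d (λ q → M ℤ.- b q)
        ≈⟨ +-cong (linear-- c a (λ _ → M)) (linear-- d (λ _ → M) b) ⟩
      (linear c a - linear c (λ _ → M)) + (linear d (λ _ → M) - linear d b)
        ≈⟨ +-cong (+-cong ca≈db (-‿cong (linear-const c M ∑c))) (+-congʳ (linear-const d M ∑d)) ⟩
      (linear d b - ι M) + (ι M - linear d b)
        ≈⟨ solve 2 (λ x m → (x :- m) :+ (m :- x) := con (+ 0)) refl (linear d b) (ι M) ⟩
      0# ∎)

  -- Treats one linear form `F` at a time. The additional coordinate 0 makes coordinates and their
  -- differences forms of the same kind, and the common point gives `F` equal averages over both
  -- simplices.
  support-near : ∀ {n m l} (w : Vector (Vector ℤ n) m) (w′ : Vector (Vector ℤ n) l) c d →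
    (∀ p → 0# ≤ c p) → sum c ≈ 1# → (∀ q → 0# ≤ d q) → sum d ≈ 1# →
    comb c (λ p → lattice ℝ (w p)) ≃ comb d (λ q → lattice ℝ (w′ q)) →
    (∀ p p′ → Near (w p) (w p′)) → (∀ q q′ → Near (w′ q) (w′ q′)) →
    ∀ i → ¬ (c i ≈ 0#) → ∀ j → Near (w i) (w′ j)
  support-near {n} {m} {l} w w′ c d 0≤c ∑c 0≤d ∑d cw≃dw′ near near′ i ci≉0 j k₁ k₂ =
    ≡.subst (ℤ._≤ + 1) (≡.sym (form (w i) (w′ j)))
      (average-bound c d (λ p → F (w p)) (λ q → F (w′ q)) 0≤c ∑c 0≤d ∑d F-average
        (λ p p′ → ≡.subst (ℤ._≤ + 1) (form (w p) (w p′)) (near p p′ k₁ k₂))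
        (λ q q′ → ≡.subst (ℤ._≤ + 1) (form (w′ q) (w′ q′)) (near′ q q′ k₁ k₂)) i ci≉0 j)
    where
    F : Vector ℤ n → ℤ
    F z = homogeneous z k₁ ℤ.- homogeneous z k₂
    form : ∀ z z′ → homogeneous (z -ᵥ z′) k₁ ℤ.- homogeneous (z -ᵥ z′) k₂ ≡ F z ℤ.- F z′
    form z z′ = ≡.trans (≡.cong₂ ℤ._-_ (homogeneous-- z z′ k₁) (homogeneous-- z z′ k₂))
      (rearrange (homogeneous z k₁) (homogeneous z′ k₁) (homogeneous z k₂) (homogeneous z′ k₂))
      where
      rearrange : ∀ a b c d → (a ℤ.- b) ℤ.- (c ℤ.- d) ≡ (a ℤ.- c) ℤ.- (b ℤ.- d)
      rearrange = ℤ-Ring.solve-∀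
    average : ∀ k → linear c (λ p → homogeneous (w p) k) ≈ linear d (λ q → homogeneous (w′ q) k)
    average zero    = trans (sum-zero {c = λ p → c p * 0#} (λ p → zeroʳ _))
      (sym (sum-zero {c = λ q → d q * 0#} (λ q → zeroʳ _)))
    average (suc k) = cw≃dw′ k
    F-average : linear c (λ p → F (w p)) ≈ linear d (λ q → F (w′ q))
    F-average = trans (linear-- c (λ p → homogeneous (w p) k₁) (λ p → homogeneous (w p) k₂))
      (trans (+-cong (average k₁) (-‿cong (average k₂)))
        (sym (linear-- d (λ q → homogeneous (w′ q) k₁) (λ q → homogeneous (w′ q) k₂))))

  Vertices-injective : ∀ {n} (σ : Simplex ℝ n) {w} → Vertices σ w → ∀ i j → w i ≗ w j → i ≡ j
  Vertices-injective σ {w} σ≃w i j wi≗wj with i Fin.≟ j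
  ... | yes i≡j = i≡j
  ... | no  i≢j = ⊥-elim (0≉1 (begin
      0#       ≈⟨ δ-≢ i j i≢j ⟨
      δ i j    ≈⟨ barycentric-unique σ (δ i) (δ j) (trans (∑δ≈1 i) (sym (∑δ≈1 j))) same j ⟩
      δ j j    ≈⟨ *-identityʳ _ ⟨
      δ j j * 1# ≈⟨ δjj≈1 ⟩
      1#       ∎))
    where
    same : comb (δ i) (vertex σ) ≃ comb (δ j) (vertex σ)
    same k = begin
      comb (δ i) (vertex σ) k ≈⟨ sum-δ i (λ a → vertex σ a k) ⟩
      vertex σ i k            ≈⟨ σ≃w i k ⟩
      ι (w i k)               ≡⟨ ≡.cong ι (wi≗wj k) ⟩
      ι (w j k)               ≈⟨ σ≃w j k ⟨
      vertex σ j k            ≈⟨ sum-δ j (λ a → vertex σ a k) ⟨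
      comb (δ j) (vertex σ) k ∎
    δjj≈1 : δ j j * 1# ≈ 1#
    δjj≈1 with j Fin.≟ j
    ... | yes _   = *-identityʳ _
    ... | no  j≢j = ⊥-elim (j≢j ≡.refl)

  kuhn-support : ∀ {σ τ : Simplex ℝ 3} {w w′ c d} → Vertices σ w → (∀ i j → Near (w i) (w j)) →
    Vertices τ w′ → (∀ i j → Near (w′ i) (w′ j)) →
    (∀ i → 0# ≤ c i) → sum c ≈ 1# → (∀ j → 0# ≤ d j) → sum d ≈ 1# →
    comb c (vertex σ) ≃ comb d (vertex τ) → ∀ i → ¬ (c i ≈ 0#) → ∃ λ j → w′ j ≗ w i
  kuhn-support {σ} {τ} {w} {w′} {c} {d} σ≃w near τ≃w′ near′ 0≤c ∑c 0≤d ∑d cσ≃dτ i ci≉0 =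
    near-all⇒member w′ (w i) near′ (Vertices-injective τ τ≃w′)
      (λ j → Near-sym {z = w i} {w′ j} (support-near w w′ c d 0≤c ∑c 0≤d ∑d cw≃dw′ near near′ i ci≉0 j))
    where
    cw≃dw′ : comb c (λ p → lattice ℝ (w p)) ≃ comb d (λ q → lattice ℝ (w′ q))
    cw≃dw′ k = trans (comb-cong {c = c} (λ _ → refl) (λ p k → sym (σ≃w p k)) k)
      (trans (cσ≃dτ k) (comb-cong {c = d} (λ _ → refl) τ≃w′ k))

  fromDec : ∀ {m} {P : Fin m → Set} → (∀ i → Dec (P i)) → Subset m
  fromDec P? = tabulate (λ i → does (P? i))

  ∈-fromDec⁺ : ∀ {m} {P : Fin m → Set} (P? : ∀ i → Dec (P i)) {i} → P i → i ∈ₛ fromDec P?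
  ∈-fromDec⁺ P? {i} Pi = lookup⇒[]= i _ (≡.trans (lookup∘tabulate _ i) (dec-true (P? i) Pi))

  ∈-fromDec⁻ : ∀ {m} {P : Fin m → Set} (P? : ∀ i → Dec (P i)) {i} → i ∈ₛ fromDec P? → P i
  ∈-fromDec⁻ P? {i} i∈ with P? i | ≡.trans (≡.sym (lookup∘tabulate (λ i → does (P? i)) i)) ([]=⇒lookup i∈)
  ... | yes Pi | _ = Pi

  kuhn-face : ∀ {σ τ : Simplex ℝ 3} → σ ∈ kuhn 3 → τ ∈ kuhn 3 → _IsFaceOf_ ℝ (body ℝ σ ∩ body ℝ τ) σ
  kuhn-face {σ} {τ} (w , σ≃w , near) (w′ , τ≃w′ , near′) = S , to , from
    where
    common? : ∀ i → Dec (∃ λ j → w′ j ≗ w i)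
    common? i = em
    -- The intersection is the hull of the common vertices.
    S : Subset 4
    S = fromDec common?
    to : ∀ {x} → x ∈ body ℝ σ ∩ body ℝ τ → x ∈ face ℝ σ S
    to {x} ((c , 0≤c , _ , ∑c , cσ≃x) , (d , 0≤d , _ , ∑d , dτ≃x)) = c , 0≤c , outside , ∑c , cσ≃x
      where
      outside : ∀ i → i ∉ₛ S → c i ≈ 0#
      outside i i∉S with em {c i ≈ 0#}
      ... | yes ci≈0 = ci≈0
      ... | no  ci≉0 = ⊥-elim (i∉S (∈-fromDec⁺ common?
        (kuhn-support {σ} {τ} {w} {w′} {c} {d} σ≃w near τ≃w′ near′ 0≤c ∑c 0≤d ∑d
          (λ k → trans (cσ≃x k) (sym (dτ≃x k))) i ci≉0)))
    from : ∀ {x} → x ∈ face ℝ σ S → x ∈ body ℝ σ ∩ body ℝ τ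
    from {x} (c , 0≤c , outside , ∑c , cσ≃x) =
      Hull⇒body σ (c , 0≤c , ∑c , cσ≃x) ,
      Hull⇒body τ (weight , 0≤weight 0≤c , trans ∑weight ∑c , λ k → trans (comb-weight k) (cσ≃x k))
      where
      represented : ∀ i → c i ≈ 0# ⊎ Hull (vertex τ) (vertex σ i)
      represented i with i ∈? S
      ... | no  i∉S = inj₁ (outside i i∉S)
      ... | yes i∈S = inj₂ (δ j , 0≤δ j , ∑δ≈1 j , λ k → begin
          comb (δ j) (vertex τ) k ≈⟨ sum-δ j (λ a → vertex τ a k) ⟩
          vertex τ j k            ≈⟨ τ≃w′ j k ⟩
          ι (w′ j k)              ≡⟨ ≡.cong ι (proj₂ (∈-fromDec⁻ common? i∈S) k) ⟩
          ι (w i k)               ≈⟨ σ≃w i k ⟨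
          vertex σ i k            ∎)
        where j = proj₁ (∈-fromDec⁻ common? i∈S)
      open Substitution (vertex τ) (vertex σ) c represented

  kuhn-intersection : ∀ {σ τ : Simplex ℝ 3} → σ ∈ kuhn 3 → τ ∈ kuhn 3 →
    _IsFaceOf_ ℝ (body ℝ σ ∩ body ℝ τ) σ × _IsFaceOf_ ℝ (body ℝ σ ∩ body ℝ τ) τ
  kuhn-intersection {σ} {τ} σ∈K τ∈K with kuhn-face {τ} {σ} τ∈K σ∈K
  ... | S , to , from = kuhn-face {σ} {τ} σ∈K τ∈K ,
    S , (λ (x∈σ , x∈τ) → to (x∈τ , x∈σ)) , (λ x∈S → proj₂ (from x∈S) , proj₁ (from x∈S))

-- The vertices of the simplex with base point z along π are z, z + e_{π 0}, z + e_{π 0} + e_{π 1}, ….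
step : ∀ {n} → Fin (suc n) → Fin n → ℤ
step zero    _       = + 0
step (suc t) zero    = + 1
step (suc t) (suc a) = step t a

kuhnVertex : ∀ {n} → Vector ℤ n → Permutation′ n → Vector (Vector ℤ n) (suc n)
kuhnVertex z π t k = z k ℤ.+ step t (π ⟨$⟩ˡ k)

-- The base point cancels, and `π` only permutes coordinates other than the homogeneous one, which
-- leaves the differences of the rows of `step` to check.
kuhnVertex-near : ∀ z (π : Permutation′ 3) s t → Near (kuhnVertex z π s) (kuhnVertex z π t)
kuhnVertex-near z π s t k l = ≡.subst (ℤ._≤ + 1)
  (≡.sym (≡.cong₂ ℤ._-_ (relabel-step k) (relabel-step l))) (decided s t (relabel k) (relabel l))
  where
  e : Vector ℤ 3
  e = step s -ᵥ step t
  relabel : Fin 4 → Fin 4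
  relabel zero    = zero
  relabel (suc k) = suc (π ⟨$⟩ˡ k)
  relabel-step : ∀ k → homogeneous (kuhnVertex z π s -ᵥ kuhnVertex z π t) k ≡ homogeneous e (relabel k)
  relabel-step zero    = ≡.refl
  relabel-step (suc k) = cancel (z k) (step s (π ⟨$⟩ˡ k)) (step t (π ⟨$⟩ˡ k))
    where
    cancel : ∀ z a b → (z ℤ.+ a) ℤ.- (z ℤ.+ b) ≡ a ℤ.- b
    cancel = ℤ-Ring.solve-∀
  decided : ∀ s t → Short {3} (step s -ᵥ step t)
  decided = from-yes (Fin.all? λ s → Fin.all? λ t → Short? {3} (step s -ᵥ step t))

module KuhnTriangulation (em : ExcludedMiddle 0ℓ) (ℝ : RealNumbers) where
  open OrderedField ℝ
  open Convexity em ℝ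
  open Floor em ℝ
  open Kuhn em ℝ
  open Simplex
  open IsPeriodicTriangulation
  open Solver using (solve; con; _:=_; _:+_; _:*_; _:-_)
  open SetoidReasoning setoid

  -- `step t a` is 1 exactly for `t > a`. So, apart from the base point, the coordinate `π a` of a
  -- combination is the tail sum of the weights after `a`.
  comb-kuhnVertex : ∀ {n} (c : Vector Carrier (suc n)) z (π : Permutation′ n) a →
    comb c (λ t → lattice ℝ (kuhnVertex z π t)) (π ⟨$⟩ʳ a) ≈
    sum c * ι (z (π ⟨$⟩ʳ a)) + linear c (λ t → step t a)
  comb-kuhnVertex c z π a = begin
    sum (λ t → c t * ι (z k ℤ.+ step t (π ⟨$⟩ˡ k)))
      ≈⟨ sum-cong-≋ (λ t → *-congˡ {c t} (reflexive (≡.cong (λ b → ι (z k ℤ.+ step t b)) (Perm.inverseˡ π {a})))) ⟩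
    sum (λ t → c t * ι (z k ℤ.+ step t a))
      ≈⟨ sum-cong-≋ (λ t → trans (*-congˡ (fromℤ-+ (z k) (step t a))) (distribˡ (c t) _ _)) ⟩
    sum (λ t → c t * ι (z k) + c t * ι (step t a))
      ≈⟨ ∑-distrib-+ (λ t → c t * ι (z k)) (λ t → c t * ι (step t a)) ⟩
    sum (λ t → c t * ι (z k)) + linear c (λ t → step t a)
      ≈⟨ +-congʳ (*-distribʳ-sum (ι (z k)) c) ⟨
    sum c * ι (z k) + linear c (λ t → step t a) ∎
    where k = π ⟨$⟩ʳ a

  kuhnSimplex : Vector ℤ 3 → Permutation′ 3 → Simplex ℝ 3
  kuhnSimplex z π .vertex t        = lattice ℝ (kuhnVertex z π t)
  kuhnSimplex z π .independent c ∑c≈0 cw≃0 = zeros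
    where
    L : Fin 3 → Carrier
    L a = linear c (λ t → step t a)
    L≈0 : ∀ a → L a ≈ 0#
    L≈0 a = begin
      L a                                   ≈⟨ +-identityˡ _ ⟨
      0# + L a                              ≈⟨ +-congʳ (trans (*-congʳ ∑c≈0) (zeroˡ _)) ⟨
      sum c * ι (z (π ⟨$⟩ʳ a)) + L a        ≈⟨ comb-kuhnVertex c z π a ⟨
      comb c (λ t → lattice ℝ (kuhnVertex z π t)) (π ⟨$⟩ʳ a) ≈⟨ cw≃0 (π ⟨$⟩ʳ a) ⟩
      0#                                    ∎
    difference≈0 : ∀ {x y} → x ≈ 0# → y ≈ 0# → x - y ≈ 0#
    difference≈0 x≈0 y≈0 = trans (+-cong x≈0 (-‿cong y≈0)) (-‿inverseʳ 0#)
    O I : ∀ {n} → Solver.Polynomial n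
    O = con (+ 0)
    I = con (+ 1)
    -- Each weight is the difference of two consecutive tail sums, starting with the full sum, and
    -- all of these vanish.
    zeros : ∀ t → c t ≈ 0#
    zeros 0F = trans (solve 4 (λ a b c d → a := (a :+ (b :+ (c :+ (d :+ O)))) :-
      (a :* O :+ (b :* I :+ (c :* I :+ (d :* I :+ O))))) refl (c 0F) (c 1F) (c 2F) (c 3F))
      (difference≈0 ∑c≈0 (L≈0 0F))
    zeros 1F = trans (solve 4 (λ a b c d → b := (a :* O :+ (b :* I :+ (c :* I :+ (d :* I :+ O)))) :-
      (a :* O :+ (b :* O :+ (c :* I :+ (d :* I :+ O))))) refl (c 0F) (c 1F) (c 2F) (c 3F))
      (difference≈0 (L≈0 0F) (L≈0 1F))
    zeros 2F = trans (solve 4 (λ a b c d → c := (a :* O :+ (b :* O :+ (c :* I :+ (d :* I :+ O)))) :-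
      (a :* O :+ (b :* O :+ (c :* O :+ (d :* I :+ O))))) refl (c 0F) (c 1F) (c 2F) (c 3F))
      (difference≈0 (L≈0 1F) (L≈0 2F))
    zeros 3F = trans (solve 4 (λ a b c d → d := a :* O :+ (b :* O :+ (c :* O :+ (d :* I :+ O))))
      refl (c 0F) (c 1F) (c 2F) (c 3F)) (L≈0 2F)

  kuhnSimplex∈kuhn : ∀ z π → kuhnSimplex z π ∈ kuhn 3
  kuhnSimplex∈kuhn z π = kuhnVertex z π , (λ i k → refl) , kuhnVertex-near z π

  kuhn-hull : ∀ z π x → let u = λ a → x (π ⟨$⟩ʳ a) - ι (z (π ⟨$⟩ʳ a)) in
    u 0F ≤ 1# → u 1F ≤ u 0F → u 2F ≤ u 1F → 0# ≤ u 2F → Hull (λ t → lattice ℝ (kuhnVertex z π t)) x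
  kuhn-hull z π x u₀≤1 u₁≤u₀ u₂≤u₁ 0≤u₂ = c , 0≤c , ∑c≈1 , cw≃x
    where
    u : Fin 3 → Carrier
    u a = x (π ⟨$⟩ʳ a) - ι (z (π ⟨$⟩ʳ a))
    -- The weights are the gaps in the chain from 1 through `u 0F`, `u 1F`, `u 2F` down to 0, so
    -- that the tail sums are the `u a`.
    c : Vector Carrier 4
    c 0F = 1# - u 0F
    c 1F = u 0F - u 1F
    c 2F = u 1F - u 2F
    c 3F = u 2F
    0≤c : ∀ i → 0# ≤ c i
    0≤c 0F = ≤⇒0≤- u₀≤1
    0≤c 1F = ≤⇒0≤- u₁≤u₀
    0≤c 2F = ≤⇒0≤- u₂≤u₁
    0≤c 3F = 0≤u₂
    O I : ∀ {n} → Solver.Polynomial n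
    O = con (+ 0)
    I = con (+ 1)
    ∑c≈1 : sum c ≈ 1#
    ∑c≈1 = solve 4 (λ o a b c → (o :- a) :+ ((a :- b) :+ ((b :- c) :+ (c :+ O))) := o)
      refl 1# (u 0F) (u 1F) (u 2F)
    linear-step : ∀ a → linear c (λ t → step t a) ≈ u a
    linear-step 0F = solve 4 (λ o a b c → (o :- a) :* O :+ ((a :- b) :* I :+ ((b :- c) :* I :+
      (c :* I :+ O))) := a) refl 1# (u 0F) (u 1F) (u 2F)
    linear-step 1F = solve 4 (λ o a b c → (o :- a) :* O :+ ((a :- b) :* O :+ ((b :- c) :* I :+
      (c :* I :+ O))) := b) refl 1# (u 0F) (u 1F) (u 2F)
    linear-step 2F = solve 4 (λ o a b c → (o :- a) :* O :+ ((a :- b) :* O :+ ((b :- c) :* O :+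
      (c :* I :+ O))) := c) refl 1# (u 0F) (u 1F) (u 2F)
    cw≃xπ : ∀ a → comb c (λ t → lattice ℝ (kuhnVertex z π t)) (π ⟨$⟩ʳ a) ≈ x (π ⟨$⟩ʳ a)
    cw≃xπ a = begin
      comb c (λ t → lattice ℝ (kuhnVertex z π t)) k    ≈⟨ comb-kuhnVertex c z π a ⟩
      sum c * ι (z k) + linear c (λ t → step t a)      ≈⟨ +-cong (trans (*-congʳ ∑c≈1) (*-identityˡ _)) (linear-step a) ⟩
      ι (z k) + (x k - ι (z k))                        ≈⟨ solve 2 (λ a b → a :+ (b :- a) := b) refl (ι (z k)) (x k) ⟩
      x k                                              ∎
      where k = π ⟨$⟩ʳ a
    cw≃x : comb c (λ t → lattice ℝ (kuhnVertex z π t)) ≃ x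
    cw≃x k = ≡.subst (λ k → comb c (λ t → lattice ℝ (kuhnVertex z π t)) k ≈ x k)
      (Perm.inverseʳ π) (cw≃xπ (π ⟨$⟩ˡ k))

  kuhn-body : ∀ x z π → (∀ k → ι (z k) ≤ x k) → (∀ k → x k ≤ ι (z k) + 1#) →
              Decreasing (λ k → x k - ι (z k)) π → x ∈ body ℝ (kuhnSimplex z π)
  kuhn-body x z π z≤x x≤z+1 (u₁≤u₀ , u₂≤u₁) = Hull⇒body (kuhnSimplex z π)
    (kuhn-hull z π x (y≤1 (π ⟨$⟩ʳ 0F)) u₁≤u₀ u₂≤u₁ (≤⇒0≤- (z≤x (π ⟨$⟩ʳ 2F))))
    where
    y≤1 : ∀ k → x k - ι (z k) ≤ 1#
    y≤1 k = 0≤-⇒≤ (≤-respʳ (solve 3 (λ o a b → b :+ o :- a := o :- (a :- b)) refl 1# (x k) (ι (z k)))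
      (≤⇒0≤- (x≤z+1 k)))

  kuhn-covers : ∀ x → ∃ λ σ → σ ∈ kuhn 3 × x ∈ body ℝ σ
  kuhn-covers x = kuhnSimplex z π , kuhnSimplex∈kuhn z π ,
    kuhn-body x z π (λ k → proj₁ (proj₂ (floor (x k)))) (λ k → proj₂ (proj₂ (floor (x k)))) (proj₂ sorted)
    where
    z : Vector ℤ 3
    z k = proj₁ (floor (x k))
    sorted : ∃ (Decreasing (λ k → x k - ι (z k)))
    sorted = sort (λ k → x k - ι (z k))
    π = proj₁ sorted

  Near-translate : ∀ {n} (z z′ v : Vector ℤ n) → Near z z′ → Near (λ k → z k ℤ.+ v k) (λ k → z′ k ℤ.+ v k)
  Near-translate z z′ v = Short-cong (λ k → cancel (z k) (z′ k) (v k))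
    where
    cancel : ∀ a b c → a ℤ.- b ≡ (a ℤ.+ c) ℤ.- (b ℤ.+ c)
    cancel = ℤ-Ring.solve-∀

  translate-lattice : ∀ {n} v {x : Point ℝ n} {z} → x ≃ lattice ℝ z →
                      translate ℝ v x ≃ lattice ℝ (λ k → z k ℤ.+ v k)
  translate-lattice v {z = z} x≃z k = trans (+-congʳ (x≃z k)) (sym (fromℤ-+ (z k) (v k)))

  kuhn-translate : ∀ {n} v {σ : Simplex ℝ n} → σ ∈ kuhn n → translateSimplex v σ ∈ kuhn n
  kuhn-translate v (w , σ≃w , near) = (λ i k → w i k ℤ.+ v k) , (λ i → translate-lattice v {z = w i} (σ≃w i)) ,
    (λ i j → Near-translate (w i) (w j) v (near i j))

  kuhn-respects : ∀ {n} → kuhn n Respects (_≋_ ℝ)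
  kuhn-respects {n} {σ} {τ} (σ⊆τ , τ⊆σ) (w , σ≃w , near) =
    (λ i → w (f i)) , (λ i k → trans (proj₂ (f-spec i) k) (σ≃w (f i) k)) , (λ i j → near (f i) (f j))
    where
    f-spec : ∀ i → vertex τ i ∈ range ℝ (vertex σ)
    f-spec i = τ⊆σ (i , λ k → refl)
    f : Fin (suc n) → Fin (suc n)
    f i = proj₁ (f-spec i)

  kuhn-triangulation : IsPeriodicTriangulation ℝ 3 (kuhn 3)
  kuhn-triangulation .respects {σ} {τ} = kuhn-respects {3} {σ} {τ}
  kuhn-triangulation .vertices = to , from
    where
    to : ∀ {x} → (∃ λ σ → σ ∈ kuhn 3 × x ∈ range ℝ (vertex σ)) → ∃ λ z → x ≃ lattice ℝ z
    to (σ , (w , σ≃w , _) , i , x≃σi) = w i , λ k → trans (x≃σi k) (σ≃w i k)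
    from : ∀ {x} → (∃ λ z → x ≃ lattice ℝ z) → ∃ λ σ → σ ∈ kuhn 3 × x ∈ range ℝ (vertex σ)
    from (z , x≃z) = kuhnSimplex z Perm.id , kuhnSimplex∈kuhn z Perm.id , 0F ,
      λ k → trans (x≃z k) (reflexive (≡.cong ι (≡.sym (ℤ.+-identityʳ (z k)))))
  kuhn-triangulation .covers = kuhn-covers
  kuhn-triangulation .intersection {σ} {τ} = kuhn-intersection {σ} {τ}
  kuhn-triangulation .periodic v = (λ {τ} → to {τ}) , (λ {τ} → from {τ})
    where
    to : ∀ {τ} → τ ∈ image ℝ (translate ℝ v) (kuhn 3) → τ ∈ kuhn 3
    to {τ} (σ , σ∈K , τ⊆ , ⊆τ) =
      kuhn-respects {3} {translateSimplex v σ} {τ} (⊆τ , τ⊆) (kuhn-translate v {σ} σ∈K)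
    from : ∀ {τ} → τ ∈ kuhn 3 → τ ∈ image ℝ (translate ℝ v) (kuhn 3)
    from {τ} τ∈K = translateSimplex -v τ , kuhn-translate -v {τ} τ∈K ,
      (λ (i , x≃τi) → i , λ k → trans (x≃τi k) (sym (back i k))) ,
      (λ (i , x≃) → i , λ k → trans (x≃ k) (back i k))
      where
      -v : Vector ℤ 3
      -v k = ℤ.- v k
      back : ∀ i → translate ℝ v (vertex (translateSimplex -v τ) i) ≃ vertex τ i
      back i k = trans (+-congʳ (+-congˡ (fromℤ-neg (v k))))
        (solve 2 (λ a b → a :- b :+ b := a) refl (vertex τ i k) (ι (v k)))

-- Uniqueness

module LinearMaps (em : ExcludedMiddle 0ℓ) (ℝ : RealNumbers) where
  open OrderedField ℝ
  open Convexity em ℝ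
  open Kuhn em ℝ
  open Simplex
  open SetoidReasoning setoid

  inverseGL : ∀ {n} → GL n → GL n
  inverseGL g = record
    { matrix   = GL.inverse g
    ; inverse  = GL.matrix g
    ; inverseˡ = GL.inverseʳ g
    ; inverseʳ = GL.inverseˡ g
    }

  ι-identity : ∀ {n} (i j : Fin n) → ι (identity i j) ≈ δ i j
  ι-identity i j with i Fin.≟ j
  ... | yes _ = fromℤ-1
  ... | no  _ = refl

  act-cong : ∀ {n} (g : GL n) {x y} → x ≃ y → act ℝ g x ≃ act ℝ g y
  act-cong g x≃y i = sum-cong-≋ (λ j → *-congˡ (x≃y j))

  act-inverse : ∀ {n} (g : GL n) x → act ℝ (inverseGL g) (act ℝ g x) ≃ x
  act-inverse g x i = begin
    sum (λ j → ι (A i j) * sum (λ k → ι (G j k) * x k))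
      ≈⟨ sum-cong-≋ (λ j → *-distribˡ-sum (ι (A i j)) (λ k → ι (G j k) * x k)) ⟩
    sum (λ j → sum (λ k → ι (A i j) * (ι (G j k) * x k)))
      ≈⟨ ∑-comm (λ j k → ι (A i j) * (ι (G j k) * x k)) ⟩
    sum (λ k → sum (λ j → ι (A i j) * (ι (G j k) * x k)))
      ≈⟨ sum-cong-≋ entry ⟩
    sum (λ k → δ i k * x k)
      ≈⟨ sum-δ i x ⟩
    x i ∎
    where
    G = GL.matrix g
    A = GL.inverse g
    entry : ∀ k → sum (λ j → ι (A i j) * (ι (G j k) * x k)) ≈ δ i k * x k
    entry k = begin
      sum (λ j → ι (A i j) * (ι (G j k) * x k))
        ≈⟨ sum-cong-≋ (λ j → trans (sym (*-assoc _ _ _)) (*-congʳ (sym (fromℤ-* (A i j) (G j k))))) ⟩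
      sum (λ j → ι (A i j ℤ.* G j k) * x k)
        ≈⟨ *-distribʳ-sum (x k) (λ j → ι (A i j ℤ.* G j k)) ⟨
      sum (λ j → ι (A i j ℤ.* G j k)) * x k
        ≈⟨ *-congʳ (ι-sum (λ j → A i j ℤ.* G j k)) ⟨
      ι ((A ⊛ G) i k) * x k
        ≈⟨ *-congʳ (trans (reflexive (≡.cong ι (GL.inverseˡ g i k))) (ι-identity i k)) ⟩
      δ i k * x k ∎

  act-lattice : ∀ {n} (g : GL n) z → act ℝ g (lattice ℝ z) ≃ lattice ℝ (apply (GL.matrix g) z)
  act-lattice g z i = sym (trans (ι-sum (λ j → GL.matrix g i j ℤ.* z j))
    (sum-cong-≋ (λ j → fromℤ-* (GL.matrix g i j) (z j))))

  mapSimplex : ∀ {n} → GL n → Simplex ℝ n → Simplex ℝ n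
  mapSimplex g σ .vertex i = act ℝ g (vertex σ i)
  mapSimplex {n} g σ .independent c ∑c≈0 gcv≃0 = independent σ c ∑c≈0 λ k → begin
    comb c (vertex σ) k                                    ≈⟨ act-inverse g (comb c (vertex σ)) k ⟨
    act ℝ (inverseGL g) (act ℝ g (comb c (vertex σ))) k    ≈⟨ act-cong (inverseGL g) (comb-act g c (vertex σ)) k ⟨
    act ℝ (inverseGL g) (comb c (λ i → act ℝ g (vertex σ i))) k ≈⟨ act-cong (inverseGL g) gcv≃0 k ⟩
    sum (λ j → ι (GL.inverse g k j) * 0#)                  ≈⟨ sum-zero {n} {λ j → ι (GL.inverse g k j) * 0#} (λ j → zeroʳ _) ⟩
    0#                                                     ∎

  Vertices-map : ∀ {n} (g : GL n) {σ : Simplex ℝ n} {w} → Vertices σ w →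
                 Vertices (mapSimplex g σ) (λ i → apply (GL.matrix g) (w i))
  Vertices-map g {w = w} σ≃w i k = trans (act-cong g (σ≃w i) k) (act-lattice g (w i) k)

module Uniqueness (em : ExcludedMiddle 0ℓ) (ℝ : RealNumbers) {T : Collection ℝ 3}
                  (triangulation : IsPeriodicTriangulation ℝ 3 T) where
  open OrderedField ℝ
  open Convexity em ℝ
  open Cells em ℝ triangulation
  open Kuhn em ℝ
  open LinearMaps em ℝ
  open IsPeriodicTriangulation triangulation
  open Simplex
  open Solver using (solve; con; _:=_; _:+_; _:*_; _:-_)
  open SetoidReasoning setoid

  linear-∙ : ∀ {m} (c : Vector Carrier m) (w : Vector (Vector ℤ 3) m) f →
             linear c (λ j → f ∙ w j) ≈ sum (λ k → ι (f k) * comb c (λ j → lattice ℝ (w j)) k)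
  linear-∙ c w f = begin
    sum (λ j → c j * ι (f ∙ w j))
      ≈⟨ sum-cong-≋ (λ j → *-congˡ (trans (ι-sum (λ k → f k ℤ.* w j k)) (sum-cong-≋ (λ k → fromℤ-* (f k) (w j k))))) ⟩
    sum (λ j → c j * sum (λ k → ι (f k) * ι (w j k)))
      ≈⟨ sum-cong-≋ (λ j → *-distribˡ-sum (c j) (λ k → ι (f k) * ι (w j k))) ⟩
    sum (λ j → sum (λ k → c j * (ι (f k) * ι (w j k))))
      ≈⟨ ∑-comm (λ j k → c j * (ι (f k) * ι (w j k))) ⟩
    sum (λ k → sum (λ j → c j * (ι (f k) * ι (w j k))))
      ≈⟨ sum-cong-≋ (λ k → trans (sum-cong-≋ (λ j → swap (c j) (ι (f k)) (ι (w j k))))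
           (sym (*-distribˡ-sum (ι (f k)) (λ j → c j * ι (w j k))))) ⟩
    sum (λ k → ι (f k) * comb c (λ j → lattice ℝ (w j)) k) ∎
    where
    swap : ∀ x y z → x * (y * z) ≈ y * (x * z)
    swap = solve 3 (λ x y z → x :* (y :* z) := y :* (x :* z)) refl

  -- At the covered point `u / 2` the form `f` takes an average of its values at the vertices, which
  -- is at least `m`.
  half-covered : ∀ u → ∃ λ w → Cell w × (∀ f m → (∀ j → m ℤ.≤ f ∙ w j) → + 2 ℤ.* m ℤ.≤ f ∙ u)
  half-covered u = found (covers x)
    where
    y = proj₁ (reciprocal 1)
    2y≈1 : ι (+ 2) * y ≈ 1#
    2y≈1 = proj₁ (proj₂ (reciprocal 1))
    x : Point ℝ 3
    x k = y * ι (u k)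
    found : (∃ λ σ → σ ∈ T × x ∈ body ℝ σ) →
            ∃ λ w → Cell w × (∀ f m → (∀ j → m ℤ.≤ f ∙ w j) → + 2 ℤ.* m ℤ.≤ f ∙ u)
    found (σ , σ∈T , c , 0≤c , _ , ∑c≈1 , cσ≃x) = w , (σ , σ∈T , σ≃w) , bound
      where
      w = proj₁ (cell σ∈T)
      σ≃w = proj₂ (cell σ∈T)
      bound : ∀ f m → (∀ j → m ℤ.≤ f ∙ w j) → + 2 ℤ.* m ℤ.≤ f ∙ u
      bound f m m≤ = fromℤ-cancel-≤ (0≤-⇒≤ (≤-respʳ doubled
          (*-nonNeg (0≤fromℕ 2) (0≤sum (λ j → *-nonNeg (0≤c j) (≤-respʳ (sym (fromℤ-- (f ∙ w j) m)) (≤⇒0≤- (fromℤ-mono (m≤ j)))))))))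
        where
        average : linear c (λ j → f ∙ w j) ≈ y * ι (f ∙ u)
        average = begin
          linear c (λ j → f ∙ w j)
            ≈⟨ linear-∙ c w f ⟩
          sum (λ k → ι (f k) * comb c (λ j → lattice ℝ (w j)) k)
            ≈⟨ sum-cong-≋ (λ k → *-congˡ {ι (f k)} (trans (comb-cong {c = c} (λ _ → refl) (λ j l → sym (σ≃w j l)) k) (cσ≃x k))) ⟩
          sum (λ k → ι (f k) * (y * ι (u k)))
            ≈⟨ sum-cong-≋ (λ k → swap (ι (f k)) y (ι (u k))) ⟩
          sum (λ k → y * (ι (f k) * ι (u k)))
            ≈⟨ *-distribˡ-sum y (λ k → ι (f k) * ι (u k)) ⟨
          y * sum (λ k → ι (f k) * ι (u k))
            ≈⟨ *-congˡ (trans (ι-sum (λ k → f k ℤ.* u k)) (sum-cong-≋ (λ k → fromℤ-* (f k) (u k)))) ⟨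
          y * ι (f ∙ u) ∎
          where
          swap : ∀ x y z → x * (y * z) ≈ y * (x * z)
          swap = solve 3 (λ x y z → x :* (y :* z) := y :* (x :* z)) refl
        doubled : ι (+ 2) * linear c (λ j → f ∙ w j ℤ.- m) ≈ ι (f ∙ u) - ι (+ 2 ℤ.* m)
        doubled = begin
          ι (+ 2) * linear c (λ j → f ∙ w j ℤ.- m)
            ≈⟨ *-congˡ (linear-- c (λ j → f ∙ w j) (λ _ → m)) ⟩
          ι (+ 2) * (linear c (λ j → f ∙ w j) - linear c (λ _ → m))
            ≈⟨ *-congˡ (+-cong average (-‿cong (linear-const c m ∑c≈1))) ⟩
          ι (+ 2) * (y * ι (f ∙ u) - ι m)
            ≈⟨ solve 4 (λ a y b m → a :* (y :* b :- m) := (a :* y) :* b :- a :* m) refl (ι (+ 2)) y (ι (f ∙ u)) (ι m) ⟩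
          ι (+ 2) * y * ι (f ∙ u) - ι (+ 2) * ι m
            ≈⟨ +-cong (trans (*-congʳ 2y≈1) (*-identityˡ _)) (-‿cong (sym (fromℤ-* (+ 2) m))) ⟩
          ι (f ∙ u) - ι (+ 2 ℤ.* m) ∎

  cellSystem : CellSystem Cell
  cellSystem = record
    { translated  = λ {w} c v → Cell-translate {w} v c
    ; independent = λ {w} → Cell-independent {w}
    ; support     = λ {w} {w′} c c′ {s} {s′} {N} → Cell-support {w} {w′} c c′ {s} {s′} {N}
    ; half-covers = half-covered
    }

  abstract
    g : GL 3
    g = proj₁ (classification cellSystem)

    near : ∀ {w} → Cell w → ∀ i j → Near (apply (GL.inverse g) (w i)) (apply (GL.inverse g) (w j))
    near {w} = proj₂ (classification cellSystem) {w}

  g⁻¹ : GL 3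
  g⁻¹ = inverseGL g

  preimage∈kuhn : ∀ {σ} → σ ∈ T → mapSimplex g⁻¹ σ ∈ kuhn 3
  preimage∈kuhn {σ} σ∈T = (λ i → apply (GL.inverse g) (w i)) , Vertices-map g⁻¹ {σ} {w} σ≃w ,
    near {w} (σ , σ∈T , σ≃w)
    where
    w = proj₁ (cell σ∈T)
    σ≃w = proj₂ (cell σ∈T)

  T⊆image : ∀ {σ} → σ ∈ T → σ ∈ image ℝ (act ℝ g) (kuhn 3)
  T⊆image {σ} σ∈T = mapSimplex g⁻¹ σ , preimage∈kuhn σ∈T ,
    (λ (i , x≃) → i , λ k → trans (x≃ k) (sym (act-inverse g⁻¹ (vertex σ i) k))) ,
    (λ (i , x≃) → i , λ k → trans (x≃ k) (act-inverse g⁻¹ (vertex σ i) k))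

  -- The simplex of T containing the barycentre of g σ₀ is g τ₀ for a Kuhn simplex τ₀ which contains
  -- the barycentre of σ₀, so that τ₀ and σ₀ have the same vertices.
  image⊆T : ∀ {σ} → σ ∈ image ℝ (act ℝ g) (kuhn 3) → σ ∈ T
  image⊆T {σ} (σ₀ , (w , σ₀≃w , w-near) , σ⊆gσ₀ , gσ₀⊆σ) = compare (covers (act ℝ g (comb c (vertex σ₀))))
    where
    c : Vector Carrier 4
    c _ = proj₁ (reciprocal 3)
    ∑c≈1 : sum c ≈ 1#
    ∑c≈1 = trans (solve 1 (λ y → y :+ (y :+ (y :+ (y :+ con (+ 0)))) := con (+ 4) :* y) refl (proj₁ (reciprocal 3)))
      (proj₁ (proj₂ (reciprocal 3)))
    compare : (∃ λ τ → τ ∈ T × act ℝ g (comb c (vertex σ₀)) ∈ body ℝ τ) → σ ∈ T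
    compare (τ , τ∈T , d , 0≤d , _ , ∑d≈1 , dτ≃) = respects {τ} {σ} (τ⊆σ , σ⊆τ) τ∈T
      where
      τ₀ = mapSimplex g⁻¹ τ
      w′ = proj₁ (preimage∈kuhn τ∈T)
      τ₀≃w′ : Vertices τ₀ w′
      τ₀≃w′ = proj₁ (proj₂ (preimage∈kuhn τ∈T))
      w′-near : ∀ i j → Near (w′ i) (w′ j)
      w′-near = proj₂ (proj₂ (preimage∈kuhn τ∈T))
      same-point : comb c (vertex σ₀) ≃ comb d (vertex τ₀)
      same-point k = begin
        comb c (vertex σ₀) k                                 ≈⟨ act-inverse g (comb c (vertex σ₀)) k ⟨
        act ℝ g⁻¹ (act ℝ g (comb c (vertex σ₀))) k           ≈⟨ act-cong g⁻¹ dτ≃ k ⟨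
        act ℝ g⁻¹ (comb d (vertex τ)) k                      ≈⟨ comb-act g⁻¹ d (vertex τ) k ⟨
        comb d (vertex τ₀) k                                 ∎
      matched : ∀ i → ∃ λ j → w′ j ≗ w i
      matched i = kuhn-support {σ₀} {τ₀} {w} {w′} {c} {d} σ₀≃w w-near τ₀≃w′ w′-near
        (λ _ → proj₁ (proj₂ (proj₂ (reciprocal 3)))) ∑c≈1 0≤d ∑d≈1 same-point i
        (proj₂ (proj₂ (proj₂ (reciprocal 3))))
      -- Every `w i` is one of the `w′`, hence near to `w′ j`; and four distinct, pairwise near
      -- points leave no room for a fifth.
      matched′ : ∀ j → ∃ λ i → w i ≗ w′ j
      matched′ j = near-all⇒member w (w′ j) w-near (Vertices-injective σ₀ σ₀≃w)
        (λ i → Near-cong (proj₂ (matched i)) (λ _ → ≡.refl) (w′-near (proj₁ (matched i)) j))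
      gσ₀≃τ : ∀ i j → w i ≗ w′ j → act ℝ g (vertex σ₀ i) ≃ vertex τ j
      gσ₀≃τ i j wi≗w′j k = begin
        act ℝ g (vertex σ₀ i) k ≈⟨ act-cong g (λ l → trans (σ₀≃w i l) (trans (reflexive (≡.cong ι (wi≗w′j l))) (sym (τ₀≃w′ j l)))) k ⟩
        act ℝ g (vertex τ₀ j) k ≈⟨ act-inverse g⁻¹ (vertex τ j) k ⟩
        vertex τ j k            ∎
      τ⊆σ : ∀ {x} → x ∈ range ℝ (vertex τ) → x ∈ range ℝ (vertex σ)
      τ⊆σ (j , x≃τj) = gσ₀⊆σ (proj₁ (matched′ j) ,
        λ k → trans (x≃τj k) (sym (gσ₀≃τ (proj₁ (matched′ j)) j (proj₂ (matched′ j)) k)))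
      σ⊆τ : ∀ {x} → x ∈ range ℝ (vertex σ) → x ∈ range ℝ (vertex τ)
      σ⊆τ x∈σ = locate (σ⊆gσ₀ x∈σ)
        where
        locate : ∀ {x} → x ∈ range ℝ (λ i → act ℝ g (vertex σ₀ i)) → x ∈ range ℝ (vertex τ)
        locate (i , x≃) = proj₁ (matched i) , λ k → trans (x≃ k)
          (gσ₀≃τ i (proj₁ (matched i)) (λ l → ≡.sym (proj₂ (matched i) l)) k)

theorem4p5 : ExcludedMiddle 0ℓ → (ℝ : RealNumbers) →
    ∃! (GLEquivalent ℝ 3) (IsPeriodicTriangulation ℝ 3)
theorem4p5 em ℝ = Kuhn.kuhn em ℝ 3 , KuhnTriangulation.kuhn-triangulation em ℝ ,
  λ triangulation → Uniqueness.g em ℝ triangulation ,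
    (λ {σ} → Uniqueness.T⊆image em ℝ triangulation {σ}) ,
    (λ {σ} → Uniqueness.image⊆T em ℝ triangulation {σ})
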